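{- Let $G$ be the toroidal $L$-grid with $n=L^2$ vertices, let $r$ be a positive integer with $r\le L-2$, let $\mathscr{S}$ be the set of all $r\times r$ subgrids of $G$, and let $\psi$ be the uniform distribution on $\mathscr{S}$. Given $\lambda>1$, if $$q\ge 2^{r^2+8r+3}\,r^{2r^2+4r+1}\,\lambda^{2+\frac2r},$$ then for every $\varepsilon>0$, $\tau(\mathcal{M}_{\mathrm{BD}}^{\mathscr{S},\psi}(G,\lambda,q),\varepsilon)\le 2n\log(n\varepsilon^{ -1})/r^2$.
   Context: The toroidal $L$-grid has vertex set $(\mathbb{Z}/L\mathbb{Z})^2$ with $(a,b)\sim(c,d)$ iff ($a-c=\pm1$ and $b=d$) or ($b-d=\pm1$ and $a=c$). An $r\times r$ subgrid is a set $\{(a+i,b+j):0\le i,j\le r-1\}$. Potts model: configurations $\sigma\in\Omega=[q]^V$, $\mu(\sigma)$ = number of monochromatic edges, Gibbs distribution $\pi(\sigma)\propto\lambda^{\mu(\sigma)}$. $\tau(\mathcal{M},\varepsilon)=\max_x\min\{t:\|P^t(x,\cdot)-\pi\|_{TV}\le\varepsilon\}$. For $S\subseteq V$, $X\in\Omega$, $c\in[q]^S$: $X^{(S,c)}$ equals $c$ on $S$ and $X$ off $S$, and $\mu_{X,S}(c)$ is the number of monochromatic edges of $X^{(S,c)}$ incident with $S$. The $(\mathscr{S},\psi)$-block dynamics $\mathcal{M}_{\mathrm{BD}}^{\mathscr{S},\psi}(G,\lambda,q)$ from $X_t$ picks $S\in\mathscr{S}$ according to $\psi$, picks $c\in[q]^S$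 with probability proportional to $\lambda^{\mu_{X_t,S}(c)}$, and moves to $X_t^{(S,c)}$.
   Formalization: The claim is proved for 0 < ε ≤ n rather than for every ε > 0: when ε > n the bound 2n log(n/ε)/r² is negative while the mixing time is 0, so the claim fails there. -}

module Defs where

open import Algebra.Bundles using (CommutativeRing; Semiring)
import Algebra.Definitions.RawSemiring as RawSemiringDefinitions
open import Data.Bool.Base using (if_then_else_)
import Data.Bool.Properties as Bool
open import Data.Fin.Base as Fin using (Fin; toℕ; remQuot)
open import Data.Fin.Properties as Fin using (any?; nonZeroIndex; toℕ-fromℕ<; toℕ<n)
open import Data.Fin.Subset using (Subset; inside; outside; ∣_∣; _∈_)
open import Data.Fin.Subset.Properties using (_∈?_)
open import Data.List.Base as List
  using (List; allFin; cartesianProduct; cartesianProductWith; deduplicate; filter; foldr; length; upTo)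
open import Data.Nat.Base as ℕ using (ℕ; zero; suc; NonZero; NonTrivial; _!)
open import Data.Nat.DivMod using (_mod_; m<n⇒m%n≡m; n%n≡0)
import Data.Nat.Properties as ℕ
open import Data.Product.Base using (∃; ∃-syntax; _×_; _,_; proj₁; proj₂)
open import Data.Product.Properties using () renaming (≡-dec to ×-≡-dec)
open import Data.Sum.Base using (_⊎_; inj₁; inj₂; swap; [_,_]′)
open import Data.Vec.Base as Vec using (Vec; []; _∷_; lookup; tabulate)
open import Data.Vec.Properties using () renaming (≡-dec to Vec-≡-dec)
open import Function.Base using (_∘_)
open import Level using (0ℓ)
open import Relation.Binary.Core using (Rel)
open import Relation.Binary.Definitions using (Decidable; DecidableEquality; Symmetric)
import Relation.Binary.Construct.StrictToNonStrict as StrictToNonStrict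
open import Relation.Binary.PropositionalEquality using (_≡_; refl; sym; trans; cong; subst)
open import Relation.Binary.Structures using (IsStrictTotalOrder)
open import Relation.Nullary using (¬_; does; _×-dec_; _⊎-dec_)

------------------------------------------------------------------------
-- The real numbers

-- ℝ is characterised as the Dedekind-complete ordered field.  The order is
-- classical: trichotomy is decidable.  The Archimedean property follows
-- classically from `lub`; it is a field because extracting the natural number
-- is not possible constructively.  The value of 0# ⁻¹ is unspecified.
record RealNumbers : Set₁ where
  infix 4 _<_
  infix 8 _⁻¹
  field
    commutativeRing : CommutativeRing 0ℓ 0ℓ

  open CommutativeRing commutativeRing public
    hiding (refl; sym; trans; zero; _≉_)
  open RawSemiringDefinitions (Semiring.rawSemiring semiring) public
    using (_^_) renaming (_×_ to _ℕ×_)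

  field
    _<_                : Rel Carrier 0ℓ
    isStrictTotalOrder : IsStrictTotalOrder _≈_ _<_
    0<1                : 0# < 1#
    +-monoˡ-<          : ∀ z {x y} → x < y → x + z < y + z
    *-pos              : ∀ {x y} → 0# < x → 0# < y → 0# < x * y
    _⁻¹                : Carrier → Carrier
    ⁻¹-cong            : ∀ {x y} → x ≈ y → x ⁻¹ ≈ y ⁻¹
    ⁻¹-inverseʳ        : ∀ {x} → ¬ (x ≈ 0#) → x * x ⁻¹ ≈ 1#

  open IsStrictTotalOrder isStrictTotalOrder public using (compare; _<?_)
  open StrictToNonStrict _≈_ _<_ public using (_≤_)

  fromℕ : ℕ → Carrier
  fromℕ n = n ℕ× 1#

  IsUpperBound : (Carrier → Set) → Carrier → Set
  IsUpperBound P b = ∀ {x} → P x → x ≤ b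

  field
    archimedean : ∀ x → ∃[ n ] x < fromℕ n
    lub         : ∀ (P : Carrier → Set) → ∃ P → ∃ (IsUpperBound P) →
                  ∃[ s ] IsUpperBound P s × (∀ b → IsUpperBound P b → s ≤ b)

  infixl 7 _/_
  _/_ : Carrier → Carrier → Carrier
  x / y = x * y ⁻¹

  abs : Carrier → Carrier
  abs x = if does (x <? 0#) then - x else x

  Σ[_] : ∀ {A : Set} → List A → (A → Carrier) → Carrier
  Σ[ xs ] f = foldr (λ x s → f x + s) 0# xs

  -- y = x^(a/b), for x > 0.
  IsRationalPower : Carrier → ℕ → (b : ℕ) → .{{NonZero b}} → Carrier → Set
  IsRationalPower x a b y = 0# < y × y ^ b ≈ x ^ a

  _⟶_ : (ℕ → Carrier) → Carrier → Set
  f ⟶ y = ∀ δ → 0# < δ → ∃[ N ] (∀ m → N ℕ.≤ m → abs (f m - y) < δ)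

  IsExp : Carrier → Carrier → Set
  IsExp x y = (λ m → Σ[ upTo m ] (λ k → x ^ k / fromℕ (k !))) ⟶ y

  IsLog : Carrier → Carrier → Set
  IsLog x y = IsExp y x

------------------------------------------------------------------------
-- Graphs

record Graph (n : ℕ) : Set₁ where
  infix 4 _~_ _~?_
  field
    _~_    : Rel (Fin n) 0ℓ
    _~?_   : Decidable _~_
    ~-sym  : Symmetric _~_
    ~-irr  : ∀ {u} → ¬ (u ~ u)

  -- Each unordered edge is listed once, smaller endpoint first.
  edges : List (Fin n × Fin n)
  edges = filter (λ (u , v) → (u Fin.<? v) ×-dec (u ~? v))
                 (cartesianProduct (allFin n) (allFin n))

infixl 6 _⊕_
_⊕_ : ∀ {L} → Fin L → ℕ → Fin L
_⊕_ {L} a i = (toℕ a ℕ.+ i) mod L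
  where instance L≢0 = nonZeroIndex a

private
  ⊕1-irr : ∀ {L} → .{{NonTrivial L}} → (a : Fin L) → ¬ (a ≡ a ⊕ 1)
  ⊕1-irr {L} a a≡a+1 = [ below , atTop ]′ (ℕ.m≤n⇒m<n∨m≡n 1+a≤L)
    where
    instance L≢0 = nonZeroIndex a

    1+a≤L : toℕ a ℕ.+ 1 ℕ.≤ L
    1+a≤L = subst (ℕ._≤ L) (ℕ.+-comm 1 (toℕ a)) (toℕ<n a)

    a≡[a+1]%L : toℕ a ≡ (toℕ a ℕ.+ 1) ℕ.% L
    a≡[a+1]%L = trans (cong toℕ a≡a+1) (toℕ-fromℕ< _)

    below : ¬ (toℕ a ℕ.+ 1 ℕ.< L)
    below a+1<L = ℕ.1+n≢n (sym (trans (trans a≡[a+1]%L (m<n⇒m%n≡m a+1<L)) (ℕ.+-comm (toℕ a) 1)))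

    atTop : ¬ (toℕ a ℕ.+ 1 ≡ L)
    atTop a+1≡L = ℕ.<-irrefl 1≡L (ℕ.nonTrivial⇒n>1 L)
      where
      a≡0 : toℕ a ≡ 0
      a≡0 = trans a≡[a+1]%L (trans (cong (ℕ._% L) a+1≡L) (n%n≡0 L))
      1≡L : 1 ≡ L
      1≡L = trans (cong (ℕ._+ 1) (sym a≡0)) a+1≡L

coordinates : ∀ {L} → Fin (L ℕ.* L) → Fin L × Fin L
coordinates {L} = remQuot L

-- a - c = ±1 in ℤ/L.
Consecutive : ∀ {L} → Rel (Fin L) 0ℓ
Consecutive a c = (a ≡ c ⊕ 1) ⊎ (c ≡ a ⊕ 1)

consecutive? : ∀ {L} → Decidable (Consecutive {L})
consecutive? a c = (a Fin.≟ (c ⊕ 1)) ⊎-dec (c Fin.≟ (a ⊕ 1))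

-- The vertex set (ℤ/L)² is numbered by Fin (L * L) through `coordinates`.
toroidalGrid : ∀ L → .{{NonTrivial L}} → Graph (L ℕ.* L)
toroidalGrid L = record
  { _~_   = λ u v → Adjacent (coordinates u) (coordinates v)
  ; _~?_  = λ u v → adjacent? (coordinates u) (coordinates v)
  ; ~-sym = λ where
      (inj₁ (p , b≡d)) → inj₁ (swap p , sym b≡d)
      (inj₂ (p , a≡c)) → inj₂ (swap p , sym a≡c)
  ; ~-irr = λ where
      (inj₁ (p , _)) → [ ⊕1-irr _ , ⊕1-irr _ ]′ p
      (inj₂ (p , _)) → [ ⊕1-irr _ , ⊕1-irr _ ]′ p
  }
  where
  Adjacent : Rel (Fin L × Fin L) 0ℓ
  Adjacent (a , b) (c , d) = (Consecutive a c × b ≡ d) ⊎ (Consecutive b d × a ≡ c)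

  adjacent? : Decidable Adjacent
  adjacent? (a , b) (c , d) =
    (consecutive? a c ×-dec (b Fin.≟ d)) ⊎-dec (consecutive? b d ×-dec (a Fin.≟ c))

subgrid : ∀ {L} → ℕ → Fin L × Fin L → Subset (L ℕ.* L)
subgrid {L} r (a , b) = tabulate λ v → does
  (any? {r} λ i → any? {r} λ j →
    ×-≡-dec Fin._≟_ Fin._≟_ (coordinates {L} v) (a ⊕ toℕ i , b ⊕ toℕ j))

-- The set of all r × r subgrids, listed without repetition.
subgrids : ∀ L → ℕ → List (Subset (L ℕ.* L))
subgrids L r = deduplicate (Vec-≡-dec Bool._≟_)
  (List.map (subgrid r) (cartesianProduct (allFin L) (allFin L)))

------------------------------------------------------------------------
-- Configurations

Config : ℕ → ℕ → Set
Config n q = Vec (Fin q) n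

_≟ᶜ_ : ∀ {n q} → DecidableEquality (Config n q)
_≟ᶜ_ = Vec-≡-dec Fin._≟_

configs : ∀ n q → List (Config n q)
configs zero    q = List.[ [] ]
configs (suc n) q = cartesianProductWith _∷_ (allFin q) (configs n q)

-- X^(S,c).  An element c of [q]^S is represented by the vector of its values
-- at the elements of S, in increasing order.
overwrite : ∀ {n q} → Config n q → (S : Subset n) → Config ∣ S ∣ q → Config n q
overwrite []      []            []      = []
overwrite (x ∷ X) (inside  ∷ S) (k ∷ c) = k ∷ overwrite X S c
overwrite (x ∷ X) (outside ∷ S) c       = x ∷ overwrite X S c

module _ {n q : ℕ} (G : Graph n) where
  open Graph G

  monochromaticEdges : Config n q → List (Fin n × Fin n)
  monochromaticEdges σ = filter (λ (u , v) → lookup σ u Fin.≟ lookup σ v) edges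

  μ : Config n q → ℕ
  μ σ = length (monochromaticEdges σ)

  μ[_,_] : Config n q → (S : Subset n) → Config ∣ S ∣ q → ℕ
  μ[ X , S ] c = length
    (filter (λ (u , v) → (u ∈? S) ⊎-dec (v ∈? S)) (monochromaticEdges (overwrite X S c)))

------------------------------------------------------------------------
-- Markov chains on configurations

module Chains (ℝ : RealNumbers) where
  open RealNumbers ℝ

  module _ {n q : ℕ} where

    Distribution : Set
    Distribution = Config n q → Carrier

    TransitionMatrix : Set
    TransitionMatrix = Config n q → Config n q → Carrier

    gibbs : Graph n → Carrier → Distribution
    gibbs G λ′ σ = λ′ ^ μ G σ / Σ[ configs n q ] (λ ρ → λ′ ^ μ G ρ)

    blockDynamics : List (Subset n) → (Subset n → Carrier) → Graph n → Carrier → TransitionMatrix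
    blockDynamics 𝒮 ψ G λ′ X Y =
      Σ[ 𝒮 ] λ S → ψ S *
        Σ[ filter (λ c → overwrite X S c ≟ᶜ Y) (configs ∣ S ∣ q) ] λ c →
          λ′ ^ μ[_,_] G X S c / Σ[ configs ∣ S ∣ q ] (λ d → λ′ ^ μ[_,_] G X S d)

    _^ᴹ_ : TransitionMatrix → ℕ → TransitionMatrix
    (P ^ᴹ zero)  X Y = if does (X ≟ᶜ Y) then 1# else 0#
    (P ^ᴹ suc t) X Y = Σ[ configs n q ] λ Z → P X Z * (P ^ᴹ t) Z Y

    totalVariation : Distribution → Distribution → Carrier
    totalVariation p p′ = Σ[ configs n q ] (λ σ → abs (p σ - p′ σ)) / fromℕ 2

    -- t = min { t : ‖Pᵗ(x,·) - π‖ ≤ ε }.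
    IsMixingTimeFrom : TransitionMatrix → Distribution → Carrier → Config n q → ℕ → Set
    IsMixingTimeFrom P π ε x t = Mixed t × (∀ s → Mixed s → t ℕ.≤ s)
      where
      Mixed : ℕ → Set
      Mixed s = totalVariation ((P ^ᴹ s) x) π ≤ ε

    -- τ is the maximum over x of the mixing times from x.  This includes that
    -- the mixing time from every x is finite.
    IsMixingTime : TransitionMatrix → Distribution → Carrier → ℕ → Set
    IsMixingTime P π ε τ =
      (∀ x → ∃[ t ] IsMixingTimeFrom P π ε x t × t ℕ.≤ τ) ×
      (∃[ x ] IsMixingTimeFrom P π ε x τ)

  -- Only its values at members of 𝒮 are used.
  uniform : ∀ {n} → List (Subset n) → Subset n → Carrier
  uniform 𝒮 _ = 1# / fromℕ (length 𝒮)

-- Instead of a coupling, test functions are contracted: if changing one vertex alters F by at most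
-- K, then it alters the one-step expectation of F by at most (1 - 3r²/(4n)) K. Total variation
-- distance is a difference of expectations of a function of oscillation 1, so n (1 - 3r²/(4n))^t
-- bounds it.
--
-- Only subgrids S next to the changed vertex can do harm, and there are at most 4r² of them; r²
-- subgrids contain the vertex and erase the change. For every boundary condition the update of S is
-- nearly uniform on [q]^S because its partition function is at most (1 + 1/(64r²)) q^(r²). Indeed,
-- call a cell of S old if its colour occurs on the boundary or at an earlier cell. In a row of r
-- cells the r + 1 edges contain at most (1 + 1/r) times as many monochromatic ones as there are old
-- cells, and likewise in columns, so a colouring with k old cells has weight at most λ^((2 + 2/r)
-- k) = p^k. Summing cell by cell gives the bound (q + (4r + r²) p)^(r²), and q is much larger than
-- p.
module Submission where

import Data.Nat.Properties as ℕ
open import Data.List.Extrema ℕ.≤-totalOrder using (argmax; f[xs]≤f[argmax])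
open import Defs
open import Algebra.Bundles
import Algebra.Properties.CommutativeSemigroup as CommutativeSemigroupProperties
import Algebra.Properties.CommutativeSemiring.Exp as CommutativeSemiringExp
import Algebra.Properties.Ring as RingProperties
import Algebra.Properties.Semiring.Exp as SemiringExp
import Algebra.Properties.Semiring.Mult as SemiringMult
import Algebra.Solver.Ring as RingSolver
open import Algebra.Solver.Ring.AlmostCommutativeRing using (AlmostCommutativeRing; fromCommutativeRing; _-Raw-AlmostCommutative⟶_)
open import Data.Bool.Base using (true; false; if_then_else_)
import Data.Bool.Properties as Bool
open import Data.Empty using (⊥; ⊥-elim)
open import Data.Fin.Base as Fin using (Fin; zero; suc; toℕ)
import Data.Fin.Properties as Fin
open import Data.Fin.Subset using (Subset; inside; outside; ∣_∣)
import Data.Fin.Subset as Subset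
open import Data.Fin.Subset.Properties using (_∈?_)
open import Data.Integer.Base as ℤ using (ℤ; -[1+_])
import Data.Integer.Properties as ℤ
open import Data.List.Base as List using (List; []; _∷_; _++_; map; filter; length; allFin; upTo; cartesianProduct; cartesianProductWith)
open import Data.List.Membership.Propositional using (_∈_; _∉_)
open import Data.List.Membership.Propositional.Properties
open import Data.List.Membership.Propositional.Properties.WithK using (unique∧set⇒bag)
import Data.List.Properties as List
open import Data.List.Relation.Binary.BagAndSetEquality using (∼bag⇒↭)
open import Data.List.Relation.Binary.Permutation.Propositional using (_↭_; prep; swap; trans; refl)
open import Data.List.Relation.Unary.All as All using (All; []; _∷_)
open import Data.List.Relation.Unary.AllPairs using ([]; _∷_)
open import Data.List.Relation.Unary.Any using (here; there)
open import Data.List.Relation.Unary.Unique.Propositional using (Unique)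
import Data.List.Relation.Unary.Unique.Propositional.Properties as Unique
open import Data.Maybe.Base using (Maybe; just; nothing)
open import Data.Nat.Base as ℕ using (ℕ; zero; suc; NonZero; NonTrivial; _!; z≤n; s≤s)
open import Data.Nat.DivMod using (m%n<n; m<n⇒m%n≡m; %-distribˡ-+; m%n%n≡m%n; [m+kn]%n≡m%n; m≡m%n+[m/n]*n; m<n*o⇒m/o<n; m*n/n≡m; m<n⇒m/n≡0; +-distrib-/-∣ˡ)
open import Data.Nat.Divisibility using (n∣m*n)
open import Data.Nat.Solver using (module +-*-Solver)
open import Data.Product.Base using (∃-syntax; _×_; _,_; proj₁; proj₂)
open import Data.Product.Properties using () renaming (≡-dec to ×-≡-dec)
open import Data.Sign.Base using (Sign)
open import Data.Sum.Base using (_⊎_; inj₁; inj₂; [_,_]′)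
open import Data.Vec.Base as Vec using ([]; _∷_; lookup; _[_]≔_)
import Data.Vec.Properties as Vec
open import Function.Base using (_∘_)
open import Function.Bundles using (mk⇔)
open import Level using (0ℓ)
open import Relation.Binary.Bundles using (StrictPartialOrder)
import Relation.Binary.Construct.StrictToNonStrict as StrictToNonStrict
open import Relation.Binary.Definitions using (tri<; tri≈; tri>)
open import Relation.Binary.PropositionalEquality as ≡ using (_≡_; _≢_; cong; cong₂; subst; subst₂; module ≡-Reasoning)
import Relation.Binary.Reasoning.StrictPartialOrder as StrictPartialOrderReasoning
open import Relation.Binary.Structures using (IsStrictTotalOrder)
open import Relation.Nullary using (¬_; Dec; yes; no; does; ¬?; _×-dec_; _⊎-dec_)

-- The numbers behind the rate: on one subgrid a function that changes by at most K per vertex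
-- varies by at most r² K, while the weights exceed 1 by at most 1/(64 r²) of their total. So the
-- mean after an update differs from the uniform mean by at most 2 r² K / (64 r²) = K/32. Applied on
-- both sides of a change next to the subgrid, this lets the mean change by at most K + K/16, and r²
-- - 4 r²/16 = 3 r²/4. With functions instead of a coupling no joint distribution has to be built:
-- each case compares two finite sums over the same colourings. Rounding 2n log(n/ε)/r² down costs
-- one step, and the surplus of 3/4 over 1/2 covers it once log(n/ε) ≥ 3/2. The other obstacle is
-- the logarithm, which is given only by the convergent series of its exponential. The estimate 1 -
-- x ≤ e^(-x) is replaced by an inequality between partial sums, and the sign of the logarithm,
-- where the series alternates, is settled by an Euler scheme.

module OrderedField (ℝ : RealNumbers) where
  open RealNumbers ℝ public
  open CommutativeRing commutativeRing public using ()
    renaming (refl to ≈-refl; sym to ≈-sym; trans to ≈-trans; reflexive to ≈-reflexive)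
  open RingProperties ring public using (-‿distribˡ-*; -0#≈0#; -‿+-comm; -‿involutive)
  open SemiringExp semiring public using (^-congˡ; ^-homo-*; ^-assocʳ)
  open CommutativeSemiringExp commutativeSemiring public using (^-distrib-*)
  open SemiringMult semiring public using (×-homo-+; ×1-homo-*)

  strictPartialOrder : StrictPartialOrder 0ℓ 0ℓ 0ℓ
  strictPartialOrder = record
    { isStrictPartialOrder = IsStrictTotalOrder.isStrictPartialOrder isStrictTotalOrder }

  module ≤-Reasoning = StrictPartialOrderReasoning strictPartialOrder
  open StrictPartialOrder strictPartialOrder public using ()
    renaming (trans to <-trans; irrefl to <-irrefl; asym to <-asym; <-respʳ-≈ to <-respʳ; <-respˡ-≈ to <-respˡ)

  private
    -- Lets the ring solver use integer numerals. A numeral denotes its `fromℕ`, so 1 becomes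
    -- `1# + 0#`, not `1#`; identities that mention `1#` itself pass it as a variable or rewrite it
    -- by `fromℕ-1`.
    coefficient : ℤ → Carrier
    coefficient (ℤ.+ n)    = fromℕ n
    coefficient -[1+ n ] = - fromℕ (suc n)

    coefficient-neg : ∀ i → coefficient (ℤ.- i) ≈ - coefficient i
    coefficient-neg (ℤ.+ zero)  = ≈-sym -0#≈0#
    coefficient-neg (ℤ.+ suc n) = ≈-refl
    coefficient-neg -[1+ n ]  = ≈-sym (-‿involutive _)

    cancel-1 : ∀ a b → a - b ≈ (1# + a) - (1# + b)
    cancel-1 a b = ≈-sym (begin-equality
      (1# + a) + - (1# + b)     ≈⟨ +-congˡ (≈-sym (-‿+-comm 1# b)) ⟩
      (1# + a) + (- 1# + - b)   ≈⟨ +-congʳ (+-comm 1# a) ⟩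
      (a + 1#) + (- 1# + - b)   ≈⟨ +-assoc a 1# _ ⟩
      a + (1# + (- 1# + - b))   ≈⟨ +-congˡ (+-assoc 1# (- 1#) (- b)) ⟨
      a + ((1# + - 1#) + - b)   ≈⟨ +-congˡ (+-congʳ (-‿inverseʳ 1#)) ⟩
      a + (0# + - b)            ≈⟨ +-congˡ (+-identityˡ (- b)) ⟩
      a - b ∎)
      where open ≤-Reasoning

    coefficient-⊖ : ∀ m n → coefficient (m ℤ.⊖ n) ≈ fromℕ m - fromℕ n
    coefficient-⊖ zero zero = ≈-sym (-‿inverseʳ 0#)
    coefficient-⊖ zero (suc n) = ≈-sym (+-identityˡ _)
    coefficient-⊖ (suc m) zero = ≈-sym (≈-trans (+-congˡ -0#≈0#) (+-identityʳ _))
    coefficient-⊖ (suc m) (suc n) =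
      ≈-trans (≈-reflexive (cong coefficient (ℤ.[1+m]⊖[1+n]≡m⊖n m n)))
        (≈-trans (coefficient-⊖ m n) (cancel-1 _ _))

    coefficient-+ : ∀ i j → coefficient (i ℤ.+ j) ≈ coefficient i + coefficient j
    coefficient-+ (ℤ.+ m) (ℤ.+ n) = ×-homo-+ 1# m n
    coefficient-+ (ℤ.+ m) -[1+ n ] = coefficient-⊖ m (suc n)
    coefficient-+ -[1+ m ] (ℤ.+ n) = ≈-trans (coefficient-⊖ n (suc m)) (+-comm _ _)
    coefficient-+ -[1+ m ] -[1+ n ] = ≈-trans
      (-‿cong (≈-trans (≈-reflexive (cong fromℕ (cong suc (≡.sym (ℕ.+-suc m n))))) (×-homo-+ 1# (suc m) (suc n))))
      (≈-sym (-‿+-comm _ _))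

    coefficient-◃ : ∀ n → coefficient (Sign.- ℤ.◃ n) ≈ - fromℕ n
    coefficient-◃ zero = ≈-sym -0#≈0#
    coefficient-◃ (suc n) = ≈-refl

    coefficient-◃+ : ∀ n → coefficient (Sign.+ ℤ.◃ n) ≈ fromℕ n
    coefficient-◃+ zero = ≈-refl
    coefficient-◃+ (suc n) = ≈-refl

    coefficient-* : ∀ i j → coefficient (i ℤ.* j) ≈ coefficient i * coefficient j
    coefficient-* (ℤ.+ m) (ℤ.+ n) = ≈-trans (coefficient-◃+ (m ℕ.* n)) (×1-homo-* m n)
    coefficient-* (ℤ.+ m) -[1+ n ] = begin-equality
      coefficient (Sign.- ℤ.◃ (m ℕ.* suc n)) ≈⟨ coefficient-◃ (m ℕ.* suc n) ⟩
      - fromℕ (m ℕ.* suc n)                  ≈⟨ -‿cong (×1-homo-* m (suc n)) ⟩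
      - (fromℕ m * fromℕ (suc n))            ≈⟨ RingProperties.-‿distribʳ-* ring _ _ ⟩
      fromℕ m * - fromℕ (suc n)              ∎
      where open ≤-Reasoning
    coefficient-* -[1+ m ] (ℤ.+ n) = begin-equality
      coefficient (Sign.- ℤ.◃ (suc m ℕ.* n)) ≈⟨ coefficient-◃ (suc m ℕ.* n) ⟩
      - fromℕ (suc m ℕ.* n)                  ≈⟨ -‿cong (×1-homo-* (suc m) n) ⟩
      - (fromℕ (suc m) * fromℕ n)            ≈⟨ -‿distribˡ-* _ _ ⟩
      - fromℕ (suc m) * fromℕ n              ∎
      where open ≤-Reasoning
    coefficient-* -[1+ m ] -[1+ n ] = begin-equality
      fromℕ (suc m ℕ.* suc n)             ≈⟨ ×1-homo-* (suc m) (suc n) ⟩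
      fromℕ (suc m) * fromℕ (suc n)       ≈⟨ -‿involutive _ ⟨
      - - (fromℕ (suc m) * fromℕ (suc n)) ≈⟨ -‿cong (-‿distribˡ-* _ _) ⟩
      - (- fromℕ (suc m) * fromℕ (suc n)) ≈⟨ RingProperties.-‿distribʳ-* ring _ _ ⟩
      - fromℕ (suc m) * - fromℕ (suc n)   ∎
      where open ≤-Reasoning

    almostCommutativeRing : AlmostCommutativeRing 0ℓ 0ℓ
    almostCommutativeRing = fromCommutativeRing commutativeRing

    integerCoefficients : RawRing 0ℓ 0ℓ
    integerCoefficients = record
      { Carrier = ℤ ; _≈_ = _≡_ ; _+_ = ℤ._+_ ; _*_ = ℤ._*_ ; -_ = ℤ.-_ ; 0# = ℤ.0ℤ ; 1# = ℤ.1ℤ }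

    morphism : integerCoefficients -Raw-AlmostCommutative⟶ almostCommutativeRing
    morphism = record
      { ⟦_⟧ = coefficient ; +-homo = coefficient-+ ; *-homo = coefficient-*
      ; -‿homo = coefficient-neg ; 0-homo = ≈-refl ; 1-homo = +-identityʳ 1# }

    equal? : ∀ i j → Maybe (coefficient i ≈ coefficient j)
    equal? i j with i ℤ.≟ j
    ... | yes i≡j = just (≈-reflexive (cong coefficient i≡j))
    ... | no _    = nothing

  module RingIdentity = RingSolver integerCoefficients almostCommutativeRing morphism equal?
  open RingIdentity public using (solve; con; _:+_; _:*_; _:-_; :-_; _:^_; _:=_)

  -- Arithmetic of the ordered field

  module NonStrict = StrictToNonStrict _≈_ _<_
  open NonStrict public using (<⇒≤)

  ≤-reflexive : ∀ {x y} → x ≈ y → x ≤ y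
  ≤-reflexive = inj₂

  ≤-refl : ∀ {x} → x ≤ x
  ≤-refl = inj₂ ≈-refl

  ≤-trans : ∀ {x y z} → x ≤ y → y ≤ z → x ≤ z
  ≤-trans {x} {y} {z} x≤y y≤z = begin
    x ≤⟨ x≤y ⟩ y ≤⟨ y≤z ⟩ z ∎
    where open ≤-Reasoning

  ≤-antisym : ∀ {x y} → x ≤ y → y ≤ x → x ≈ y
  ≤-antisym (inj₂ x≈y) _ = x≈y
  ≤-antisym (inj₁ _) (inj₂ y≈x) = ≈-sym y≈x
  ≤-antisym (inj₁ x<y) (inj₁ y<x) = ⊥-elim (<-asym x<y y<x)

  <-≤-trans : ∀ {x y z} → x < y → y ≤ z → x < z
  <-≤-trans x<y (inj₁ y<z) = <-trans x<y y<z
  <-≤-trans x<y (inj₂ y≈z) = <-respʳ y≈z x<y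

  ≤-<-trans : ∀ {x y z} → x ≤ y → y < z → x < z
  ≤-<-trans (inj₁ x<y) y<z = <-trans x<y y<z
  ≤-<-trans (inj₂ x≈y) y<z = <-respˡ (≈-sym x≈y) y<z

  <⇒≱ : ∀ {x y} → x < y → ¬ (y ≤ x)
  <⇒≱ x<y y≤x = <-irrefl ≈-refl (<-≤-trans x<y y≤x)

  ≤-or-< : ∀ x y → x ≤ y ⊎ y < x
  ≤-or-< x y with compare x y
  ... | tri< x<y _ _ = inj₁ (inj₁ x<y)
  ... | tri≈ _ x≈y _ = inj₁ (inj₂ x≈y)
  ... | tri> _ _ y<x = inj₂ y<x

  ≮⇒≥ : ∀ {x y} → ¬ (x < y) → y ≤ x
  ≮⇒≥ {x} {y} x≮y with ≤-or-< y x
  ... | inj₁ y≤x = y≤x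
  ... | inj₂ x<y = ⊥-elim (x≮y x<y)

  ≰⇒> : ∀ {x y} → ¬ (x ≤ y) → y < x
  ≰⇒> {x} {y} x≰y with ≤-or-< x y
  ... | inj₁ x≤y = ⊥-elim (x≰y x≤y)
  ... | inj₂ y<x = y<x

  _≤?_ : ∀ x y → Dec (x ≤ y)
  x ≤? y with ≤-or-< x y
  ... | inj₁ x≤y = yes x≤y
  ... | inj₂ y<x = no (<⇒≱ y<x)

  +-monoˡ-≤ : ∀ z {x y} → x ≤ y → x + z ≤ y + z
  +-monoˡ-≤ z (inj₁ x<y) = inj₁ (+-monoˡ-< z x<y)
  +-monoˡ-≤ z (inj₂ x≈y) = inj₂ (+-congʳ x≈y)

  +-monoʳ-≤ : ∀ z {x y} → x ≤ y → z + x ≤ z + y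
  +-monoʳ-≤ z {x} {y} x≤y = begin
    z + x ≈⟨ +-comm z x ⟩ x + z ≤⟨ +-monoˡ-≤ z x≤y ⟩ y + z ≈⟨ +-comm y z ⟩ z + y ∎
    where open ≤-Reasoning

  +-mono-≤ : ∀ {x y u v} → x ≤ y → u ≤ v → x + u ≤ y + v
  +-mono-≤ x≤y u≤v = ≤-trans (+-monoˡ-≤ _ x≤y) (+-monoʳ-≤ _ u≤v)

  x≤y⇒0≤y-x : ∀ {x y} → x ≤ y → 0# ≤ y - x
  x≤y⇒0≤y-x {x} {y} x≤y = begin
    0# ≈⟨ -‿inverseʳ x ⟨ x - x ≤⟨ +-monoˡ-≤ (- x) x≤y ⟩ y - x ∎
    where open ≤-Reasoning

  x<y⇒0<y-x : ∀ {x y} → x < y → 0# < y - x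
  x<y⇒0<y-x {x} {y} x<y = begin-strict
    0# ≈⟨ -‿inverseʳ x ⟨ x - x <⟨ +-monoˡ-< (- x) x<y ⟩ y - x ∎
    where open ≤-Reasoning

  -- An inequality becomes a ring identity with an explicit nonnegative slack `d`, which the solver
  -- can check.
  gap-≤ : ∀ {d x y} → 0# ≤ d → x + d ≈ y → x ≤ y
  gap-≤ {d} {x} {y} 0≤d x+d≈y = begin
    x ≈⟨ +-identityʳ x ⟨ x + 0# ≤⟨ +-monoʳ-≤ x 0≤d ⟩ x + d ≈⟨ x+d≈y ⟩ y ∎
    where open ≤-Reasoning

  gap-< : ∀ {d x y} → 0# < d → x + d ≈ y → x < y
  gap-< {d} {x} {y} 0<d x+d≈y = begin-strict
    x ≈⟨ +-identityˡ x ⟨ 0# + x <⟨ +-monoˡ-< x 0<d ⟩ d + x ≈⟨ +-comm d x ⟩ x + d ≈⟨ x+d≈y ⟩ y ∎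
    where open ≤-Reasoning

  +-nonneg : ∀ {x y} → 0# ≤ x → 0# ≤ y → 0# ≤ x + y
  +-nonneg 0≤x 0≤y = ≤-trans (≤-reflexive (≈-sym (+-identityʳ 0#))) (+-mono-≤ 0≤x 0≤y)

  *-nonneg : ∀ {x y} → 0# ≤ x → 0# ≤ y → 0# ≤ x * y
  *-nonneg (inj₁ 0<x) (inj₁ 0<y) = inj₁ (*-pos 0<x 0<y)
  *-nonneg {x} {y} (inj₁ _) (inj₂ 0≈y) = inj₂ (≈-trans (≈-sym (zeroʳ x)) (*-congˡ 0≈y))
  *-nonneg {x} {y} (inj₂ 0≈x) _ = inj₂ (≈-trans (≈-sym (zeroˡ y)) (*-congʳ 0≈x))

  neg-mono-≤ : ∀ {x y} → x ≤ y → - y ≤ - x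
  neg-mono-≤ {x} {y} x≤y = gap-≤ (x≤y⇒0≤y-x x≤y) (solve 2 (λ x y → :- y :+ (y :- x) := :- x) ≈-refl x y)

  *-monoˡ-≤ : ∀ {z x y} → 0# ≤ z → x ≤ y → z * x ≤ z * y
  *-monoˡ-≤ {z} {x} {y} 0≤z x≤y = gap-≤ (*-nonneg 0≤z (x≤y⇒0≤y-x x≤y))
    (solve 3 (λ x y z → z :* x :+ z :* (y :- x) := z :* y) ≈-refl x y z)

  *-monoʳ-≤ : ∀ {z x y} → 0# ≤ z → x ≤ y → x * z ≤ y * z
  *-monoʳ-≤ {z} {x} {y} 0≤z x≤y = begin
    x * z ≈⟨ *-comm x z ⟩ z * x ≤⟨ *-monoˡ-≤ 0≤z x≤y ⟩ z * y ≈⟨ *-comm z y ⟩ y * z ∎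
    where open ≤-Reasoning

  *-mono-≤ : ∀ {x y u v} → 0# ≤ u → 0# ≤ y → x ≤ y → u ≤ v → x * u ≤ y * v
  *-mono-≤ 0≤u 0≤y x≤y u≤v = ≤-trans (*-monoʳ-≤ 0≤u x≤y) (*-monoˡ-≤ 0≤y u≤v)

  *-monoˡ-< : ∀ {z x y} → 0# < z → x < y → z * x < z * y
  *-monoˡ-< {z} {x} {y} 0<z x<y = gap-< (*-pos 0<z (x<y⇒0<y-x x<y))
    (solve 3 (λ x y z → z :* x :+ z :* (y :- x) := z :* y) ≈-refl x y z)

  *-cancelˡ-≤ : ∀ {z x y} → 0# < z → z * x ≤ z * y → x ≤ y
  *-cancelˡ-≤ 0<z zx≤zy = ≮⇒≥ (λ y<x → <⇒≱ (*-monoˡ-< 0<z y<x) zx≤zy)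

  0≤1 : 0# ≤ 1#
  0≤1 = inj₁ 0<1

  ^-nonneg : ∀ {x} n → 0# ≤ x → 0# ≤ x ^ n
  ^-nonneg zero    0≤x = 0≤1
  ^-nonneg (suc n) 0≤x = *-nonneg 0≤x (^-nonneg n 0≤x)

  ^-pos : ∀ {x} n → 0# < x → 0# < x ^ n
  ^-pos zero    0<x = 0<1
  ^-pos (suc n) 0<x = *-pos 0<x (^-pos n 0<x)

  ^-mono-≤ : ∀ {x y} n → 0# ≤ x → x ≤ y → x ^ n ≤ y ^ n
  ^-mono-≤ zero    0≤x x≤y = ≤-refl
  ^-mono-≤ (suc n) 0≤x x≤y = *-mono-≤ (^-nonneg n 0≤x) (≤-trans 0≤x x≤y) x≤y (^-mono-≤ n 0≤x x≤y)

  ^-mono-< : ∀ {x y} n → .{{NonZero n}} → 0# ≤ x → x < y → x ^ n < y ^ n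
  ^-mono-< {x} {y} (suc n) 0≤x x<y = ≤-<-trans
    (*-monoˡ-≤ 0≤x (^-mono-≤ n 0≤x (<⇒≤ x<y)))
    (<-respˡ (*-comm (y ^ n) x) (<-respʳ (*-comm (y ^ n) y)
      (*-monoˡ-< (^-pos n (≤-<-trans 0≤x x<y)) x<y)))

  ^-cancel-≤ : ∀ {x y} n → .{{NonZero n}} → 0# ≤ y → x ^ n ≤ y ^ n → x ≤ y
  ^-cancel-≤ n 0≤y xⁿ≤yⁿ = ≮⇒≥ (λ y<x → <⇒≱ (^-mono-< n 0≤y y<x) xⁿ≤yⁿ)

  1≤^ : ∀ {x} n → 1# ≤ x → 1# ≤ x ^ n
  1≤^ zero    1≤x = ≤-refl
  1≤^ (suc n) 1≤x = ≤-trans (≤-reflexive (≈-sym (*-identityˡ 1#)))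
    (*-mono-≤ 0≤1 (≤-trans 0≤1 1≤x) 1≤x (1≤^ n 1≤x))

  ^-monoʳ-≤ : ∀ {x m n} → 1# ≤ x → m ℕ.≤ n → x ^ m ≤ x ^ n
  ^-monoʳ-≤ {x} {m} 1≤x m≤n with ℕ.m≤n⇒∃[o]m+o≡n m≤n
  ... | k , ≡.refl = begin
    x ^ m         ≈⟨ *-identityʳ _ ⟨
    x ^ m * 1#    ≤⟨ *-monoˡ-≤ (^-nonneg m (≤-trans 0≤1 1≤x)) (1≤^ k 1≤x) ⟩
    x ^ m * x ^ k ≈⟨ ^-homo-* x m k ⟨
    x ^ (m ℕ.+ k) ∎
    where open ≤-Reasoning

  fromℕ-nonneg : ∀ n → 0# ≤ fromℕ n
  fromℕ-nonneg zero    = ≤-refl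
  fromℕ-nonneg (suc n) = +-nonneg 0≤1 (fromℕ-nonneg n)

  fromℕ-+ : ∀ m n → fromℕ (m ℕ.+ n) ≈ fromℕ m + fromℕ n
  fromℕ-+ = ×-homo-+ 1#

  fromℕ-* : ∀ m n → fromℕ (m ℕ.* n) ≈ fromℕ m * fromℕ n
  fromℕ-* = ×1-homo-*

  fromℕ-^ : ∀ m n → fromℕ (m ℕ.^ n) ≈ fromℕ m ^ n
  fromℕ-^ m zero    = +-identityʳ 1#
  fromℕ-^ m (suc n) = ≈-trans (fromℕ-* m (m ℕ.^ n)) (*-congˡ (fromℕ-^ m n))

  fromℕ-mono-≤ : ∀ {m n} → m ℕ.≤ n → fromℕ m ≤ fromℕ n
  fromℕ-mono-≤ {m} m≤n with ℕ.m≤n⇒∃[o]m+o≡n m≤n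
  ... | k , ≡.refl = gap-≤ (fromℕ-nonneg k) (≈-sym (fromℕ-+ m k))

  fromℕ-pos : ∀ n → .{{NonZero n}} → 0# < fromℕ n
  fromℕ-pos (suc n) = <-≤-trans 0<1 (gap-≤ (fromℕ-nonneg n) ≈-refl)

  fromℕ-mono-< : ∀ {m n} → m ℕ.< n → fromℕ m < fromℕ n
  fromℕ-mono-< {m} m<n = <-≤-trans
    (gap-< 0<1 (+-comm _ _)) (fromℕ-mono-≤ m<n)

  fromℕ-1 : fromℕ 1 ≈ 1#
  fromℕ-1 = +-identityʳ 1#

  pos⇒≉0 : ∀ {x} → 0# < x → ¬ (x ≈ 0#)
  pos⇒≉0 0<x x≈0 = <-irrefl (≈-sym x≈0) 0<x

  *-inverseʳ : ∀ {x} → 0# < x → x * x ⁻¹ ≈ 1#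
  *-inverseʳ 0<x = ⁻¹-inverseʳ (pos⇒≉0 0<x)

  ⁻¹-pos : ∀ {x} → 0# < x → 0# < x ⁻¹
  ⁻¹-pos {x} 0<x with ≤-or-< (x ⁻¹) 0#
  ... | inj₂ 0<x⁻¹ = 0<x⁻¹
  ... | inj₁ x⁻¹≤0 = ⊥-elim (<⇒≱ 0<1 (begin
    1#       ≈⟨ *-inverseʳ 0<x ⟨
    x * x ⁻¹ ≤⟨ *-monoˡ-≤ (inj₁ 0<x) x⁻¹≤0 ⟩
    x * 0#   ≈⟨ zeroʳ x ⟩
    0#       ∎))
    where open ≤-Reasoning

  /-nonneg : ∀ {x y} → 0# ≤ x → 0# < y → 0# ≤ x / y
  /-nonneg 0≤x 0<y = *-nonneg 0≤x (inj₁ (⁻¹-pos 0<y))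

  y*[x/y]≈x : ∀ {x y} → 0# < y → y * (x / y) ≈ x
  y*[x/y]≈x {x} {y} 0<y = begin-equality
    y * (x * y ⁻¹) ≈⟨ solve 3 (λ x y z → y :* (x :* z) := (y :* z) :* x) ≈-refl x y (y ⁻¹) ⟩
    (y * y ⁻¹) * x ≈⟨ *-congʳ (*-inverseʳ 0<y) ⟩
    1# * x         ≈⟨ *-identityˡ x ⟩
    x ∎
    where open ≤-Reasoning

  x≤y*z⇒x/y≤z : ∀ {x y z} → 0# < y → x ≤ y * z → x / y ≤ z
  x≤y*z⇒x/y≤z 0<y x≤yz = *-cancelˡ-≤ 0<y (≤-trans (≤-reflexive (y*[x/y]≈x 0<y)) x≤yz)

  y*z≤x⇒z≤x/y : ∀ {x y z} → 0# < y → y * z ≤ x → z ≤ x / y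
  y*z≤x⇒z≤x/y 0<y yz≤x = *-cancelˡ-≤ 0<y (≤-trans yz≤x (≤-reflexive (≈-sym (y*[x/y]≈x 0<y))))

  *-cancelˡ-≈ : ∀ {z x y} → 0# < z → z * x ≈ z * y → x ≈ y
  *-cancelˡ-≈ 0<z zx≈zy = ≤-antisym
    (*-cancelˡ-≤ 0<z (≤-reflexive zx≈zy)) (*-cancelˡ-≤ 0<z (≤-reflexive (≈-sym zx≈zy)))

  abs-cases : ∀ x → (0# ≤ x × abs x ≡ x) ⊎ (x < 0# × abs x ≡ - x)
  abs-cases x with x <? 0#
  ... | yes x<0 = inj₂ (x<0 , ≡.refl)
  ... | no x≮0  = inj₁ (≮⇒≥ x≮0 , ≡.refl)

  x≤abs : ∀ x → x ≤ abs x
  x≤abs x with abs-cases x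
  ... | inj₁ (_ , p) = ≤-reflexive (≈-reflexive (≡.sym p))
  ... | inj₂ (x<0 , p) = ≤-trans (inj₁ x<0) (≤-trans
      (≤-trans (≤-reflexive (≈-sym -0#≈0#)) (neg-mono-≤ (inj₁ x<0))) (≤-reflexive (≈-reflexive (≡.sym p))))

  -x≤abs : ∀ x → - x ≤ abs x
  -x≤abs x with abs-cases x
  ... | inj₂ (_ , p) = ≤-reflexive (≈-reflexive (≡.sym p))
  ... | inj₁ (0≤x , p) = ≤-trans
      (≤-trans (neg-mono-≤ 0≤x) (≤-reflexive -0#≈0#)) (≤-trans 0≤x (≤-reflexive (≈-reflexive (≡.sym p))))

  half : Carrier
  half = fromℕ 2 ⁻¹

  0<half : 0# < half
  0<half = ⁻¹-pos (fromℕ-pos 2)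

  2*half : fromℕ 2 * half ≈ 1#
  2*half = *-inverseʳ (fromℕ-pos 2)

  half+half : half + half ≈ 1#
  half+half = ≈-trans (solve 1 (λ h → h :+ h := con (ℤ.+ 2) :* h) ≈-refl half) 2*half

  half<1 : half < 1#
  half<1 = gap-< 0<half half+half

  1-half : half ≈ 1# - half
  1-half = ≈-trans (solve 1 (λ h → h := (h :+ h) :- h) ≈-refl half) (+-congʳ half+half)

  2*y≤n⇒y≤n*half : ∀ n {y} → fromℕ 2 * y ≤ fromℕ n → y ≤ fromℕ n * half
  2*y≤n⇒y≤n*half n 2y≤n = *-cancelˡ-≤ (fromℕ-pos 2) (≤-trans 2y≤n (≤-reflexive (≈-trans (≈-sym (*-identityʳ _))
    (≈-trans (*-congˡ (≈-sym 2*half)) (solve 3 (λ a b c → c :* (a :* b) := a :* (c :* b)) ≈-refl (fromℕ 2) half (fromℕ n))))))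

-- Finite sums and sums over recolourings of a vertex set

module Sums (ℝ : RealNumbers) where
  open OrderedField ℝ

  indicator : ∀ {P : Set} → Dec P → Carrier
  indicator d = if does d then 1# else 0#

  indicator-yes : ∀ {P : Set} (d : Dec P) → P → indicator d ≈ 1#
  indicator-yes (yes _) p = ≈-refl
  indicator-yes (no ¬p) p = ⊥-elim (¬p p)

  indicator-no : ∀ {P : Set} (d : Dec P) → ¬ P → indicator d ≈ 0#
  indicator-no (yes p) ¬p = ⊥-elim (¬p p)
  indicator-no (no _)  ¬p = ≈-refl

  indicator-nonneg : ∀ {P : Set} (d : Dec P) → 0# ≤ indicator d
  indicator-nonneg (yes _) = 0≤1
  indicator-nonneg (no _)  = ≤-refl

  indicator-cong : ∀ {P Q : Set} (d : Dec P) (e : Dec Q) → (P → Q) → (Q → P) → indicator d ≈ indicator e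
  indicator-cong (yes p) e f g = ≈-sym (indicator-yes e (f p))
  indicator-cong (no ¬p) e f g = ≈-sym (indicator-no e (¬p ∘ g))

  module _ {A : Set} where

    Σ-mono : ∀ (xs : List A) {f g : A → Carrier} → (∀ x → x ∈ xs → f x ≤ g x) → Σ[ xs ] f ≤ Σ[ xs ] g
    Σ-mono []       f≤g = ≤-refl
    Σ-mono (x ∷ xs) f≤g = +-mono-≤ (f≤g x (here ≡.refl)) (Σ-mono xs (λ y y∈xs → f≤g y (there y∈xs)))

    Σ-cong : ∀ (xs : List A) {f g : A → Carrier} → (∀ x → f x ≈ g x) → Σ[ xs ] f ≈ Σ[ xs ] g
    Σ-cong []       f≈g = ≈-refl
    Σ-cong (x ∷ xs) f≈g = +-cong (f≈g x) (Σ-cong xs f≈g)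

    Σ-+ : ∀ (xs : List A) {f g : A → Carrier} → Σ[ xs ] (λ x → f x + g x) ≈ Σ[ xs ] f + Σ[ xs ] g
    Σ-+ []       = ≈-sym (+-identityʳ 0#)
    Σ-+ (x ∷ xs) {f} {g} = ≈-trans (+-congˡ (Σ-+ xs))
      (solve 4 (λ a b c d → (a :+ b) :+ (c :+ d) := (a :+ c) :+ (b :+ d)) ≈-refl (f x) (g x) _ _)

    Σ-*ˡ : ∀ (xs : List A) {f : A → Carrier} c → Σ[ xs ] (λ x → c * f x) ≈ c * Σ[ xs ] f
    Σ-*ˡ []       c = ≈-sym (zeroʳ c)
    Σ-*ˡ (x ∷ xs) c = ≈-trans (+-congˡ (Σ-*ˡ xs c)) (≈-sym (distribˡ c _ _))

    Σ-*ʳ : ∀ (xs : List A) {f : A → Carrier} c → Σ[ xs ] (λ x → f x * c) ≈ Σ[ xs ] f * c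
    Σ-*ʳ xs c = ≈-trans (Σ-cong xs (λ x → *-comm _ c)) (≈-trans (Σ-*ˡ xs c) (*-comm c _))

    Σ-const : ∀ (xs : List A) c → Σ[ xs ] (λ _ → c) ≈ fromℕ (length xs) * c
    Σ-const []       c = ≈-sym (zeroˡ c)
    Σ-const (x ∷ xs) c = ≈-trans (+-cong (≈-sym (*-identityˡ c)) (Σ-const xs c)) (≈-sym (distribʳ c 1# _))

    Σ-0 : ∀ (xs : List A) → Σ[ xs ] (λ _ → 0#) ≈ 0#
    Σ-0 xs = ≈-trans (Σ-const xs 0#) (zeroʳ _)

    Σ-nonneg : ∀ (xs : List A) {f : A → Carrier} → (∀ x → 0# ≤ f x) → 0# ≤ Σ[ xs ] f
    Σ-nonneg xs 0≤f = ≤-trans (≤-reflexive (≈-sym (Σ-0 xs))) (Σ-mono xs (λ x _ → 0≤f x))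

    Σ-++ : ∀ (xs ys : List A) {f : A → Carrier} → Σ[ xs ++ ys ] f ≈ Σ[ xs ] f + Σ[ ys ] f
    Σ-++ []       ys = ≈-sym (+-identityˡ _)
    Σ-++ (x ∷ xs) ys = ≈-trans (+-congˡ (Σ-++ xs ys)) (≈-sym (+-assoc _ _ _))

    Σ-filter : ∀ {P : A → Set} (P? : ∀ x → Dec (P x)) (xs : List A) {f : A → Carrier} →
               Σ[ filter P? xs ] f ≈ Σ[ xs ] (λ x → indicator (P? x) * f x)
    Σ-filter P? [] = ≈-refl
    Σ-filter P? (x ∷ xs) {f} with P? x
    ... | yes _ = +-cong (≈-sym (*-identityˡ _)) (Σ-filter P? xs)
    ... | no _  = ≈-trans (Σ-filter P? xs) (≈-sym (≈-trans (+-congʳ (zeroˡ _)) (+-identityˡ _)))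

    Σ-point : ∀ (_≟_ : ∀ (x y : A) → Dec (x ≡ y)) {xs : List A} → Unique xs → ∀ {x} → x ∈ xs →
              (g : A → Carrier) → Σ[ xs ] (λ y → indicator (x ≟ y) * g y) ≈ g x
    Σ-point _≟_ {z ∷ xs} (z∉xs ∷ _) {x} (here ≡.refl) g = ≈-trans
      (+-cong (≈-trans (*-congʳ (indicator-yes (x ≟ x) ≡.refl)) (*-identityˡ _)) (vanish xs z∉xs)) (+-identityʳ _)
      where
      vanish : ∀ ys → All (x ≢_) ys → Σ[ ys ] (λ y → indicator (x ≟ y) * g y) ≈ 0#
      vanish []       []             = ≈-refl
      vanish (y ∷ ys) (x≢y ∷ x≢ys) = ≈-trans
        (+-cong (≈-trans (*-congʳ (indicator-no (x ≟ y) x≢y)) (zeroˡ _)) (vanish ys x≢ys)) (+-identityʳ 0#)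
    Σ-point _≟_ {z ∷ xs} (z∉xs ∷ xs!) {x} (there x∈xs) g = ≈-trans
      (+-congʳ (≈-trans (*-congʳ (indicator-no (x ≟ z) (λ x≡z → All.lookup z∉xs x∈xs (≡.sym x≡z)))) (zeroˡ _)))
      (≈-trans (+-identityˡ _) (Σ-point _≟_ xs! x∈xs g))

  module _ {A B : Set} where

    Σ-map : ∀ (h : A → B) (xs : List A) {f : B → Carrier} → Σ[ map h xs ] f ≡ Σ[ xs ] (f ∘ h)
    Σ-map h []       = ≡.refl
    Σ-map h (x ∷ xs) = cong (_ +_) (Σ-map h xs)

    Σ-swap : ∀ (xs : List A) (ys : List B) {f : A → B → Carrier} →
             Σ[ xs ] (λ x → Σ[ ys ] (f x)) ≈ Σ[ ys ] (λ y → Σ[ xs ] (λ x → f x y))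
    Σ-swap []       ys = ≈-sym (Σ-0 ys)
    Σ-swap (x ∷ xs) ys = ≈-trans (+-congˡ (Σ-swap xs ys)) (≈-sym (Σ-+ ys))

  Σ-cartesianProductWith : ∀ {A B C : Set} (h : A → B → C) (xs : List A) (ys : List B) {f : C → Carrier} →
    Σ[ cartesianProductWith h xs ys ] f ≈ Σ[ xs ] (λ x → Σ[ ys ] (λ y → f (h x y)))
  Σ-cartesianProductWith h []       ys = ≈-refl
  Σ-cartesianProductWith h (x ∷ xs) ys = ≈-trans
    (Σ-++ (map (h x) ys) _) (+-cong (≈-reflexive (Σ-map (h x) ys)) (Σ-cartesianProductWith h xs ys))

  -- A transition probability is a sum over the colourings that lead to a given configuration.
  -- Against a test function these fibres merge into one sum over all colourings.
  Σ-fibres : ∀ {A B : Set} (_≟_ : ∀ (x y : B) → Dec (x ≡ y)) {ys : List B} → Unique ys → (∀ y → y ∈ ys) →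
    (g : A → B) (w : A → Carrier) (f : B → Carrier) (xs : List A) →
    Σ[ ys ] (λ y → Σ[ filter (λ x → g x ≟ y) xs ] w * f y) ≈ Σ[ xs ] (λ x → w x * f (g x))
  Σ-fibres _≟_ {ys} ys! complete g w f xs = begin-equality
    Σ[ ys ] (λ y → Σ[ filter (λ x → g x ≟ y) xs ] w * f y)
      ≈⟨ Σ-cong ys (λ y → ≈-trans (*-congʳ (Σ-filter (λ x → g x ≟ y) xs)) (≈-sym (Σ-*ʳ xs (f y)))) ⟩
    Σ[ ys ] (λ y → Σ[ xs ] (λ x → (indicator (g x ≟ y) * w x) * f y))
      ≈⟨ Σ-swap ys xs ⟩
    Σ[ xs ] (λ x → Σ[ ys ] (λ y → (indicator (g x ≟ y) * w x) * f y))
      ≈⟨ Σ-cong xs (λ x → ≈-trans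
           (Σ-cong ys (λ y → solve 3 (λ a b c → (a :* b) :* c := b :* (a :* c)) ≈-refl (indicator (g x ≟ y)) (w x) (f y)))
           (≈-trans (Σ-*ˡ ys (w x)) (*-congˡ (Σ-point _≟_ ys! (complete (g x)) f)))) ⟩
    Σ[ xs ] (λ x → w x * f (g x)) ∎
    where open ≤-Reasoning

  configs! : ∀ {n q} → Unique (configs n q)
  configs! {zero}  = [] ∷ []
  configs! {suc n} = Unique.cartesianProductWith⁺ _∷_ (λ { ≡.refl → ≡.refl , ≡.refl }) (Unique.allFin⁺ _) configs!

  ∈-configs : ∀ {n q} (X : Config n q) → X ∈ configs n q
  ∈-configs []      = here ≡.refl
  ∈-configs (k ∷ X) = ∈-cartesianProductWith⁺ _∷_ (∈-allFin k) (∈-configs X)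

  -- Agreement off `ws`: these are the configurations `Z` that recolouring `X` at `ws` can reach.
  Agree : ∀ {n q} → List (Fin n) → Config n q → Config n q → Set
  Agree ws X Z = ∀ v → v ∉ ws → lookup Z v ≡ lookup X v

  Agree-[] : ∀ {n q} {X Z : Config n q} → Agree [] X Z → Z ≡ X
  Agree-[] {X = []}    {[]}    _     = ≡.refl
  Agree-[] {X = x ∷ X} {z ∷ Z} agree =
    cong₂ _∷_ (agree zero (λ ())) (Agree-[] (λ v _ → agree (suc v) (λ ())))

  -- The sum of F(X^(S,c)) over c ∈ [q]^S, where ws lists S without repetition.
  recolour : ∀ {n q} → List (Fin n) → (Config n q → Carrier) → Config n q → Carrier
  recolour         []       F X = F X
  recolour {q = q} (w ∷ ws) F X = Σ[ allFin q ] (λ k → recolour ws F (X [ w ]≔ k))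

  module _ {n q : ℕ} where

    Agree-update : ∀ {w ws} {X Z : Config n q} k → Agree ws (X [ w ]≔ k) Z → Agree (w ∷ ws) X Z
    Agree-update {X = X} k agree v v∉w∷ws =
      ≡.trans (agree v (v∉w∷ws ∘ there)) (Vec.lookup∘update′ (v∉w∷ws ∘ here) X k)

    recolour-mono : ∀ ws {F G : Config n q → Carrier} {X} → (∀ Z → Agree ws X Z → F Z ≤ G Z) →
                    recolour ws F X ≤ recolour ws G X
    recolour-mono []       F≤G = F≤G _ (λ _ _ → ≡.refl)
    recolour-mono (w ∷ ws) {X = X} F≤G =
      Σ-mono (allFin q) (λ k _ → recolour-mono ws (λ Z agree → F≤G Z (Agree-update {X = X} {Z} k agree)))

    recolour-cong : ∀ ws {F G : Config n q → Carrier} {X} → (∀ Z → Agree ws X Z → F Z ≈ G Z) →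
                    recolour ws F X ≈ recolour ws G X
    recolour-cong ws F≈G = ≤-antisym
      (recolour-mono ws (λ Z agree → ≤-reflexive (F≈G Z agree)))
      (recolour-mono ws (λ Z agree → ≤-reflexive (≈-sym (F≈G Z agree))))

    recolour-+ : ∀ ws {F G : Config n q → Carrier} {X} →
                 recolour ws (λ Z → F Z + G Z) X ≈ recolour ws F X + recolour ws G X
    recolour-+ []       = ≈-refl
    recolour-+ (w ∷ ws) = ≈-trans (Σ-cong (allFin q) (λ k → recolour-+ ws)) (Σ-+ (allFin q))

    recolour-*ˡ : ∀ ws {F : Config n q → Carrier} {X} c →
                  recolour ws (λ Z → c * F Z) X ≈ c * recolour ws F X
    recolour-*ˡ []       c = ≈-refl
    recolour-*ˡ (w ∷ ws) c = ≈-trans (Σ-cong (allFin q) (λ k → recolour-*ˡ ws c)) (Σ-*ˡ (allFin q) c)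

    recolour-const : ∀ ws c {X : Config n q} → recolour ws (λ _ → c) X ≈ fromℕ q ^ length ws * c
    recolour-const []       c = ≈-sym (*-identityˡ c)
    recolour-const (w ∷ ws) c {X} = begin-equality
      Σ[ allFin q ] (λ k → recolour ws (λ _ → c) (X [ w ]≔ k)) ≈⟨ Σ-cong (allFin q) (λ k → recolour-const ws c) ⟩
      Σ[ allFin q ] (λ _ → fromℕ q ^ length ws * c)            ≈⟨ Σ-const (allFin q) _ ⟩
      fromℕ (length (allFin q)) * (fromℕ q ^ length ws * c)
        ≈⟨ *-congʳ (≈-reflexive (cong fromℕ (List.length-tabulate {n = q} (λ i → i)))) ⟩
      fromℕ q * (fromℕ q ^ length ws * c)                      ≈⟨ *-assoc _ _ _ ⟨
      (fromℕ q * fromℕ q ^ length ws) * c                      ∎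
      where open ≤-Reasoning

    -- Every vertex of `ws` is overwritten, so the colours there at the start do not matter.
    recolour-base : ∀ ws {F : Config n q → Carrier} {X Y} → Agree ws X Y → recolour ws F X ≈ recolour ws F Y
    recolour-base []       {F} agree = ≈-reflexive (cong F (≡.sym (Agree-[] agree)))
    recolour-base (w ∷ ws) {F} {X} {Y} agree = Σ-cong (allFin q) (λ k → recolour-base ws (agree′ k))
      where
      agree′ : ∀ k → Agree ws (X [ w ]≔ k) (Y [ w ]≔ k)
      agree′ k v v∉ws with v Fin.≟ w
      ... | yes ≡.refl = ≡.trans (Vec.lookup∘update v Y k) (≡.sym (Vec.lookup∘update v X k))
      ... | no v≢w = ≡.trans (Vec.lookup∘update′ v≢w Y k)
        (≡.trans (agree v λ { (here v≡w) → v≢w v≡w ; (there v∈ws) → v∉ws v∈ws })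
                 (≡.sym (Vec.lookup∘update′ v≢w X k)))

    -- Updates at distinct vertices commute, so a changed vertex `v` moves from the start into the
    -- summand. This lets two starts that differ at `v` be compared colouring by colouring.
    recolour-update : ∀ ws {F : Config n q → Carrier} {X v} b → v ∉ ws →
                      recolour ws F (X [ v ]≔ b) ≈ recolour ws (λ Z → F (Z [ v ]≔ b)) X
    recolour-update []       b v∉ws = ≈-refl
    recolour-update (w ∷ ws) {F} {X} {v} b v∉ws = Σ-cong (allFin q) (λ k → ≈-trans
      (≈-reflexive (cong (recolour ws F) (Vec.[]≔-commutes X v w (v∉ws ∘ here))))
      (recolour-update ws b (v∉ws ∘ there)))

    -- A subset lists its vertices by number, a subgrid lists its cells relative to its corner; the
    -- two orders differ when the subgrid wraps round the torus.
    recolour-↭ : ∀ {ws ws′} {F : Config n q → Carrier} {X} → ws ↭ ws′ → recolour ws F X ≈ recolour ws′ F X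
    recolour-↭ refl = ≈-refl
    recolour-↭ (prep w p) = Σ-cong (allFin q) (λ k → recolour-↭ p)
    recolour-↭ (trans p p′) = ≈-trans (recolour-↭ p) (recolour-↭ p′)
    recolour-↭ {F = F} {X} (swap {ws} {ws′} v w p) with v Fin.≟ w
    ... | yes ≡.refl = Σ-cong (allFin q) (λ j → Σ-cong (allFin q) (λ k → recolour-↭ p))
    ... | no v≢w = ≈-trans
      (Σ-cong (allFin q) (λ j → Σ-cong (allFin q) (λ k → ≈-trans
        (≈-reflexive (cong (recolour ws F) (Vec.[]≔-commutes X v w v≢w))) (recolour-↭ p))))
      (Σ-swap (allFin q) (allFin q))

  -- Each configuration arises from exactly q pairs of a configuration and a new colour, one for
  -- each former colour of `w`.
  Σ-configs-update : ∀ {n q} w (F : Config n q → Carrier) →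
    Σ[ configs n q ] (λ X → Σ[ allFin q ] (λ k → F (X [ w ]≔ k))) ≈ fromℕ q * Σ[ configs n q ] F
  Σ-configs-update {suc n} {q} zero F = begin-equality
    Σ[ configs (suc n) q ] (λ X → Σ[ allFin q ] (λ k → F (X [ zero ]≔ k)))
      ≈⟨ Σ-cartesianProductWith _∷_ (allFin q) (configs n q) ⟩
    Σ[ allFin q ] (λ _ → Σ[ configs n q ] (λ c → Σ[ allFin q ] (λ k → F (k ∷ c))))
      ≈⟨ Σ-const (allFin q) _ ⟩
    fromℕ (length (allFin q)) * Σ[ configs n q ] (λ c → Σ[ allFin q ] (λ k → F (k ∷ c)))
      ≈⟨ *-cong (≈-reflexive (cong fromℕ (List.length-tabulate {n = q} (λ i → i))))
           (≈-trans (Σ-swap (configs n q) (allFin q)) (≈-sym (Σ-cartesianProductWith _∷_ (allFin q) (configs n q)))) ⟩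
    fromℕ q * Σ[ configs (suc n) q ] F ∎
    where open ≤-Reasoning
  Σ-configs-update {suc n} {q} (suc w) F = begin-equality
    Σ[ configs (suc n) q ] (λ X → Σ[ allFin q ] (λ k → F (X [ suc w ]≔ k)))
      ≈⟨ Σ-cartesianProductWith _∷_ (allFin q) (configs n q) ⟩
    Σ[ allFin q ] (λ j → Σ[ configs n q ] (λ c → Σ[ allFin q ] (λ k → F (j ∷ c [ w ]≔ k))))
      ≈⟨ Σ-cong (allFin q) (λ j → Σ-configs-update w (λ c → F (j ∷ c))) ⟩
    Σ[ allFin q ] (λ j → fromℕ q * Σ[ configs n q ] (λ c → F (j ∷ c)))
      ≈⟨ Σ-*ˡ (allFin q) (fromℕ q) ⟩
    fromℕ q * Σ[ allFin q ] (λ j → Σ[ configs n q ] (λ c → F (j ∷ c)))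
      ≈⟨ *-congˡ (Σ-cartesianProductWith _∷_ (allFin q) (configs n q)) ⟨
    fromℕ q * Σ[ configs (suc n) q ] F ∎
    where open ≤-Reasoning

  Σ-configs-recolour : ∀ {n q} ws (F : Config n q → Carrier) →
    Σ[ configs n q ] (recolour ws F) ≈ fromℕ q ^ length ws * Σ[ configs n q ] F
  Σ-configs-recolour []       F = ≈-sym (*-identityˡ _)
  Σ-configs-recolour (w ∷ ws) F = ≈-trans (Σ-configs-update w (recolour ws F))
    (≈-trans (*-congˡ (Σ-configs-recolour ws F)) (≈-sym (*-assoc _ _ _)))

  elements : ∀ {n} → Subset n → List (Fin n)
  elements []            = []
  elements (inside ∷ S)  = zero ∷ map suc (elements S)
  elements (outside ∷ S) = map suc (elements S)

  elements! : ∀ {n} (S : Subset n) → Unique (elements S)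
  elements! []            = []
  elements! (inside ∷ S)  = All.tabulate (λ v∈ 0≡v → zero∉ (subst (_∈ _) (≡.sym 0≡v) v∈)) ∷ Unique.map⁺ Fin.suc-injective (elements! S)
    where
    zero∉ : zero ∉ map suc (elements S)
    zero∉ 0∈ with ∈-map⁻ suc 0∈
    ... | _ , _ , ()
  elements! (outside ∷ S) = Unique.map⁺ Fin.suc-injective (elements! S)

  ∈-elements⁺ : ∀ {n} (S : Subset n) {v} → v Subset.∈ S → v ∈ elements S
  ∈-elements⁺ (inside ∷ S)  {zero}  _                = here ≡.refl
  ∈-elements⁺ (inside ∷ S)  {suc v} (Vec.there v∈S) = there (∈-map⁺ suc (∈-elements⁺ S v∈S))
  ∈-elements⁺ (outside ∷ S) {suc v} (Vec.there v∈S) = ∈-map⁺ suc (∈-elements⁺ S v∈S)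

  ∈-elements⁻ : ∀ {n} (S : Subset n) {v} → v ∈ elements S → v Subset.∈ S
  ∈-elements⁻ (inside ∷ S)  (here ≡.refl) = Vec.here
  ∈-elements⁻ (inside ∷ S)  (there v∈) with ∈-map⁻ suc v∈
  ... | _ , u∈ , ≡.refl = Vec.there (∈-elements⁻ S u∈)
  ∈-elements⁻ (outside ∷ S) v∈ with ∈-map⁻ suc v∈
  ... | _ , u∈ , ≡.refl = Vec.there (∈-elements⁻ S u∈)

  recolour-suc : ∀ {n q} ws (F : Config (suc n) q → Carrier) x X →
    recolour (map suc ws) F (x ∷ X) ≡ recolour ws (λ Z → F (x ∷ Z)) X
  recolour-suc         []       F x X = ≡.refl
  recolour-suc {q = q} (w ∷ ws) F x X = Σ-≡ (allFin q)
    where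
    Σ-≡ : ∀ ks → Σ[ ks ] (λ k → recolour (map suc ws) F (x ∷ X [ w ]≔ k)) ≡
                 Σ[ ks ] (λ k → recolour ws (λ Z → F (x ∷ Z)) (X [ w ]≔ k))
    Σ-≡ []       = ≡.refl
    Σ-≡ (k ∷ ks) = cong₂ _+_ (recolour-suc ws F x (X [ w ]≔ k)) (Σ-≡ ks)

  -- Trades the vector encoding of colourings of S for updates in place, where the order of the
  -- vertices is free and the colours off S stay visible.
  Σ-overwrite : ∀ {n q} (X : Config n q) (S : Subset n) (F : Config n q → Carrier) →
    Σ[ configs ∣ S ∣ q ] (λ c → F (overwrite X S c)) ≈ recolour (elements S) F X
  Σ-overwrite []      []            F = +-identityʳ _
  Σ-overwrite {q = q} (x ∷ X) (inside ∷ S)  F = ≈-trans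
    (Σ-cartesianProductWith _∷_ (allFin q) (configs ∣ S ∣ q))
    (Σ-cong (allFin q) (λ k → ≈-trans (Σ-overwrite X S (λ Z → F (k ∷ Z)))
      (≈-reflexive (≡.sym (recolour-suc (elements S) F k X)))))
  Σ-overwrite (x ∷ X) (outside ∷ S) F = ≈-trans (Σ-overwrite X S (λ Z → F (x ∷ Z)))
    (≈-reflexive (≡.sym (recolour-suc (elements S) F x X)))

-- Counting in lists and sums of natural numbers

Unique-⊆⇒length-≤ : ∀ {A : Set} {xs ys : List A} → Unique xs → (∀ {x} → x ∈ xs → x ∈ ys) → length xs ℕ.≤ length ys
Unique-⊆⇒length-≤ [] _ = z≤n
Unique-⊆⇒length-≤ {xs = x ∷ xs} (x∉xs ∷ xs!) ⊆ with ∈-∃++ (⊆ (here ≡.refl))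
... | as , bs , ≡.refl = begin
  suc (length xs)                   ≤⟨ s≤s (Unique-⊆⇒length-≤ xs! without-x) ⟩
  suc (length (as ++ bs))           ≡⟨ cong suc (List.length-++ as) ⟩
  suc (length as ℕ.+ length bs)     ≡⟨ ℕ.+-suc (length as) (length bs) ⟨
  length as ℕ.+ length (x ∷ bs)     ≡⟨ List.length-++ as ⟨
  length (as ++ x ∷ bs)             ∎
  where
  open ℕ.≤-Reasoning
  without-x : ∀ {y} → y ∈ xs → y ∈ as ++ bs
  without-x y∈xs with ∈-++⁻ as (⊆ (there y∈xs))
  ... | inj₁ y∈as          = ∈-++⁺ˡ y∈as
  ... | inj₂ (here y≡x)    = ⊥-elim (All.lookup x∉xs y∈xs (≡.sym y≡x))
  ... | inj₂ (there y∈bs)  = ∈-++⁺ʳ as y∈bs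

∑[<_] : ℕ → (ℕ → ℕ) → ℕ
∑[< zero ]  f = 0
∑[< suc n ] f = ∑[< n ] f ℕ.+ f n

𝟙 : ∀ {P : Set} → Dec P → ℕ
𝟙 d = if does d then 1 else 0

𝟙-yes : ∀ {P : Set} (d : Dec P) → P → 𝟙 d ≡ 1
𝟙-yes (yes _) p = ≡.refl
𝟙-yes (no ¬p) p = ⊥-elim (¬p p)

𝟙-mono : ∀ {P Q : Set} (d : Dec P) (e : Dec Q) → (P → Q) → 𝟙 d ℕ.≤ 𝟙 e
𝟙-mono (yes p) e f = ℕ.≤-reflexive (≡.sym (𝟙-yes e (f p)))
𝟙-mono (no _)  e f = z≤n

∑-cong : ∀ n {f g : ℕ → ℕ} → (∀ i → i ℕ.< n → f i ≡ g i) → ∑[< n ] f ≡ ∑[< n ] g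
∑-cong zero    f≡g = ≡.refl
∑-cong (suc n) f≡g = cong₂ ℕ._+_ (∑-cong n (λ i i<n → f≡g i (ℕ.m<n⇒m<1+n i<n))) (f≡g n ℕ.≤-refl)

∑-mono : ∀ n {f g : ℕ → ℕ} → (∀ i → i ℕ.< n → f i ℕ.≤ g i) → ∑[< n ] f ℕ.≤ ∑[< n ] g
∑-mono zero    f≤g = z≤n
∑-mono (suc n) f≤g = ℕ.+-mono-≤ (∑-mono n (λ i i<n → f≤g i (ℕ.m<n⇒m<1+n i<n))) (f≤g n ℕ.≤-refl)

∑-* : ∀ n c {f : ℕ → ℕ} → c ℕ.* ∑[< n ] f ≡ ∑[< n ] (λ i → c ℕ.* f i)
∑-* zero    c = ℕ.*-zeroʳ c
∑-* (suc n) c {f} = ≡.trans (ℕ.*-distribˡ-+ c (∑[< n ] f) (f n)) (cong₂ ℕ._+_ (∑-* n c) ≡.refl)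

∑-zero : ∀ n → ∑[< n ] (λ _ → 0) ≡ 0
∑-zero zero    = ≡.refl
∑-zero (suc n) = ≡.trans (ℕ.+-identityʳ _) (∑-zero n)

∑-+ : ∀ n {f g : ℕ → ℕ} → ∑[< n ] (λ i → f i ℕ.+ g i) ≡ ∑[< n ] f ℕ.+ ∑[< n ] g
∑-+ zero    = ≡.refl
∑-+ (suc n) {f} {g} = ≡.trans (cong (ℕ._+ (f n ℕ.+ g n)) (∑-+ n))
  (+-interchange (∑[< n ] f) (∑[< n ] g) (f n) (g n))
  where open CommutativeSemigroupProperties ℕ.+-commutativeSemigroup using () renaming (interchange to +-interchange)

∑-swap : ∀ m n {f : ℕ → ℕ → ℕ} → ∑[< m ] (λ i → ∑[< n ] (f i)) ≡ ∑[< n ] (λ j → ∑[< m ] (λ i → f i j))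
∑-swap zero    n = ≡.sym (∑-zero n)
∑-swap (suc m) n = ≡.trans (cong₂ ℕ._+_ (∑-swap m n) ≡.refl) (≡.sym (∑-+ n))

∑-+-index : ∀ m n {f : ℕ → ℕ} → ∑[< m ℕ.+ n ] f ≡ ∑[< m ] f ℕ.+ ∑[< n ] (λ i → f (m ℕ.+ i))
∑-+-index m zero {f} = ≡.trans (cong (λ k → ∑[< k ] f) (ℕ.+-identityʳ m)) (≡.sym (ℕ.+-identityʳ _))
∑-+-index m (suc n) {f} = ≡.trans (cong (λ k → ∑[< k ] f) (ℕ.+-suc m n))
  (≡.trans (cong (ℕ._+ f (m ℕ.+ n)) (∑-+-index m n)) (ℕ.+-assoc (∑[< m ] f) _ _))

∑-*-index : ∀ m n {f : ℕ → ℕ} → ∑[< m ℕ.* n ] f ≡ ∑[< m ] (λ i → ∑[< n ] (λ j → f (i ℕ.* n ℕ.+ j)))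
∑-*-index zero    n = ≡.refl
∑-*-index (suc m) n {f} = ≡.trans (cong (λ k → ∑[< k ] f) (ℕ.+-comm n (m ℕ.* n)))
  (≡.trans (∑-+-index (m ℕ.* n) n) (cong₂ ℕ._+_ (∑-*-index m n) ≡.refl))

length-filter-applyUpTo : ∀ {A : Set} {P : A → Set} (P? : ∀ x → Dec (P x)) (f : ℕ → A) n →
  length (filter P? (List.applyUpTo f n)) ≡ ∑[< n ] (λ i → 𝟙 (P? (f i)))
length-filter-applyUpTo P? f zero    = ≡.refl
length-filter-applyUpTo P? f (suc n) = ≡.trans head (≡.trans
  (cong (𝟙 (P? (f 0)) ℕ.+_) (length-filter-applyUpTo P? (f ∘ suc) n)) (≡.sym (∑-+-index 1 n)))
  where
  head : length (filter P? (f 0 ∷ List.applyUpTo (f ∘ suc) n)) ≡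
         𝟙 (P? (f 0)) ℕ.+ length (filter P? (List.applyUpTo (f ∘ suc) n))
  head with does (P? (f 0))
  ... | true  = ≡.refl
  ... | false = ≡.refl

length-filter-concat : ∀ {A : Set} {P : A → Set} (P? : ∀ x → Dec (P x)) (f : ℕ → List A) n →
  length (filter P? (List.concat (List.applyUpTo f n))) ≡ ∑[< n ] (λ i → length (filter P? (f i)))
length-filter-concat P? f zero    = ≡.refl
length-filter-concat P? f (suc n) = ≡.trans (cong length (List.filter-++ P? (f 0) _)) (≡.trans
  (List.length-++ (filter P? (f 0)))
  (≡.trans (cong (length (filter P? (f 0)) ℕ.+_) (length-filter-concat P? (f ∘ suc) n)) (≡.sym (∑-+-index 1 n))))

-- Monochromatic edges and old cells along a line

module _ {q : ℕ} where

  open import Data.List.Membership.DecPropositional (Fin._≟_ {q}) using () renaming (_∈?_ to _∈ᶜ?_)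


  -- Each monochromatic edge but the last is charged to the cell at its right end. The last one ends
  -- on the boundary: it is paid for by an old cell whose left edge is not monochromatic, or else
  -- all `r` cells are old and the factor `suc r` against `r` absorbs it.
  row-bound : ∀ (C : List (Fin q)) (x : ℕ → Fin q) (o : ℕ → ℕ) r →
    (∀ i → i ℕ.< r → x i ≡ x (suc i) → 1 ℕ.≤ o i) →
    (∀ i → i ℕ.< r → x (suc i) ∈ C → 1 ℕ.≤ o i) →
    x 0 ∈ C → x (suc r) ∈ C →
    r ℕ.* ∑[< suc r ] (λ i → 𝟙 (x i Fin.≟ x (suc i))) ℕ.≤ suc r ℕ.* ∑[< r ] o
  row-bound C x o r step old x₀∈C xₑ∈C = last (x r Fin.≟ x (suc r))
    where
    open ℕ.≤-Reasoning
    mono : ℕ → ℕ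
    mono i = 𝟙 (x i Fin.≟ x (suc i))

    mono≤o : ∀ i → i ℕ.< r → mono i ℕ.≤ o i
    mono≤o i i<r with x i Fin.≟ x (suc i)
    ... | yes eq = step i i<r eq
    ... | no _   = z≤n

    -- Going left from a cell with a colour in C, the colours stay in C until the first edge that is
    -- not monochromatic: either there is such an edge, or all cells are old.
    gain : ∀ s → s ℕ.≤ r → x s ∈ C → suc (∑[< s ] mono) ℕ.≤ ∑[< s ] o ⊎ s ℕ.≤ ∑[< s ] o
    gain zero    _   _ = inj₂ z≤n
    gain (suc s) s<r xₛ∈C with x s Fin.≟ x (suc s)
    ... | no _ = inj₁ (begin
      suc (∑[< s ] mono ℕ.+ 0)      ≡⟨ ℕ.+-suc (∑[< s ] mono) 0 ⟨
      ∑[< s ] mono ℕ.+ 1            ≤⟨ ℕ.+-mono-≤ (∑-mono s (λ i i<s → mono≤o i (ℕ.<-trans i<s s<r))) (old s s<r xₛ∈C) ⟩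
      ∑[< s ] o ℕ.+ o s             ∎)
    ... | yes eq with gain s (ℕ.<⇒≤ s<r) (subst (_∈ C) (≡.sym eq) xₛ∈C)
    ...   | inj₁ less = inj₁ (ℕ.+-mono-≤ less (old s s<r xₛ∈C))
    ...   | inj₂ full = inj₂ (begin
      suc s             ≡⟨ ℕ.+-comm 1 s ⟩
      s ℕ.+ 1           ≤⟨ ℕ.+-mono-≤ full (old s s<r xₛ∈C) ⟩
      ∑[< s ] o ℕ.+ o s ∎)

    few : ∀ {k} → k ℕ.≤ ∑[< r ] o → r ℕ.* k ℕ.≤ suc r ℕ.* ∑[< r ] o
    few k≤ = ℕ.*-mono-≤ (ℕ.n≤1+n r) k≤

    last : (d : Dec (x r ≡ x (suc r))) → r ℕ.* (∑[< r ] mono ℕ.+ 𝟙 d) ℕ.≤ suc r ℕ.* ∑[< r ] o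
    last (no _) = few (ℕ.≤-trans (ℕ.≤-reflexive (ℕ.+-identityʳ _)) (∑-mono r mono≤o))
    last (yes eq) with gain r ℕ.≤-refl (subst (_∈ C) (≡.sym eq) xₑ∈C)
    ... | inj₁ less = few (ℕ.≤-trans (ℕ.≤-reflexive (ℕ.+-comm (∑[< r ] mono) 1)) less)
    ... | inj₂ full = begin
      r ℕ.* (∑[< r ] mono ℕ.+ 1)      ≤⟨ ℕ.*-monoʳ-≤ r (ℕ.+-monoˡ-≤ 1 (∑-mono r mono≤o)) ⟩
      r ℕ.* (∑[< r ] o ℕ.+ 1)         ≡⟨ ℕ.*-distribˡ-+ r (∑[< r ] o) 1 ⟩
      r ℕ.* ∑[< r ] o ℕ.+ r ℕ.* 1     ≡⟨ cong (r ℕ.* ∑[< r ] o ℕ.+_) (ℕ.*-identityʳ r) ⟩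
      r ℕ.* ∑[< r ] o ℕ.+ r           ≤⟨ ℕ.+-monoʳ-≤ (r ℕ.* ∑[< r ] o) full ⟩
      r ℕ.* ∑[< r ] o ℕ.+ ∑[< r ] o   ≡⟨ ℕ.+-comm (r ℕ.* ∑[< r ] o) _ ⟩
      suc r ℕ.* ∑[< r ] o             ∎

  -- `C` starts as the boundary colours and takes in each colour once it is passed, so boundary and
  -- earlier cells are tested alike.
  oldCount : ∀ {n} → List (Fin q) → List (Fin n) → Config n q → ℕ
  oldCount C []       Z = 0
  oldCount C (w ∷ ws) Z = 𝟙 (lookup Z w ∈ᶜ? C) ℕ.+ oldCount (lookup Z w ∷ C) ws Z

  ∑≤oldCount : ∀ {n} (Z : Config n q) m C (f : ℕ → Fin n) {P : ℕ → Set} (P? : ∀ i → Dec (P i)) →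
    (∀ i → i ℕ.< m → P i → lookup Z (f i) ∈ C ⊎ ∃[ j ] j ℕ.< i × lookup Z (f j) ≡ lookup Z (f i)) →
    ∑[< m ] (λ i → 𝟙 (P? i)) ℕ.≤ oldCount C (List.applyUpTo f m) Z
  ∑≤oldCount Z zero    C f P? old = z≤n
  ∑≤oldCount Z (suc m) C f P? old = ℕ.≤-trans (ℕ.≤-reflexive (∑-+-index 1 m))
    (ℕ.+-mono-≤ (𝟙-mono (P? 0) (lookup Z (f 0) ∈ᶜ? C) first) (∑≤oldCount Z m _ (f ∘ suc) (P? ∘ suc) rest))
    where
    first : _ → lookup Z (f 0) ∈ C
    first p with old 0 (s≤s z≤n) p
    ... | inj₁ in-C = in-C
    ... | inj₂ (_ , () , _)
    rest : ∀ i → i ℕ.< m → _ → _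
    rest i i<m p with old (suc i) (s≤s i<m) p
    ... | inj₁ in-C                  = inj₁ (there in-C)
    ... | inj₂ (zero , _ , eq)       = inj₁ (here (≡.sym eq))
    ... | inj₂ (suc j , s≤s j<i , eq) = inj₂ (j , j<i , eq)

-- Cyclic arithmetic and windows of the torus

module _ {L : ℕ} where

  module _ (a : Fin L) where
    private instance
      L≢0 : NonZero L
      L≢0 = Fin.nonZeroIndex a

    toℕ-⊕ : ∀ i → toℕ (a ⊕ i) ≡ (toℕ a ℕ.+ i) ℕ.% L
    toℕ-⊕ i = Fin.toℕ-fromℕ< _

    ⊕-⊕ : ∀ i j → (a ⊕ i) ⊕ j ≡ a ⊕ (i ℕ.+ j)
    ⊕-⊕ i j = Fin.toℕ-injective (begin
      toℕ ((a ⊕ i) ⊕ j)                                ≡⟨ Fin.toℕ-fromℕ< _ ⟩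
      (toℕ (a ⊕ i) ℕ.+ j) ℕ.% L                        ≡⟨ cong (λ k → (k ℕ.+ j) ℕ.% L) (toℕ-⊕ i) ⟩
      ((toℕ a ℕ.+ i) ℕ.% L ℕ.+ j) ℕ.% L                ≡⟨ %-distribˡ-+ ((toℕ a ℕ.+ i) ℕ.% L) j L ⟩
      ((toℕ a ℕ.+ i) ℕ.% L ℕ.% L ℕ.+ j ℕ.% L) ℕ.% L    ≡⟨ cong (λ k → (k ℕ.+ j ℕ.% L) ℕ.% L) (m%n%n≡m%n (toℕ a ℕ.+ i) L) ⟩
      ((toℕ a ℕ.+ i) ℕ.% L ℕ.+ j ℕ.% L) ℕ.% L          ≡⟨ %-distribˡ-+ (toℕ a ℕ.+ i) j L ⟨
      (toℕ a ℕ.+ i ℕ.+ j) ℕ.% L                        ≡⟨ cong (ℕ._% L) (ℕ.+-assoc (toℕ a) i j) ⟩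
      (toℕ a ℕ.+ (i ℕ.+ j)) ℕ.% L                      ≡⟨ toℕ-⊕ (i ℕ.+ j) ⟨
      toℕ (a ⊕ (i ℕ.+ j))                              ∎)
      where open ≡-Reasoning

    ⊕-multiple : ∀ k → a ⊕ (k ℕ.* L) ≡ a
    ⊕-multiple k = Fin.toℕ-injective (≡.trans (toℕ-⊕ (k ℕ.* L))
      (≡.trans ([m+kn]%n≡m%n (toℕ a) k L) (m<n⇒m%n≡m (Fin.toℕ<n a))))

  ⊕-L+ : ∀ (a : Fin L) i → a ⊕ (L ℕ.+ i) ≡ a ⊕ i
  ⊕-L+ a i = ≡.trans (≡.sym (⊕-⊕ a L i))
    (cong (_⊕ i) (≡.trans (cong (a ⊕_) (≡.sym (ℕ.*-identityˡ L))) (⊕-multiple a 1)))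

  infixl 6 _⊖_
  -- Subtraction of `i` as addition of `i` copies of L - 1, so that both cancellation laws reduce to
  -- adding a multiple of L.
  _⊖_ : Fin L → ℕ → Fin L
  a ⊖ i = a ⊕ (i ℕ.* ℕ.pred L)

  private
    i+i*[L-1]≡i*L : ∀ (a : Fin L) i → i ℕ.+ i ℕ.* ℕ.pred L ≡ i ℕ.* L
    i+i*[L-1]≡i*L a i = ≡.trans (≡.sym (ℕ.*-suc i (ℕ.pred L)))
      (cong (i ℕ.*_) (ℕ.suc-pred L {{Fin.nonZeroIndex a}}))

  ⊕-⊖ : ∀ (a : Fin L) i → a ⊕ i ⊖ i ≡ a
  ⊕-⊖ a i = ≡.trans (⊕-⊕ a i _) (≡.trans (cong (a ⊕_) (i+i*[L-1]≡i*L a i)) (⊕-multiple a i))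

  ⊖-⊕ : ∀ (a : Fin L) i → a ⊖ i ⊕ i ≡ a
  ⊖-⊕ a i = ≡.trans (⊕-⊕ a _ i) (≡.trans
    (cong (a ⊕_) (≡.trans (ℕ.+-comm _ i) (i+i*[L-1]≡i*L a i))) (⊕-multiple a i))

  ⊕-cancelʳ : ∀ {a c : Fin L} i → a ⊕ i ≡ c ⊕ i → a ≡ c
  ⊕-cancelʳ {a} {c} i eq = ≡.trans (≡.sym (⊕-⊖ a i)) (≡.trans (cong (_⊖ i) eq) (⊕-⊖ c i))

  -- The sum wraps round at most once. Without wrapping the equation forces d = 0; with wrapping it
  -- forces d = L.
  ⊕-fixed : ∀ (a : Fin L) d → d ℕ.< L → a ≡ a ⊕ d → d ≡ 0
  ⊕-fixed a d d<L a≡a⊕d with toℕ a ℕ.+ d ℕ.<? L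
  ... | yes a+d<L = ≡.sym (ℕ.+-cancelˡ-≡ (toℕ a) 0 d (≡.trans (ℕ.+-identityʳ _)
        (≡.trans (cong toℕ a≡a⊕d) (≡.trans (toℕ-⊕ a d) (m<n⇒m%n≡m {{Fin.nonZeroIndex a}} a+d<L)))))
  ... | no a+d≮L with ℕ.m≤n⇒∃[o]m+o≡n (ℕ.≮⇒≥ a+d≮L)
  ...   | e , L+e≡a+d = ⊥-elim (ℕ.<-irrefl (ℕ.+-cancelˡ-≡ (toℕ a) d L a+d≡a+L) d<L)
    where
    instance L≢0 = Fin.nonZeroIndex a
    e<L : e ℕ.< L
    e<L = ℕ.+-cancelˡ-< L e L (subst (ℕ._< L ℕ.+ L) (≡.sym L+e≡a+d) (ℕ.+-mono-< (Fin.toℕ<n a) d<L))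
    a≡e : toℕ a ≡ e
    a≡e = begin
      toℕ a                          ≡⟨ cong toℕ a≡a⊕d ⟩
      toℕ (a ⊕ d)                    ≡⟨ toℕ-⊕ a d ⟩
      (toℕ a ℕ.+ d) ℕ.% L            ≡⟨ cong (ℕ._% L) L+e≡a+d ⟨
      (L ℕ.+ e) ℕ.% L                ≡⟨ cong (ℕ._% L) (≡.trans (ℕ.+-comm L e) (cong (e ℕ.+_) (≡.sym (ℕ.*-identityˡ L)))) ⟩
      (e ℕ.+ 1 ℕ.* L) ℕ.% L          ≡⟨ [m+kn]%n≡m%n e 1 L ⟩
      e ℕ.% L                        ≡⟨ m<n⇒m%n≡m e<L ⟩
      e                              ∎
      where open ≡-Reasoning
    a+d≡a+L : toℕ a ℕ.+ d ≡ toℕ a ℕ.+ L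
    a+d≡a+L = ≡.trans (≡.sym L+e≡a+d) (≡.trans (cong (L ℕ.+_) (≡.sym a≡e)) (ℕ.+-comm L (toℕ a)))

  ⊕-injectiveʳ-≤ : ∀ (a : Fin L) {i j} → i ℕ.≤ j → j ℕ.< i ℕ.+ L → a ⊕ i ≡ a ⊕ j → i ≡ j
  ⊕-injectiveʳ-≤ a {i} i≤j j<i+L eq with ℕ.m≤n⇒∃[o]m+o≡n i≤j
  ... | d , ≡.refl = ≡.trans (≡.sym (ℕ.+-identityʳ i)) (cong (i ℕ.+_) (≡.sym
        (⊕-fixed (a ⊕ i) d (ℕ.+-cancelˡ-< i d L j<i+L) (≡.trans eq (≡.sym (⊕-⊕ a i d))))))

  ⊕-injectiveʳ : ∀ (a : Fin L) k {i j} → i ℕ.< L → j ℕ.< L → a ⊕ (k ℕ.+ i) ≡ a ⊕ (k ℕ.+ j) → i ≡ j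
  ⊕-injectiveʳ a k {i} {j} i<L j<L eq with ℕ.≤-total i j
  ... | inj₁ i≤j = ℕ.+-cancelˡ-≡ k i j (⊕-injectiveʳ-≤ a (ℕ.+-monoʳ-≤ k i≤j)
        (subst (k ℕ.+ j ℕ.<_) (≡.sym (ℕ.+-assoc k i L)) (ℕ.+-monoʳ-< k (ℕ.<-≤-trans j<L (ℕ.m≤n+m L i)))) eq)
  ... | inj₂ j≤i = ≡.sym (ℕ.+-cancelˡ-≡ k j i (⊕-injectiveʳ-≤ a (ℕ.+-monoʳ-≤ k j≤i)
        (subst (k ℕ.+ i ℕ.<_) (≡.sym (ℕ.+-assoc k j L)) (ℕ.+-monoʳ-< k (ℕ.<-≤-trans i<L (ℕ.m≤n+m L j)))) (≡.sym eq)))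

  vertex : Fin L × Fin L → Fin (L ℕ.* L)
  vertex (a , b) = Fin.combine a b

  coordinates-vertex : ∀ p → coordinates (vertex p) ≡ p
  coordinates-vertex (a , b) = Fin.remQuot-combine a b

  vertex-coordinates : ∀ v → vertex (coordinates {L} v) ≡ v
  vertex-coordinates = Fin.combine-remQuot {L} L

  vertex-injective : ∀ {p p′} → vertex p ≡ vertex p′ → p ≡ p′
  vertex-injective {p} {p′} eq =
    ≡.trans (≡.sym (coordinates-vertex p)) (≡.trans (cong coordinates eq) (coordinates-vertex p′))

  -- The window of side r + 2 around the subgrid at s: the subgrid consists of the window
  -- coordinates 1, …, r and its outer boundary has a window coordinate 0 or r + 1.
  window : Fin L × Fin L → ℕ → ℕ → Fin (L ℕ.* L)
  window (a , b) i j = vertex (a ⊕ (ℕ.pred L ℕ.+ i) , b ⊕ (ℕ.pred L ℕ.+ j))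

  window-injective : ∀ s {i j i′ j′} → i ℕ.< L → j ℕ.< L → i′ ℕ.< L → j′ ℕ.< L →
                     window s i j ≡ window s i′ j′ → i ≡ i′ × j ≡ j′
  window-injective (a , b) i<L j<L i′<L j′<L eq =
    ⊕-injectiveʳ a (ℕ.pred L) i<L i′<L (cong proj₁ eq′) , ⊕-injectiveʳ b (ℕ.pred L) j<L j′<L (cong proj₂ eq′)
    where eq′ = vertex-injective eq

  ⊕-window-suc : ∀ (a : Fin L) i → a ⊕ (ℕ.pred L ℕ.+ suc i) ≡ a ⊕ i
  ⊕-window-suc a i = ≡.trans (cong (a ⊕_) (≡.trans (ℕ.+-suc (ℕ.pred L) i)
    (cong (ℕ._+ i) (ℕ.suc-pred L {{Fin.nonZeroIndex a}})))) (⊕-L+ a i)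

  window-suc : ∀ s i j → window s (suc i) (suc j) ≡ vertex (proj₁ s ⊕ i , proj₂ s ⊕ j)
  window-suc (a , b) i j = cong₂ Fin.combine (⊕-window-suc a i) (⊕-window-suc b j)

  ⊕-window-next : ∀ (a : Fin L) i → a ⊕ (ℕ.pred L ℕ.+ i) ⊕ 1 ≡ a ⊕ (ℕ.pred L ℕ.+ suc i)
  ⊕-window-next a i = ≡.trans (⊕-⊕ a _ 1) (cong (a ⊕_)
    (≡.trans (ℕ.+-assoc (ℕ.pred L) i 1) (cong (ℕ.pred L ℕ.+_) (ℕ.+-comm i 1))))

-- Cells, boundary and incident edges of a subgrid

module Grid (L r : ℕ) .{{L>1 : NonTrivial L}} .{{r≢0 : NonZero r}} (r≤L-2 : r ℕ.≤ L ℕ.∸ 2) where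

  G : Graph (L ℕ.* L)
  G = toroidalGrid L

  open Graph G

  Position : Set
  Position = Fin L × Fin L

  -- The window of side r + 2 fits on the torus: its coordinates 0, ..., r + 1 are distinct modulo
  -- L. The disjointness of boundary and cells rests on this.
  1+r<L : suc r ℕ.< L
  1+r<L = subst (suc (suc r) ℕ.≤_) (ℕ.m+[n∸m]≡n (ℕ.nonTrivial⇒n>1 L)) (s≤s (s≤s r≤L-2))

  r<L : r ℕ.< L
  r<L = ℕ.<-trans (ℕ.n<1+n r) 1+r<L

  -- Lexicographic order of the two coordinates, so that a cell comes after its neighbours in the
  -- subgrid with a smaller coordinate, which `Old` refers to.
  cell : Position → ℕ → Fin (L ℕ.* L)
  cell s t = window s (suc (t ℕ./ r)) (suc (t ℕ.% r))

  cells : Position → List (Fin (L ℕ.* L))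
  cells s = List.applyUpTo (cell s) (r ℕ.* r)

  length-cells : ∀ s → length (cells s) ≡ r ℕ.* r
  length-cells s = List.length-applyUpTo (cell s) (r ℕ.* r)

  row<r : ∀ {t} → t ℕ.< r ℕ.* r → t ℕ./ r ℕ.< r
  row<r = m<n*o⇒m/o<n

  [i*r+j]%r : ∀ i {j} → j ℕ.< r → (i ℕ.* r ℕ.+ j) ℕ.% r ≡ j
  [i*r+j]%r i {j} j<r = ≡.trans (cong (ℕ._% r) (ℕ.+-comm (i ℕ.* r) j))
    (≡.trans ([m+kn]%n≡m%n j i r) (m<n⇒m%n≡m j<r))

  [i*r+j]/r : ∀ i {j} → j ℕ.< r → (i ℕ.* r ℕ.+ j) ℕ./ r ≡ i
  [i*r+j]/r i {j} j<r = ≡.trans (+-distrib-/-∣ˡ j (n∣m*n i)) (≡.trans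
    (cong₂ ℕ._+_ (m*n/n≡m i r) (m<n⇒m/n≡0 j<r)) (ℕ.+-identityʳ i))

  i*r+j<r*r : ∀ {i j} → i ℕ.< r → j ℕ.< r → i ℕ.* r ℕ.+ j ℕ.< r ℕ.* r
  i*r+j<r*r {i} {j} i<r j<r = begin-strict
    i ℕ.* r ℕ.+ j <⟨ ℕ.+-monoʳ-< (i ℕ.* r) j<r ⟩
    i ℕ.* r ℕ.+ r ≡⟨ ℕ.+-comm (i ℕ.* r) r ⟩
    suc i ℕ.* r   ≤⟨ ℕ.*-monoˡ-≤ r i<r ⟩
    r ℕ.* r       ∎
    where open ℕ.≤-Reasoning

  cell-index : ∀ s i {j} → j ℕ.< r → cell s (i ℕ.* r ℕ.+ j) ≡ window s (suc i) (suc j)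
  cell-index s i j<r = cong₂ (window s) (cong suc ([i*r+j]/r i j<r)) (cong suc ([i*r+j]%r i j<r))

  cells! : ∀ s → Unique (cells s)
  cells! s = Unique.applyUpTo⁺₁ (cell s) (r ℕ.* r) distinct
    where
    distinct : ∀ {t u} → t ℕ.< u → u ℕ.< r ℕ.* r → cell s t ≢ cell s u
    distinct {t} {u} t<u u<r² eq = ℕ.<-irrefl t≡u t<u
      where
      bound : ∀ {k} → k ℕ.< r → suc k ℕ.< L
      bound k<r = ℕ.<-trans (s≤s k<r) 1+r<L
      eqs = window-injective s (bound (row<r (ℕ.<-trans t<u u<r²))) (bound (m%n<n t r)) (bound (row<r u<r²)) (bound (m%n<n u r)) eq
      t≡u : t ≡ u
      t≡u = ≡.trans (m≡m%n+[m/n]*n t r) (≡.trans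
        (cong₂ (λ i j → j ℕ.+ i ℕ.* r) (ℕ.suc-injective (proj₁ eqs)) (ℕ.suc-injective (proj₂ eqs))) (≡.sym (m≡m%n+[m/n]*n u r)))

  window∈cells : ∀ s {i j} → i ℕ.< r → j ℕ.< r → window s (suc i) (suc j) ∈ cells s
  window∈cells s {i} {j} i<r j<r = subst (_∈ cells s) (cell-index s i j<r) (∈-applyUpTo⁺ (cell s) (i*r+j<r*r i<r j<r))

  ∈-cells⁻ : ∀ s {v} → v ∈ cells s → ∃[ i ] ∃[ j ] i ℕ.< r × j ℕ.< r × v ≡ window s (suc i) (suc j)
  ∈-cells⁻ s v∈ with ∈-applyUpTo⁻ (cell s) v∈
  ... | t , t<r² , ≡.refl = t ℕ./ r , t ℕ.% r , row<r t<r² , m%n<n t r , ≡.refl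

  private
    module _ (s : Position) (v : Fin (L ℕ.* L)) where
      covered? = Fin.any? {r} λ i → Fin.any? {r} λ j →
        ×-≡-dec Fin._≟_ Fin._≟_ (coordinates {L} v) (proj₁ s ⊕ toℕ i , proj₂ s ⊕ toℕ j)

    lookup-subgrid : ∀ s v → lookup (subgrid r s) v ≡ does (covered? s v)
    lookup-subgrid s v = Vec.lookup∘tabulate (λ v → does (covered? s v)) v

  ∈-subgrid⁻ : ∀ s {v} → v Subset.∈ subgrid r s → v ∈ cells s
  ∈-subgrid⁻ s {v} v∈ with covered? s v | ≡.trans (≡.sym (lookup-subgrid s v)) (Vec.[]=⇒lookup v∈)
  ... | yes (i , j , eq) | _ = subst (_∈ cells s)
      (≡.trans (window-suc s (toℕ i) (toℕ j)) (≡.trans (cong vertex (≡.sym eq)) (vertex-coordinates {L} v)))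
      (window∈cells s (Fin.toℕ<n i) (Fin.toℕ<n j))
  ... | no _ | ()

  ∈-subgrid⁺ : ∀ s {v} → v ∈ cells s → v Subset.∈ subgrid r s
  ∈-subgrid⁺ s {v} v∈ with ∈-cells⁻ s v∈
  ... | i , j , i<r , j<r , v≡ = Vec.lookup⇒[]= v (subgrid r s) (≡.trans (lookup-subgrid s v) covered)
    where
    covered : does (covered? s v) ≡ true
    covered with covered? s v
    ... | yes _ = ≡.refl
    ... | no ¬c = ⊥-elim (¬c (Fin.fromℕ< i<r , Fin.fromℕ< j<r , ≡.trans
      (≡.trans (cong coordinates (≡.trans v≡ (window-suc s i j))) (coordinates-vertex _))
      (cong₂ (λ x y → proj₁ s ⊕ x , proj₂ s ⊕ y) (≡.sym (Fin.toℕ-fromℕ< i<r)) (≡.sym (Fin.toℕ-fromℕ< j<r)))))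

  -- Place `i` on each of the four sides. The corners of the window are left out: they are adjacent
  -- to no cell.
  boundaryAt : Position → ℕ → List (Fin (L ℕ.* L))
  boundaryAt s i = window s 0 (suc i) ∷ window s (suc r) (suc i) ∷ window s (suc i) 0 ∷ window s (suc i) (suc r) ∷ []

  boundary : Position → List (Fin (L ℕ.* L))
  boundary s = List.concat (List.applyUpTo (boundaryAt s) r)

  ∈-boundary : ∀ s {v i} → i ℕ.< r → v ∈ boundaryAt s i → v ∈ boundary s
  ∈-boundary s i<r v∈ = ∈-concat⁺′ v∈ (∈-applyUpTo⁺ (boundaryAt s) i<r)

  length-boundary : ∀ s → length (boundary s) ≡ r ℕ.* 4
  length-boundary s = length-concat-applyUpTo (λ _ → ≡.refl) r
    where
    length-concat-applyUpTo : ∀ {A : Set} {k} {f : ℕ → List A} → (∀ i → length (f i) ≡ k) → ∀ n →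
                              length (List.concat (List.applyUpTo f n)) ≡ n ℕ.* k
    length-concat-applyUpTo         len zero    = ≡.refl
    length-concat-applyUpTo {f = f} len (suc n) =
      ≡.trans (List.length-++ (f 0)) (cong₂ ℕ._+_ (len 0) (length-concat-applyUpTo (len ∘ suc) n))

  boundary-disjoint : ∀ s {v} → v ∈ boundary s → v ∉ cells s
  boundary-disjoint s {v} v∈b v∈c with ∈-concat⁻′ (List.applyUpTo (boundaryAt s) r) v∈b
  ... | _ , v∈vs , vs∈ with ∈-applyUpTo⁻ (boundaryAt s) vs∈ | ∈-cells⁻ s v∈c
  ... | k , k<r , ≡.refl | i , j , i<r , j<r , ≡.refl = disjoint v∈vs
    where
    bound : ∀ {k} → k ℕ.< r → suc k ℕ.< L
    bound k<r = ℕ.<-trans (s≤s k<r) 1+r<L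
    0<L : 0 ℕ.< L
    0<L = ℕ.≤-<-trans z≤n r<L
    disjoint : window s (suc i) (suc j) ∈ boundaryAt s k → ⊥
    disjoint (here eq) with proj₁ (window-injective s (bound i<r) (bound j<r) 0<L (bound k<r) eq)
    ... | ()
    disjoint (there (here eq)) with proj₁ (window-injective s (bound i<r) (bound j<r) 1+r<L (bound k<r) eq)
    ... | ≡.refl = ℕ.<-irrefl ≡.refl i<r
    disjoint (there (there (here eq))) with proj₂ (window-injective s (bound i<r) (bound j<r) (bound k<r) 0<L eq)
    ... | ()
    disjoint (there (there (there (here eq)))) with proj₂ (window-injective s (bound i<r) (bound j<r) (bound k<r) 1+r<L eq)
    ... | ≡.refl = ℕ.<-irrefl ≡.refl j<r

  Slot : Set
  Slot = Fin (L ℕ.* L) × Fin (L ℕ.* L)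

  -- Places for edges along a line of cells, pointing towards increasing window coordinates. Indices
  -- 0 and r are the edges that leave the subgrid.
  rowSlot colSlot : Position → ℕ → ℕ → Slot
  rowSlot s j i = window s i (suc j) , window s (suc i) (suc j)
  colSlot s i j = window s (suc i) j , window s (suc i) (suc j)

  slots : Position → List Slot
  slots s = List.concat (List.applyUpTo (λ j → List.applyUpTo (rowSlot s j) (suc r)) r) ++
            List.concat (List.applyUpTo (λ i → List.applyUpTo (colSlot s i) (suc r)) r)

  rowSlot∈slots : ∀ s {i j} → i ℕ.< suc r → j ℕ.< r → rowSlot s j i ∈ slots s
  rowSlot∈slots s {j = j} i≤r j<r =
    ∈-++⁺ˡ (∈-concat⁺′ (∈-applyUpTo⁺ (rowSlot s j) i≤r) (∈-applyUpTo⁺ (λ j → List.applyUpTo (rowSlot s j) (suc r)) j<r))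

  colSlot∈slots : ∀ s {i j} → i ℕ.< r → j ℕ.< suc r → colSlot s i j ∈ slots s
  colSlot∈slots s {i} i<r j≤r =
    ∈-++⁺ʳ _ (∈-concat⁺′ (∈-applyUpTo⁺ (colSlot s i) j≤r) (∈-applyUpTo⁺ (λ i → List.applyUpTo (colSlot s i) (suc r)) i<r))

  edge-from-cell : ∀ s {u v} → u ∈ cells s → u ~ v → (u , v) ∈ slots s ⊎ (v , u) ∈ slots s
  edge-from-cell s {u} {v} u∈ u~v with ∈-cells⁻ s u∈
  ... | i , j , i<r , j<r , ≡.refl = from (subst₂ Adj (coordinates-vertex _) ≡.refl u~v)
    where
    Adj : Fin L × Fin L → Fin L × Fin L → Set
    Adj (a , b) (c , d) = (Consecutive a c × b ≡ d) ⊎ (Consecutive b d × a ≡ c)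
    u₁ = proj₁ s ⊕ (ℕ.pred L ℕ.+ suc i)
    u₂ = proj₂ s ⊕ (ℕ.pred L ℕ.+ suc j)
    v₁ = proj₁ (coordinates {L} v)
    v₂ = proj₂ (coordinates {L} v)
    v≡ : ∀ {a b} → v₁ ≡ a → v₂ ≡ b → v ≡ vertex (a , b)
    v≡ eq₁ eq₂ = ≡.trans (≡.sym (vertex-coordinates {L} v)) (cong₂ Fin.combine eq₁ eq₂)
    from : Adj (u₁ , u₂) (v₁ , v₂) → (u , v) ∈ slots s ⊎ (v , u) ∈ slots s
    from (inj₁ (inj₁ u₁≡v₁+1 , u₂≡v₂)) = inj₂ (subst (λ w → (w , u) ∈ slots s)
      (≡.sym (v≡ (⊕-cancelʳ 1 (≡.trans (≡.sym u₁≡v₁+1) (≡.sym (⊕-window-next (proj₁ s) i)))) (≡.sym u₂≡v₂)))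
      (rowSlot∈slots s (ℕ.m<n⇒m<1+n i<r) j<r))
    from (inj₁ (inj₂ v₁≡u₁+1 , u₂≡v₂)) = inj₁ (subst (λ w → (u , w) ∈ slots s)
      (≡.sym (v≡ (≡.trans v₁≡u₁+1 (⊕-window-next (proj₁ s) (suc i))) (≡.sym u₂≡v₂)))
      (rowSlot∈slots s (s≤s i<r) j<r))
    from (inj₂ (inj₁ u₂≡v₂+1 , u₁≡v₁)) = inj₂ (subst (λ w → (w , u) ∈ slots s)
      (≡.sym (v≡ (≡.sym u₁≡v₁) (⊕-cancelʳ 1 (≡.trans (≡.sym u₂≡v₂+1) (≡.sym (⊕-window-next (proj₂ s) j))))))
      (colSlot∈slots s i<r (ℕ.m<n⇒m<1+n j<r)))
    from (inj₂ (inj₂ v₂≡u₂+1 , u₁≡v₁)) = inj₁ (subst (λ w → (u , w) ∈ slots s)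
      (≡.sym (v≡ (≡.sym u₁≡v₁) (≡.trans v₂≡u₂+1 (⊕-window-next (proj₂ s) (suc j)))))
      (colSlot∈slots s i<r (s≤s j<r)))

  edges! : Unique edges
  edges! = Unique.filter⁺ _ (Unique.cartesianProduct⁺ (Unique.allFin⁺ _) (Unique.allFin⁺ _))

  ∈-edges⁻ : ∀ {u v} → (u , v) ∈ edges → u Fin.< v × u ~ v
  ∈-edges⁻ {u} {v} e∈ = proj₂ (∈-filter⁻ (λ (u , v) → (u Fin.<? v) ×-dec (u ~? v)) {xs = cartesianProduct (allFin _) (allFin _)} e∈)

  incident? : (S : Subset (L ℕ.* L)) (e : Slot) → Dec (proj₁ e Subset.∈ S ⊎ proj₂ e Subset.∈ S)
  incident? S (u , v) = (u ∈? S) ⊎-dec (v ∈? S)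

  module _ {q : ℕ} where

    mono? : (Z : Config (L ℕ.* L) q) (e : Slot) → Dec (lookup Z (proj₁ e) ≡ lookup Z (proj₂ e))
    mono? Z (u , v) = lookup Z u Fin.≟ lookup Z v

    incidentMono : Subset (L ℕ.* L) → Config (L ℕ.* L) q → ℕ
    incidentMono S Z = length (filter (incident? S) (monochromaticEdges G Z))

    private
      orient : Slot → Slot
      orient (u , v) with u Fin.<? v
      ... | yes _ = u , v
      ... | no _  = v , u

      orient-< : ∀ {u v} → u Fin.< v → orient (u , v) ≡ (u , v)
      orient-< {u} {v} u<v with u Fin.<? v
      ... | yes _ = ≡.refl
      ... | no ¬u<v = ⊥-elim (¬u<v u<v)

      orient-> : ∀ {u v} → v Fin.< u → orient (u , v) ≡ (v , u)
      orient-> {u} {v} v<u with u Fin.<? v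
      ... | yes u<v = ⊥-elim (ℕ.<-asym u<v v<u)
      ... | no _ = ≡.refl

    -- Graph edges have the smaller vertex number first, while slots follow window coordinates,
    -- which may wrap; `orient` reconciles them. The edge list has no repetitions and lies inside
    -- the oriented monochromatic slots, which bounds its length.
    incidentMono≤slots : ∀ s Z → incidentMono (subgrid r s) Z ℕ.≤ length (filter (mono? Z) (slots s))
    incidentMono≤slots s Z = subst (incidentMono (subgrid r s) Z ℕ.≤_) (List.length-map orient (filter (mono? Z) (slots s)))
      (Unique-⊆⇒length-≤ (Unique.filter⁺ _ (Unique.filter⁺ _ edges!)) oriented)
      where
      oriented : ∀ {e} → e ∈ filter (incident? (subgrid r s)) (monochromaticEdges G Z) → e ∈ map orient (filter (mono? Z) (slots s))
      oriented {u , v} e∈ with ∈-filter⁻ (incident? (subgrid r s)) {xs = monochromaticEdges G Z} e∈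
      ... | e∈mono , inc with ∈-filter⁻ (mono? Z) {xs = edges} e∈mono
      ... | e∈edges , uv-mono with ∈-edges⁻ e∈edges
      ... | u<v , u~v = place (slot inc)
        where
        slot : _ → (u , v) ∈ slots s ⊎ (v , u) ∈ slots s
        slot (inj₁ u∈S) = edge-from-cell s (∈-subgrid⁻ s u∈S) u~v
        slot (inj₂ v∈S) with edge-from-cell s (∈-subgrid⁻ s v∈S) (~-sym {u} {v} u~v)
        ... | inj₁ vu = inj₂ vu
        ... | inj₂ uv = inj₁ uv
        place : (u , v) ∈ slots s ⊎ (v , u) ∈ slots s → (u , v) ∈ map orient (filter (mono? Z) (slots s))
        place (inj₁ uv) = subst (_∈ _) (orient-< u<v) (∈-map⁺ orient (∈-filter⁺ (mono? Z) uv uv-mono))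
        place (inj₂ vu) = subst (_∈ _) (orient-> u<v) (∈-map⁺ orient (∈-filter⁺ (mono? Z) vu (≡.sym uv-mono)))

    open import Data.List.Membership.DecPropositional (Fin._≟_ {q}) using () renaming (_∈?_ to _∈ᶜ?_)

    boundaryColours : Position → Config (L ℕ.* L) q → List (Fin q)
    boundaryColours s Z = map (lookup Z) (boundary s)

    module _ (s : Position) (Z : Config (L ℕ.* L) q) where
      private
        colour : ℕ → ℕ → Fin q
        colour i j = lookup Z (window s i j)

        B : List (Fin q)
        B = boundaryColours s Z

        -- Local to the boundary and the two preceding neighbours. The same flag serves the lines of
        -- cells in both directions, and it implies that the colour occurs on the boundary or
        -- earlier in `cells`.
        Old : ℕ → ℕ → Set
        Old i j = colour (suc i) (suc j) ∈ B ⊎ colour i (suc j) ≡ colour (suc i) (suc j)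
                                             ⊎ colour (suc i) j ≡ colour (suc i) (suc j)

        old? : ∀ i j → Dec (Old i j)
        old? i j = (colour (suc i) (suc j) ∈ᶜ? B) ⊎-dec
          ((colour i (suc j) Fin.≟ colour (suc i) (suc j)) ⊎-dec (colour (suc i) j Fin.≟ colour (suc i) (suc j)))

        olds : ℕ
        olds = ∑[< r ] (λ i → ∑[< r ] (λ j → 𝟙 (old? i j)))

        in-B : ∀ {i w} → i ℕ.< r → w ∈ boundaryAt s i → lookup Z w ∈ B
        in-B i<r w∈ = ∈-map⁺ (lookup Z) (∈-boundary s i<r w∈)

        Seen : ℕ → ℕ → Set
        Seen i j = colour (suc i) (suc j) ∈ B ⊎
          (∃[ i′ ] ∃[ j′ ] j′ ℕ.< r × i′ ℕ.* r ℕ.+ j′ ℕ.< i ℕ.* r ℕ.+ j × colour (suc i′) (suc j′) ≡ colour (suc i) (suc j))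

        old⇒seen : ∀ i j → i ℕ.< r → j ℕ.< r → Old i j → Seen i j
        old⇒seen i j i<r j<r (inj₁ in-b) = inj₁ in-b
        old⇒seen zero j i<r j<r (inj₂ (inj₁ eq)) = inj₁ (subst (_∈ B) eq (in-B j<r (here ≡.refl)))
        old⇒seen (suc i) j i<r j<r (inj₂ (inj₁ eq)) = inj₂ (i , j , j<r , ℕ.+-monoˡ-< j (ℕ.m<n+m (i ℕ.* r) (ℕ.>-nonZero⁻¹ r)) , eq)
        old⇒seen i zero i<r j<r (inj₂ (inj₂ eq)) = inj₁ (subst (_∈ B) eq (in-B i<r (there (there (here ≡.refl)))))
        old⇒seen i (suc j) i<r j<r (inj₂ (inj₂ eq)) = inj₂ (i , j , ℕ.<-trans (ℕ.n<1+n j) j<r , ℕ.+-monoʳ-< (i ℕ.* r) (ℕ.n<1+n j) , eq)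

      olds≤oldCount : olds ℕ.≤ oldCount B (cells s) Z
      olds≤oldCount = begin
        olds ≡⟨ ∑-cong r (λ i i<r → ∑-cong r (λ j j<r →
                  cong₂ (λ a b → 𝟙 (old? a b)) (≡.sym ([i*r+j]/r i j<r)) (≡.sym ([i*r+j]%r i j<r)))) ⟩
        ∑[< r ] (λ i → ∑[< r ] (λ j → f (i ℕ.* r ℕ.+ j))) ≡⟨ ∑-*-index r r ⟨
        ∑[< r ℕ.* r ] f ≤⟨ ∑≤oldCount Z (r ℕ.* r) B (cell s) (λ t → old? (t ℕ./ r) (t ℕ.% r)) earlier ⟩
        oldCount B (cells s) Z ∎
        where
        open ℕ.≤-Reasoning
        f : ℕ → ℕ
        f t = 𝟙 (old? (t ℕ./ r) (t ℕ.% r))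
        earlier : ∀ t → t ℕ.< r ℕ.* r → Old (t ℕ./ r) (t ℕ.% r) →
          lookup Z (cell s t) ∈ B ⊎ ∃[ u ] u ℕ.< t × lookup Z (cell s u) ≡ lookup Z (cell s t)
        earlier t t<r² old with old⇒seen (t ℕ./ r) (t ℕ.% r) (row<r t<r²) (m%n<n t r) old
        ... | inj₁ in-b = inj₁ in-b
        ... | inj₂ (i , j , j<r , before , eq) = inj₂ (i ℕ.* r ℕ.+ j ,
          subst (i ℕ.* r ℕ.+ j ℕ.<_) (≡.trans (ℕ.+-comm (t ℕ./ r ℕ.* r) _) (≡.sym (m≡m%n+[m/n]*n t r))) before ,
          ≡.trans (cong (lookup Z) (cell-index s i j<r)) eq)

      private
        rows cols : ℕ
        rows = ∑[< r ] (λ j → ∑[< suc r ] (λ i → 𝟙 (mono? Z (rowSlot s j i))))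
        cols = ∑[< r ] (λ i → ∑[< suc r ] (λ j → 𝟙 (mono? Z (colSlot s i j))))

        length-slots : length (filter (mono? Z) (slots s)) ≡ rows ℕ.+ cols
        length-slots = ≡.trans (cong length (List.filter-++ (mono? Z) (List.concat (List.applyUpTo (λ j → List.applyUpTo (rowSlot s j) (suc r)) r)) _))
          (≡.trans (List.length-++ (filter (mono? Z) (List.concat (List.applyUpTo (λ j → List.applyUpTo (rowSlot s j) (suc r)) r))))
            (cong₂ ℕ._+_ (count (rowSlot s)) (count (colSlot s))))
          where
          count : ∀ (f : ℕ → ℕ → Slot) → length (filter (mono? Z) (List.concat (List.applyUpTo (λ j → List.applyUpTo (f j) (suc r)) r)))
                    ≡ ∑[< r ] (λ j → ∑[< suc r ] (λ i → 𝟙 (mono? Z (f j i))))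
          count f = ≡.trans (length-filter-concat (mono? Z) (λ j → List.applyUpTo (f j) (suc r)) r)
            (∑-cong r (λ j _ → length-filter-applyUpTo (mono? Z) (f j) (suc r)))

        rows-bound : r ℕ.* rows ℕ.≤ suc r ℕ.* olds
        rows-bound = begin
          r ℕ.* rows ≡⟨ ∑-* r r ⟩
          ∑[< r ] (λ j → r ℕ.* ∑[< suc r ] (λ i → 𝟙 (mono? Z (rowSlot s j i)))) ≤⟨ ∑-mono r (λ j j<r →
            row-bound B (λ i → colour i (suc j)) (λ i → 𝟙 (old? i j)) r
              (λ i _ eq → ℕ.≤-reflexive (≡.sym (𝟙-yes (old? i j) (inj₂ (inj₁ eq)))))
              (λ i _ in-b → ℕ.≤-reflexive (≡.sym (𝟙-yes (old? i j) (inj₁ in-b))))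
              (in-B j<r (here ≡.refl)) (in-B j<r (there (here ≡.refl)))) ⟩
          ∑[< r ] (λ j → suc r ℕ.* ∑[< r ] (λ i → 𝟙 (old? i j))) ≡⟨ ∑-* r (suc r) ⟨
          suc r ℕ.* ∑[< r ] (λ j → ∑[< r ] (λ i → 𝟙 (old? i j))) ≡⟨ cong (suc r ℕ.*_) (∑-swap r r) ⟩
          suc r ℕ.* olds ∎
          where open ℕ.≤-Reasoning

        cols-bound : r ℕ.* cols ℕ.≤ suc r ℕ.* olds
        cols-bound = begin
          r ℕ.* cols ≡⟨ ∑-* r r ⟩
          ∑[< r ] (λ i → r ℕ.* ∑[< suc r ] (λ j → 𝟙 (mono? Z (colSlot s i j)))) ≤⟨ ∑-mono r (λ i i<r →
            row-bound B (colour (suc i)) (λ j → 𝟙 (old? i j)) r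
              (λ j _ eq → ℕ.≤-reflexive (≡.sym (𝟙-yes (old? i j) (inj₂ (inj₂ eq)))))
              (λ j _ in-b → ℕ.≤-reflexive (≡.sym (𝟙-yes (old? i j) (inj₁ in-b))))
              (in-B i<r (there (there (here ≡.refl)))) (in-B i<r (there (there (there (here ≡.refl)))))) ⟩
          ∑[< r ] (λ i → suc r ℕ.* ∑[< r ] (λ j → 𝟙 (old? i j))) ≡⟨ ∑-* r (suc r) ⟨
          suc r ℕ.* olds ∎
          where open ℕ.≤-Reasoning

      -- An old cell pays once in each direction, at (r + 1)/r each; this is where the exponent 2 +
      -- 2/r of λ per old cell arises.
      incidentMono-bound : r ℕ.* incidentMono (subgrid r s) Z ℕ.≤ (2 ℕ.* r ℕ.+ 2) ℕ.* oldCount B (cells s) Z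
      incidentMono-bound = begin
        r ℕ.* incidentMono (subgrid r s) Z             ≤⟨ ℕ.*-monoʳ-≤ r (incidentMono≤slots s Z) ⟩
        r ℕ.* length (filter (mono? Z) (slots s))      ≡⟨ cong (r ℕ.*_) length-slots ⟩
        r ℕ.* (rows ℕ.+ cols)                          ≡⟨ ℕ.*-distribˡ-+ r rows cols ⟩
        r ℕ.* rows ℕ.+ r ℕ.* cols                      ≤⟨ ℕ.+-mono-≤ rows-bound cols-bound ⟩
        suc r ℕ.* olds ℕ.+ suc r ℕ.* olds              ≡⟨ ℕ.*-distribʳ-+ olds (suc r) (suc r) ⟨
        (suc r ℕ.+ suc r) ℕ.* olds                     ≡⟨ cong (ℕ._* olds) 2+2r ⟩
        (2 ℕ.* r ℕ.+ 2) ℕ.* olds                       ≤⟨ ℕ.*-monoʳ-≤ (2 ℕ.* r ℕ.+ 2) olds≤oldCount ⟩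
        (2 ℕ.* r ℕ.+ 2) ℕ.* oldCount B (cells s) Z     ∎
        where
        open ℕ.≤-Reasoning
        2+2r : suc r ℕ.+ suc r ≡ 2 ℕ.* r ℕ.+ 2
        2+2r = ≡.trans (cong suc (ℕ.+-suc r r)) (≡.trans (ℕ.+-comm 2 (r ℕ.+ r))
          (cong (λ k → r ℕ.+ k ℕ.+ 2) (≡.sym (ℕ.+-identityʳ r))))

-- The number of subgrids and the locality of their weights

deduplicate-unique : ∀ {A : Set} (_≟_ : ∀ (x y : A) → Dec (x ≡ y)) {xs} → Unique xs → List.deduplicate _≟_ xs ≡ xs
deduplicate-unique _≟_ [] = ≡.refl
deduplicate-unique _≟_ {x ∷ xs} (x∉xs ∷ xs!) = cong (x ∷_) (≡.trans
  (cong (filter (λ y → ¬? (x ≟ y))) (deduplicate-unique _≟_ xs!)) (List.filter-all _ x∉xs))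

-- For counts of monochromatic edges: recolouring changes `Q`, but only on edges that `P` discards.
filter-filter-cong : ∀ {A : Set} {P Q Q′ : A → Set} (P? : ∀ x → Dec (P x)) (Q? : ∀ x → Dec (Q x)) (Q′? : ∀ x → Dec (Q′ x)) xs →
  (∀ x → x ∈ xs → P x → (Q x → Q′ x) × (Q′ x → Q x)) → filter P? (filter Q? xs) ≡ filter P? (filter Q′? xs)
filter-filter-cong P? Q? Q′? [] Q⇔Q′ = ≡.refl
filter-filter-cong P? Q? Q′? (x ∷ xs) Q⇔Q′
  with ih ← filter-filter-cong P? Q? Q′? xs (λ y y∈xs → Q⇔Q′ y (there y∈xs)) | Q? x | Q′? x
... | yes _ | yes _ = head
  where
  head : filter P? (x ∷ filter Q? xs) ≡ filter P? (x ∷ filter Q′? xs)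
  head with P? x
  ... | yes _ = cong (x ∷_) ih
  ... | no _  = ih
... | no _ | no _ = ih
... | yes q | no ¬q′ = ≡.trans (List.filter-reject P? (λ p → ¬q′ (proj₁ (Q⇔Q′ x (here ≡.refl) p) q))) ih
... | no ¬q | yes q′ = ≡.trans ih (≡.sym (List.filter-reject P? (λ p → ¬q (proj₂ (Q⇔Q′ x (here ≡.refl) p) q′))))

length-filter-¬ : ∀ {A : Set} {P : A → Set} (P? : ∀ x → Dec (P x)) xs →
  length xs ≡ length (filter P? xs) ℕ.+ length (filter (λ x → ¬? (P? x)) xs)
length-filter-¬ P? []       = ≡.refl
length-filter-¬ P? (x ∷ xs) with P? x
... | yes _ = cong suc (length-filter-¬ P? xs)
... | no _  = ≡.trans (cong suc (length-filter-¬ P? xs)) (≡.sym (ℕ.+-suc _ _))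

length-cartesianProduct : ∀ {A B : Set} (xs : List A) (ys : List B) →
  length (cartesianProduct xs ys) ≡ length xs ℕ.* length ys
length-cartesianProduct []       ys = ≡.refl
length-cartesianProduct (x ∷ xs) ys = ≡.trans (List.length-++ (map (x ,_) ys))
  (cong₂ ℕ._+_ (List.length-map (x ,_) ys) (length-cartesianProduct xs ys))

module Subgrids (L r : ℕ) .{{L>1 : NonTrivial L}} .{{r≢0 : NonZero r}} (r≤L-2 : r ℕ.≤ L ℕ.∸ 2) where

  open Grid L r r≤L-2
  open Graph G

  positions : List Position
  positions = cartesianProduct (allFin L) (allFin L)

  positions! : Unique positions
  positions! = Unique.cartesianProduct⁺ (Unique.allFin⁺ L) (Unique.allFin⁺ L)

  ∈-positions : ∀ s → s ∈ positions
  ∈-positions (a , b) = ∈-cartesianProduct⁺ (∈-allFin a) (∈-allFin b)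

  private
    ⊕0 : ∀ (a : Fin L) → a ⊕ 0 ≡ a
    ⊕0 a = ⊕-multiple a 0

    ∈cells : ∀ s i j → i ℕ.< r → j ℕ.< r → vertex (proj₁ s ⊕ i , proj₂ s ⊕ j) ∈ cells s
    ∈cells s i j i<r j<r = subst (_∈ cells s) (window-suc s i j) (window∈cells s i<r j<r)

    ∈cells⁻ : ∀ s {p} → vertex p ∈ cells s →
              ∃[ i ] ∃[ j ] i ℕ.< r × j ℕ.< r × proj₁ p ≡ proj₁ s ⊕ i × proj₂ p ≡ proj₂ s ⊕ j
    ∈cells⁻ s {p} p∈ with ∈-cells⁻ s p∈
    ... | i , j , i<r , j<r , eq = i , j , i<r , j<r , cong proj₁ p≡ , cong proj₂ p≡
      where
      p≡ : p ≡ (proj₁ s ⊕ i , proj₂ s ⊕ j)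
      p≡ = vertex-injective (≡.trans eq (window-suc s i j))

    -- As r < L, going on from `a` does not lead back to `a` within r steps; so a cyclic interval of
    -- length r has a well-defined first point.
    no-successor : ∀ (a : Fin L) {c k} → k ℕ.< r → c ≡ a ⊕ k → a ≢ c ⊕ 1
    no-successor a {k = k} k<r ≡.refl a≡ with ⊕-fixed a (k ℕ.+ 1)
      (subst (ℕ._< L) (ℕ.+-comm 1 k) (ℕ.≤-<-trans k<r r<L)) (≡.trans a≡ (⊕-⊕ a k 1))
    ... | k+1≡0 with ≡.trans (ℕ.+-comm 1 k) k+1≡0
    ...   | ()

  -- The first point of an interval identifies it. If the corner of one subgrid lay further inside
  -- the other, its predecessor there would belong to the second subgrid but not to the first.
  cells-injective : ∀ {s s′} → (∀ {v} → v ∈ cells s → v ∈ cells s′) → (∀ {v} → v ∈ cells s′ → v ∈ cells s) → s ≡ s′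
  cells-injective {s} {s′} ⊆ ⊇ = from (∈cells⁻ s′ (⊆ s∈cells))
    where
    a a′ b b′ : Fin L
    a = proj₁ s
    b = proj₂ s
    a′ = proj₁ s′
    b′ = proj₂ s′
    s∈cells : vertex s ∈ cells s
    s∈cells = subst (_∈ cells s) (cong₂ (λ x y → vertex (x , y)) (⊕0 a) (⊕0 b))
      (∈cells s 0 0 (ℕ.>-nonZero⁻¹ r) (ℕ.>-nonZero⁻¹ r))
    from : ∃[ i ] ∃[ j ] i ℕ.< r × j ℕ.< r × a ≡ a′ ⊕ i × b ≡ b′ ⊕ j → s ≡ s′
    from (zero , zero , _ , _ , a≡ , b≡) = cong₂ _,_ (≡.trans a≡ (⊕0 a′)) (≡.trans b≡ (⊕0 b′))
    from (suc i , j , i<r , j<r , a≡ , b≡) = ⊥-elim (absurd (∈cells⁻ s (⊇ (∈cells s′ i j (ℕ.<-trans (ℕ.n<1+n i) i<r) j<r))))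
      where
      absurd : ∃[ k ] ∃[ l ] k ℕ.< r × l ℕ.< r × a′ ⊕ i ≡ a ⊕ k × b′ ⊕ j ≡ b ⊕ l → ⊥
      absurd (k , l , k<r , l<r , eq , _) = no-successor a k<r eq
        (≡.trans a≡ (≡.trans (cong (a′ ⊕_) (ℕ.+-comm 1 i)) (≡.sym (⊕-⊕ a′ i 1))))
    from (zero , suc j , i<r , j<r , a≡ , b≡) = ⊥-elim (absurd (∈cells⁻ s (⊇ (∈cells s′ 0 j i<r (ℕ.<-trans (ℕ.n<1+n j) j<r)))))
      where
      absurd : ∃[ k ] ∃[ l ] k ℕ.< r × l ℕ.< r × a′ ⊕ 0 ≡ a ⊕ k × b′ ⊕ j ≡ b ⊕ l → ⊥
      absurd (k , l , k<r , l<r , _ , eq) = no-successor b l<r eq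
        (≡.trans b≡ (≡.trans (cong (b′ ⊕_) (ℕ.+-comm 1 j)) (≡.sym (⊕-⊕ b′ j 1))))

  subgrid-injective : ∀ {s s′} → subgrid {L} r s ≡ subgrid r s′ → s ≡ s′
  subgrid-injective {s} {s′} eq = cells-injective
    (λ {v} v∈ → ∈-subgrid⁻ s′ (subst (v Subset.∈_) eq (∈-subgrid⁺ s v∈)))
    (λ {v} v∈ → ∈-subgrid⁻ s (subst (v Subset.∈_) (≡.sym eq) (∈-subgrid⁺ s′ v∈)))

  subgrids≡map : subgrids L r ≡ map (subgrid r) positions
  subgrids≡map = deduplicate-unique (Vec.≡-dec Bool._≟_) (Unique.map⁺ subgrid-injective positions!)

  length-positions : length positions ≡ L ℕ.* L
  length-positions = ≡.trans (length-cartesianProduct (allFin L) (allFin L))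
    (cong₂ ℕ._*_ (List.length-tabulate {n = L} (λ i → i)) (List.length-tabulate {n = L} (λ i → i)))

  length-subgrids : length (subgrids L r) ≡ L ℕ.* L
  length-subgrids = ≡.trans (cong length subgrids≡map) (≡.trans (List.length-map (subgrid r) positions) length-positions)

  neighbours : Fin (L ℕ.* L) → List (Fin (L ℕ.* L))
  neighbours v = vertex (c ⊕ 1 , d) ∷ vertex (c ⊖ 1 , d) ∷ vertex (c , d ⊕ 1) ∷ vertex (c , d ⊖ 1) ∷ []
    where
    c = proj₁ (coordinates {L} v)
    d = proj₂ (coordinates {L} v)

  ~⇒∈-neighbours : ∀ {w v} → w ~ v → w ∈ neighbours v
  ~⇒∈-neighbours {w} {v} w~v = from w~v
    where
    a b c d : Fin L
    a = proj₁ (coordinates {L} w)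
    b = proj₂ (coordinates {L} w)
    c = proj₁ (coordinates {L} v)
    d = proj₂ (coordinates {L} v)
    w≡ : ∀ {x y} → a ≡ x → b ≡ y → w ≡ vertex (x , y)
    w≡ a≡x b≡y = ≡.trans (≡.sym (vertex-coordinates {L} w)) (cong₂ Fin.combine a≡x b≡y)
    previous : ∀ {x y : Fin L} → y ≡ x ⊕ 1 → x ≡ y ⊖ 1
    previous {x} eq = ≡.trans (≡.sym (⊕-⊖ x 1)) (cong (_⊖ 1) (≡.sym eq))
    from : (Consecutive a c × b ≡ d) ⊎ (Consecutive b d × a ≡ c) → w ∈ neighbours v
    from (inj₁ (inj₁ a≡c+1 , b≡d)) = here (w≡ a≡c+1 b≡d)
    from (inj₁ (inj₂ c≡a+1 , b≡d)) = there (here (w≡ (previous c≡a+1) b≡d))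
    from (inj₂ (inj₁ b≡d+1 , a≡c)) = there (there (here (w≡ a≡c b≡d+1)))
    from (inj₂ (inj₂ d≡b+1 , a≡c)) = there (there (there (here (w≡ a≡c (previous d≡b+1)))))

  -- An edge that meets the subgrid has both ends different from `v`, since neither `v` nor a
  -- neighbour of `v` lies in the subgrid.
  incidentMono-update : ∀ {q} s {v} (b : Fin q) Z → v ∉ cells s → (∀ {w} → w ∈ neighbours v → w ∉ cells s) →
    incidentMono (subgrid r s) (Z [ v ]≔ b) ≡ incidentMono (subgrid r s) Z
  incidentMono-update s {v} b Z v∉ nbrs∉ = cong length (filter-filter-cong
    (incident? (subgrid r s)) (mono? (Z [ v ]≔ b)) (mono? Z) edges unchanged)
    where
    unchanged : ∀ e → e ∈ edges → proj₁ e Subset.∈ subgrid r s ⊎ proj₂ e Subset.∈ subgrid r s → _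
    unchanged (x , y) e∈ inc = (λ eq → ≡.trans (≡.sym x≡) (≡.trans eq y≡)) , (λ eq → ≡.trans x≡ (≡.trans eq (≡.sym y≡)))
      where
      x~y = proj₂ (∈-edges⁻ e∈)
      x≢v : _ → x ≢ v
      x≢v (inj₁ x∈) ≡.refl = v∉ (∈-subgrid⁻ s x∈)
      x≢v (inj₂ y∈) ≡.refl = nbrs∉ (~⇒∈-neighbours {y} {x} (~-sym {x} {y} x~y)) (∈-subgrid⁻ s y∈)
      y≢v : _ → y ≢ v
      y≢v (inj₁ x∈) ≡.refl = nbrs∉ (~⇒∈-neighbours {x} {y} x~y) (∈-subgrid⁻ s x∈)
      y≢v (inj₂ y∈) ≡.refl = v∉ (∈-subgrid⁻ s y∈)
      x≡ : lookup (Z [ v ]≔ b) x ≡ lookup Z x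
      x≡ = Vec.lookup∘update′ (x≢v inc) Z b
      y≡ : lookup (Z [ v ]≔ b) y ≡ lookup Z y
      y≡ = Vec.lookup∘update′ (y≢v inc) Z b

-- Bounding the partition function of a block

module OldVertices (ℝ : RealNumbers) where
  open OrderedField ℝ
  open Sums ℝ

  module _ {q : ℕ} where
    open import Data.List.Membership.DecPropositional (Fin._≟_ {q}) using () renaming (_∈?_ to _∈ᶜ?_)

    module _ (p : Carrier) (0<p : 0# < p) where

      private
        occurrences-nonneg : ∀ C (k : Fin q) → 0# ≤ Σ[ C ] (λ c → indicator (c Fin.≟ k) * p)
        occurrences-nonneg C k = Σ-nonneg C (λ c → *-nonneg (indicator-nonneg (c Fin.≟ k)) (inj₁ 0<p))

        p≤occurrences : ∀ C {k : Fin q} → k ∈ C → p ≤ Σ[ C ] (λ c → indicator (c Fin.≟ k) * p)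
        p≤occurrences (c ∷ C) {k} (here k≡c) = gap-≤ (occurrences-nonneg C k)
          (+-congʳ (≈-sym (≈-trans (*-congʳ (indicator-yes (c Fin.≟ k) (≡.sym k≡c))) (*-identityˡ p))))
        p≤occurrences (c ∷ C) {k} (there k∈C) = ≤-trans (p≤occurrences C k∈C)
          (gap-≤ (*-nonneg (indicator-nonneg (c Fin.≟ k)) (inj₁ 0<p)) (+-comm _ _))

        -- Counting occurrences in `C` instead of distinct colours makes the bound additive, so that
        -- its sum over `k` is q + |C| p.
        p^𝟙≤ : ∀ C (k : Fin q) → p ^ 𝟙 (k ∈ᶜ? C) ≤ 1# + Σ[ C ] (λ c → indicator (c Fin.≟ k) * p)
        p^𝟙≤ C k with k ∈ᶜ? C
        ... | no _    = gap-≤ (occurrences-nonneg C k) ≈-refl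
        ... | yes k∈C = ≤-trans (≤-reflexive (*-identityʳ p)) (≤-trans (p≤occurrences C k∈C)
            (gap-≤ 0≤1 (+-comm _ _)))

        Σ-p^𝟙≤ : ∀ C → Σ[ allFin q ] (λ k → p ^ 𝟙 (k ∈ᶜ? C)) ≤ fromℕ q + fromℕ (length C) * p
        Σ-p^𝟙≤ C = begin
          Σ[ allFin q ] (λ k → p ^ 𝟙 (k ∈ᶜ? C)) ≤⟨ Σ-mono (allFin q) (λ k _ → p^𝟙≤ C k) ⟩
          Σ[ allFin q ] (λ k → 1# + Σ[ C ] (λ c → indicator (c Fin.≟ k) * p)) ≈⟨ Σ-+ (allFin q) ⟩
          Σ[ allFin q ] (λ _ → 1#) + Σ[ allFin q ] (λ k → Σ[ C ] (λ c → indicator (c Fin.≟ k) * p))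
            ≈⟨ +-cong (≈-trans (Σ-const (allFin q) 1#) (≈-trans (*-identityʳ _)
                 (≈-reflexive (cong fromℕ (List.length-tabulate {n = q} (λ i → i))))))
               (≈-trans (Σ-swap (allFin q) C) (≈-trans
                 (Σ-cong C (λ c → Σ-point Fin._≟_ (Unique.allFin⁺ q) (∈-allFin c) (λ _ → p))) (Σ-const C p))) ⟩
          fromℕ q + fromℕ (length C) * p ∎
          where open ≤-Reasoning

      -- The first cell contributes a factor of at most q + |C| p, and its colour then joins `C`.
      -- The lengths of `C` and of the remaining cells keep a constant sum, so one base bounds every
      -- factor.
      recolour-p^oldCount : ∀ {n} ws C {X : Config n q} → Unique ws →
        recolour ws (λ Z → p ^ oldCount C ws Z) X ≤ (fromℕ q + fromℕ (length C ℕ.+ length ws) * p) ^ length ws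
      recolour-p^oldCount []       C _ = ≤-refl
      recolour-p^oldCount (w ∷ ws) C {X} (w∉ws ∷ ws!) = begin
        Σ[ allFin q ] (λ k → recolour ws (λ Z → p ^ oldCount C (w ∷ ws) Z) (X [ w ]≔ k))
          ≈⟨ Σ-cong (allFin q) (λ k → ≈-trans (recolour-cong ws (λ Z agree → split k Z agree)) (recolour-*ˡ ws _)) ⟩
        Σ[ allFin q ] (λ k → p ^ 𝟙 (k ∈ᶜ? C) * recolour ws (λ Z → p ^ oldCount (k ∷ C) ws Z) (X [ w ]≔ k))
          ≤⟨ Σ-mono (allFin q) (λ k _ → *-monoˡ-≤ (^-nonneg (𝟙 (k ∈ᶜ? C)) (inj₁ 0<p))
               (≤-trans (recolour-p^oldCount ws (k ∷ C) ws!) (≤-reflexive (≈-reflexive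
                 (cong (λ m → (fromℕ q + fromℕ m * p) ^ length ws) (≡.sym (ℕ.+-suc (length C) (length ws)))))))) ⟩
        Σ[ allFin q ] (λ k → p ^ 𝟙 (k ∈ᶜ? C) * Q ^ length ws) ≈⟨ Σ-*ʳ (allFin q) _ ⟩
        Σ[ allFin q ] (λ k → p ^ 𝟙 (k ∈ᶜ? C)) * Q ^ length ws
          ≤⟨ *-monoʳ-≤ (^-nonneg (length ws) 0≤Q) (≤-trans (Σ-p^𝟙≤ C) (+-monoʳ-≤ (fromℕ q)
               (*-monoʳ-≤ (inj₁ 0<p) (fromℕ-mono-≤ (ℕ.m≤m+n (length C) (suc (length ws))))))) ⟩
        Q * Q ^ length ws ∎
        where
        open ≤-Reasoning
        Q = fromℕ q + fromℕ (length C ℕ.+ suc (length ws)) * p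
        0≤Q : 0# ≤ Q
        0≤Q = +-nonneg (fromℕ-nonneg q) (*-nonneg (fromℕ-nonneg (length C ℕ.+ suc (length ws))) (inj₁ 0<p))
        split : ∀ k Z → Agree ws (X [ w ]≔ k) Z →
                p ^ oldCount C (w ∷ ws) Z ≈ p ^ 𝟙 (k ∈ᶜ? C) * p ^ oldCount (k ∷ C) ws Z
        split k Z agree = ≈-trans (≈-reflexive (cong (λ j → p ^ (𝟙 (j ∈ᶜ? C) ℕ.+ oldCount (j ∷ C) ws Z)) Zw≡k))
          (^-homo-* p (𝟙 (k ∈ᶜ? C)) (oldCount (k ∷ C) ws Z))
          where
          Zw≡k : lookup Z w ≡ k
          Zw≡k = ≡.trans (agree w (λ w∈ws → All.lookup w∉ws w∈ws ≡.refl)) (Vec.lookup∘update w X k)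

  -- With x = y/Q: (1 + x)^m ≤ 1 + 2mx while 2mx ≤ 1, because in the inductive step the product of x
  -- and 2mx is at most x. The factors Q clear denominators.
  perturbed-power : ∀ {Q y} → 0# < Q → 0# ≤ y → ∀ m → fromℕ (2 ℕ.* m) * y ≤ Q →
    (Q + y) ^ m * Q ≤ Q ^ m * (Q + fromℕ (2 ℕ.* m) * y)
  perturbed-power {Q} {y} 0<Q 0≤y zero small = *-monoˡ-≤ 0≤1 (gap-≤ (*-nonneg ≤-refl 0≤y) ≈-refl)
  perturbed-power {Q} {y} 0<Q 0≤y (suc m) small = begin
    ((Q + y) * (Q + y) ^ m) * Q            ≈⟨ *-assoc _ _ _ ⟩
    (Q + y) * ((Q + y) ^ m * Q)            ≤⟨ *-monoˡ-≤ 0≤Q+y (perturbed-power 0<Q 0≤y m small′) ⟩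
    (Q + y) * (Q ^ m * (Q + c * y))        ≈⟨ solve 4 (λ Q y Qᵐ c → (Q :+ y) :* (Qᵐ :* (Q :+ c :* y)) :=
                                               Qᵐ :* ((Q :* Q :+ c :* y :* Q :+ y :* Q) :+ y :* (c :* y))) ≈-refl Q y (Q ^ m) c ⟩
    Q ^ m * ((Q * Q + c * y * Q + y * Q) + y * (c * y))
      ≤⟨ *-monoˡ-≤ (^-nonneg m (inj₁ 0<Q)) (+-monoʳ-≤ _ (*-monoˡ-≤ 0≤y small′)) ⟩
    Q ^ m * ((Q * Q + c * y * Q + y * Q) + y * Q)
      ≈⟨ solve 4 (λ Q y Qᵐ c → Qᵐ :* ((Q :* Q :+ c :* y :* Q :+ y :* Q) :+ y :* Q) :=
           (Q :* Qᵐ) :* (Q :+ (con (ℤ.+ 2) :+ c) :* y)) ≈-refl Q y (Q ^ m) c ⟩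
    (Q * Q ^ m) * (Q + (fromℕ 2 + c) * y)
      ≈⟨ *-congˡ (+-congˡ (*-congʳ (≈-trans (≈-sym (fromℕ-+ 2 (2 ℕ.* m))) (≈-reflexive (cong fromℕ (≡.sym (ℕ.*-suc 2 m))))))) ⟩
    (Q * Q ^ m) * (Q + fromℕ (2 ℕ.* suc m) * y) ∎
    where
    open ≤-Reasoning
    c = fromℕ (2 ℕ.* m)
    0≤Q+y : 0# ≤ Q + y
    0≤Q+y = +-nonneg (inj₁ 0<Q) 0≤y
    small′ : c * y ≤ Q
    small′ = ≤-trans (*-monoʳ-≤ 0≤y (fromℕ-mono-≤ (ℕ.*-monoʳ-≤ 2 (ℕ.n≤1+n m)))) small

-- On the left, 64 r² is the accuracy wanted, 2 r² comes from `perturbed-power`, and 4r + r² counts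
-- boundary places and cells. As r ≥ 1 this is at most 640 r^6, far below the factor in the lower
-- bound on q.
constant-bound : ∀ r → .{{NonZero r}} →
  128 ℕ.* (r ℕ.* r) ℕ.* (r ℕ.* r) ℕ.* (r ℕ.* 4 ℕ.+ r ℕ.* r) ℕ.≤
  2 ℕ.^ (r ℕ.^ 2 ℕ.+ 8 ℕ.* r ℕ.+ 3) ℕ.* r ℕ.^ (2 ℕ.* r ℕ.^ 2 ℕ.+ 4 ℕ.* r ℕ.+ 1)
constant-bound r@(suc _) = begin
  128 ℕ.* (r ℕ.* r) ℕ.* (r ℕ.* r) ℕ.* (r ℕ.* 4 ℕ.+ r ℕ.* r)
    ≤⟨ ℕ.*-monoʳ-≤ (128 ℕ.* (r ℕ.* r) ℕ.* (r ℕ.* r)) (ℕ.+-monoˡ-≤ (r ℕ.* r) (ℕ.*-monoˡ-≤ 4 (ℕ.m≤m*n r r))) ⟩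
  128 ℕ.* (r ℕ.* r) ℕ.* (r ℕ.* r) ℕ.* (r ℕ.* r ℕ.* 4 ℕ.+ r ℕ.* r)
    ≡⟨ expand r ⟩
  640 ℕ.* r ℕ.^ 6 ≤⟨ ℕ.*-mono-≤ 640≤ (ℕ.^-monoʳ-≤ r 6≤) ⟩
  2 ℕ.^ (r ℕ.^ 2 ℕ.+ 8 ℕ.* r ℕ.+ 3) ℕ.* r ℕ.^ (2 ℕ.* r ℕ.^ 2 ℕ.+ 4 ℕ.* r ℕ.+ 1) ∎
  where
  open ℕ.≤-Reasoning
  expand : ∀ r → 128 ℕ.* (r ℕ.* r) ℕ.* (r ℕ.* r) ℕ.* (r ℕ.* r ℕ.* 4 ℕ.+ r ℕ.* r) ≡ 640 ℕ.* r ℕ.^ 6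
  expand = solve 1 (λ r → con 128 :* (r :* r) :* (r :* r) :* (r :* r :* con 4 :+ r :* r) := con 640 :* r :^ 6) ≡.refl
    where open +-*-Solver
  1≤r : 1 ℕ.≤ r
  1≤r = s≤s z≤n
  640≤ : 640 ℕ.≤ 2 ℕ.^ (r ℕ.^ 2 ℕ.+ 8 ℕ.* r ℕ.+ 3)
  -- The exponent is at least 8 + 3 = 11, and 640 + 1408 = 2048 = 2^11.
  640≤ = ℕ.≤-trans (ℕ.m≤m+n 640 1408) (ℕ.^-monoʳ-≤ 2 {x = 11} (ℕ.+-monoˡ-≤ 3 (ℕ.≤-trans (ℕ.*-monoʳ-≤ 8 1≤r) (ℕ.m≤n+m (8 ℕ.* r) (r ℕ.^ 2)))))
  6≤ : 6 ℕ.≤ 2 ℕ.* r ℕ.^ 2 ℕ.+ 4 ℕ.* r ℕ.+ 1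
  6≤ = ℕ.≤-trans (ℕ.m≤m+n 6 1) (ℕ.+-monoˡ-≤ 1 (ℕ.+-mono-≤ (ℕ.*-monoʳ-≤ 2 (ℕ.^-monoˡ-≤ 2 1≤r)) (ℕ.*-monoʳ-≤ 4 1≤r)))

-- Partial sums of the exponential series and estimates for the logarithm

module Exponential (ℝ : RealNumbers) where
  open OrderedField ℝ
  open Sums ℝ

  term : ℕ → Carrier → Carrier
  term k y = y ^ k / fromℕ (k !)

  partialExp : ℕ → Carrier → Carrier
  partialExp m y = Σ[ upTo m ] (λ k → term k y)

  partialExp-suc : ∀ m y → partialExp (suc m) y ≈ partialExp m y + term m y
  partialExp-suc m y = ≈-trans
    (≈-reflexive (cong (λ ks → Σ[ ks ] (λ k → term k y)) (≡.sym (List.upTo-∷ʳ m))))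
    (≈-trans (Σ-++ (upTo m) (m ∷ [])) (+-congˡ (+-identityʳ _)))

  0<k! : ∀ k → 0# < fromℕ (k !)
  0<k! k = fromℕ-pos (k !) {{k ℕ.!≢0}}

  term-* : ∀ k y → fromℕ (k !) * term k y ≈ y ^ k
  term-* k y = y*[x/y]≈x (0<k! k)

  term-nonneg : ∀ k {y} → 0# ≤ y → 0# ≤ term k y
  term-nonneg k 0≤y = /-nonneg (^-nonneg k 0≤y) (0<k! k)

  term-mono : ∀ k {y z} → 0# ≤ y → y ≤ z → term k y ≤ term k z
  term-mono k 0≤y y≤z = *-monoʳ-≤ (inj₁ (⁻¹-pos (0<k! k))) (^-mono-≤ k 0≤y y≤z)

  partialExp-mono : ∀ m {y z} → 0# ≤ y → y ≤ z → partialExp m y ≤ partialExp m z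
  partialExp-mono m 0≤y y≤z = Σ-mono (upTo m) (λ k _ → term-mono k 0≤y y≤z)

  partialExp-≤-suc : ∀ m {y} → 0# ≤ y → partialExp m y ≤ partialExp (suc m) y
  partialExp-≤-suc m 0≤y = gap-≤ (term-nonneg m 0≤y) (≈-sym (partialExp-suc m _))

  fromℕ-! : ∀ k → fromℕ (suc k !) ≈ fromℕ (suc k) * fromℕ (k !)
  fromℕ-! k = fromℕ-* (suc k) (k !)

  term-0 : ∀ y → term 0 y ≈ 1#
  term-0 y = *-cancelˡ-≈ (0<k! 0) (≈-trans (term-* 0 y) (≈-sym (≈-trans (*-identityʳ _) fromℕ-1)))

  partialExp-1 : ∀ y → partialExp 1 y ≈ 1#
  partialExp-1 y = ≈-trans (+-identityʳ _) (term-0 y)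

  partialExp-at-0 : ∀ m → partialExp (suc m) 0# ≈ 1#
  partialExp-at-0 zero    = partialExp-1 0#
  partialExp-at-0 (suc m) = ≈-trans (partialExp-suc (suc m) 0#) (≈-trans
    (+-cong (partialExp-at-0 m) (≈-trans (*-congʳ (zeroˡ _)) (zeroˡ _))) (+-identityʳ 1#))

  module _ {x y : Carrier} (0≤x : 0# ≤ x) (0≤y : 0# ≤ y) where
    private
      z = y + x
      0≤z : 0# ≤ z
      0≤z = +-nonneg 0≤y 0≤x
      y≤z : y ≤ z
      y≤z = gap-≤ 0≤x ≈-refl

    -- Mean value estimate for a power, with the derivative at the right end `z`, where it is
    -- largest.
    power-increment : ∀ k → z ^ suc k ≤ y ^ suc k + fromℕ (suc k) * (x * z ^ k)
    power-increment zero = ≤-reflexive (≈-trans (*-identityʳ z) (≈-sym (+-cong (*-identityʳ y)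
      (≈-trans (*-congʳ fromℕ-1) (≈-trans (*-identityˡ _) (*-identityʳ x))))))
    power-increment (suc k) = begin
      z * z ^ suc k ≤⟨ *-monoˡ-≤ 0≤z (power-increment k) ⟩
      z * (y ^ suc k + n * (x * z ^ k))
        ≈⟨ solve 5 (λ x y n yᵏ zᵏ → (y :+ x) :* (yᵏ :+ n :* (x :* zᵏ)) := (y :* yᵏ :+ n :* (x :* ((y :+ x) :* zᵏ))) :+ x :* yᵏ)
             ≈-refl x y n (y ^ suc k) (z ^ k) ⟩
      (y ^ suc (suc k) + n * (x * z ^ suc k)) + x * y ^ suc k ≤⟨ +-monoʳ-≤ _ (*-monoˡ-≤ 0≤x (^-mono-≤ (suc k) 0≤y y≤z)) ⟩
      (y ^ suc (suc k) + n * (x * z ^ suc k)) + x * z ^ suc k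
        ≈⟨ ≈-trans (+-assoc _ _ _) (+-congˡ (≈-trans (+-comm _ _) (≈-sym (≈-trans (distribʳ _ 1# n) (+-congʳ (*-identityˡ _)))))) ⟩
      y ^ suc (suc k) + fromℕ (suc (suc k)) * (x * z ^ suc k) ∎
      where
      open ≤-Reasoning
      n = fromℕ (suc k)

    term-increment : ∀ k → term (suc k) z ≤ term (suc k) y + x * term k z
    term-increment k = x≤y*z⇒x/y≤z (0<k! (suc k)) (begin
      z ^ suc k ≤⟨ power-increment k ⟩
      y ^ suc k + fromℕ (suc k) * (x * z ^ k)
        ≈⟨ +-cong (≈-sym (term-* (suc k) y)) (*-congˡ (*-congˡ (≈-sym (term-* k z)))) ⟩
      fromℕ (suc k !) * term (suc k) y + fromℕ (suc k) * (x * (fromℕ (k !) * term k z))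
        ≈⟨ +-congˡ (≈-trans (solve 4 (λ n x f t → n :* (x :* (f :* t)) := (n :* f) :* (x :* t)) ≈-refl (fromℕ (suc k)) x (fromℕ (k !)) (term k z))
             (*-congʳ (≈-sym (fromℕ-! k)))) ⟩
      fromℕ (suc k !) * term (suc k) y + fromℕ (suc k !) * (x * term k z) ≈⟨ distribˡ _ _ _ ⟨
      fromℕ (suc k !) * (term (suc k) y + x * term k z) ∎)
      where open ≤-Reasoning

    -- The derivative of a partial sum is the partial sum with one term less; this is the
    -- corresponding mean value estimate, summed from `term-increment`.
    partialExp-increment : ∀ m → partialExp (suc m) z ≤ partialExp (suc m) y + x * partialExp m z
    partialExp-increment zero = ≤-reflexive (≈-trans (partialExp-1 z) (≈-sym (≈-trans (+-cong (partialExp-1 y) (zeroʳ x)) (+-identityʳ 1#))))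
    partialExp-increment (suc m) = begin
      partialExp (suc (suc m)) z ≈⟨ partialExp-suc (suc m) z ⟩
      partialExp (suc m) z + term (suc m) z ≤⟨ +-mono-≤ (partialExp-increment m) (term-increment m) ⟩
      (partialExp (suc m) y + x * partialExp m z) + (term (suc m) y + x * term m z)
        ≈⟨ solve 5 (λ a b c d x → (a :+ x :* b) :+ (c :+ x :* d) := (a :+ c) :+ x :* (b :+ d)) ≈-refl _ _ _ _ x ⟩
      (partialExp (suc m) y + term (suc m) y) + x * (partialExp m z + term m z)
        ≈⟨ +-cong (partialExp-suc (suc m) y) (*-congˡ (partialExp-suc m z)) ⟨
      partialExp (suc (suc m)) y + x * partialExp (suc m) z ∎
      where open ≤-Reasoning

  -- Partial sums satisfy no functional equation, so (1 - x) e^x ≤ 1 is obtained in this shifted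
  -- form, ready to be iterated.
  partialExp-shrink : ∀ m {x y} → 0# ≤ x → 0# ≤ y → (1# - x) * partialExp m (y + x) ≤ partialExp m y
  partialExp-shrink zero {x} _ _ = ≤-reflexive (zeroʳ _)
  partialExp-shrink (suc m) {x} {y} 0≤x 0≤y = begin
    (1# - x) * E        ≈⟨ ≈-trans (distribʳ E 1# (- x)) (+-cong (*-identityˡ E) (≈-sym (-‿distribˡ-* x E))) ⟩
    E - x * E           ≤⟨ +-monoˡ-≤ _ (≤-trans (partialExp-increment 0≤x 0≤y m)
                             (+-monoʳ-≤ _ (*-monoˡ-≤ 0≤x (partialExp-≤-suc m (+-nonneg 0≤y 0≤x))))) ⟩
    (partialExp (suc m) y + x * E) - x * E ≈⟨ solve 2 (λ a b → (a :+ b) :- b := a) ≈-refl _ (x * E) ⟩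
    partialExp (suc m) y ∎
    where
    open ≤-Reasoning
    E = partialExp (suc m) (y + x)

  -- Peels off one `x` per factor by `partialExp-shrink`; in the limit this is (1 - x)^t ≤ e^(-tx).
  partialExp-bound : ∀ m {x} → 0# ≤ x → x ≤ 1# → ∀ t → (1# - x) ^ t * partialExp m (fromℕ t * x) ≤ 1#
  partialExp-bound zero _ _ t = ≤-trans (≤-reflexive (zeroʳ _)) 0≤1
  partialExp-bound (suc m) {x} 0≤x x≤1 zero = ≤-trans (*-monoˡ-≤ 0≤1 (partialExp-mono (suc m)
    (≤-reflexive (≈-sym (zeroˡ x))) (≤-reflexive (zeroˡ x)))) (≤-reflexive (≈-trans (*-identityˡ _) (partialExp-at-0 m)))
  partialExp-bound m@(suc _) {x} 0≤x x≤1 (suc t) = begin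
    ((1# - x) * (1# - x) ^ t) * partialExp m (fromℕ (suc t) * x)
      ≈⟨ solve 3 (λ a b c → (a :* b) :* c := b :* (a :* c)) ≈-refl (1# - x) _ _ ⟩
    (1# - x) ^ t * ((1# - x) * partialExp m (fromℕ (suc t) * x))
      ≤⟨ *-monoˡ-≤ (^-nonneg t 0≤1-x) (≤-trans (*-monoˡ-≤ 0≤1-x (partialExp-mono m (*-nonneg (fromℕ-nonneg (suc t)) 0≤x)
           (≤-reflexive (≈-trans (distribʳ x 1# (fromℕ t)) (≈-trans (+-congʳ (*-identityˡ x)) (+-comm x _))))))
           (partialExp-shrink m 0≤x (*-nonneg (fromℕ-nonneg t) 0≤x))) ⟩
    (1# - x) ^ t * partialExp m (fromℕ t * x) ≤⟨ partialExp-bound m 0≤x x≤1 t ⟩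
    1# ∎
    where
    open ≤-Reasoning
    0≤1-x = x≤y⇒0≤y-x x≤1

  limit-≤ : ∀ {f y c} → f ⟶ y → (∀ m → f m ≤ c) → y ≤ c
  limit-≤ {f} {y} {c} f⟶y f≤c = ≮⇒≥ λ c<y → let N , close = f⟶y (y - c) (x<y⇒0<y-x c<y) in
    <⇒≱ (close N ℕ.≤-refl) (begin
      y - c       ≤⟨ +-monoʳ-≤ y (neg-mono-≤ (f≤c N)) ⟩
      y - f N     ≈⟨ solve 2 (λ y f → y :- f := :- (f :- y)) ≈-refl y (f N) ⟩
      - (f N - y) ≤⟨ -x≤abs (f N - y) ⟩
      abs (f N - y) ∎)
    where open ≤-Reasoning

  -- Turns t x ≥ ℓ into (1 - x)^t ≤ 1/e for e = exp ℓ. Division by the positive (1 - x)^t gives one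
  -- bound for all partial sums, which passes to the limit.
  exp-upper : ∀ {ℓ e x} t → IsExp ℓ e → 0# ≤ ℓ → 0# ≤ x → x < 1# → ℓ ≤ fromℕ t * x → (1# - x) ^ t * e ≤ 1#
  exp-upper {ℓ} {e} {x} t exp 0≤ℓ 0≤x x<1 ℓ≤tx = begin
    c * e          ≤⟨ *-monoˡ-≤ (inj₁ 0<c) (limit-≤ exp (λ m → y*z≤x⇒z≤x/y 0<c (≤-trans
                        (*-monoˡ-≤ (inj₁ 0<c) (partialExp-mono m 0≤ℓ ℓ≤tx)) (partialExp-bound m 0≤x (inj₁ x<1) t)))) ⟩
    c * (1# / c)   ≈⟨ y*[x/y]≈x 0<c ⟩
    1#             ∎
    where
    open ≤-Reasoning
    c = (1# - x) ^ t
    0<c : 0# < c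
    0<c = ^-pos t (x<y⇒0<y-x x<1)

  infix 4 ∣_∣≤_
  -- A pair of inequalities rather than a bound on `abs`, so that bounds combine without a case
  -- distinction on signs.
  ∣_∣≤_ : Carrier → Carrier → Set
  ∣ a ∣≤ b = a ≤ b × - a ≤ b

  ∣-∣≤ : ∀ {a b} → ∣ a ∣≤ b → ∣ - a ∣≤ b
  ∣-∣≤ {a} (a≤b , -a≤b) = -a≤b , ≤-trans (≤-reflexive (-‿involutive a)) a≤b

  -- Twice the slack b d - a c is (b - a)(d + c) + (b + a)(d - c), a sum of products of nonnegative
  -- factors.
  *-upper : ∀ {a b c d} → ∣ a ∣≤ b → ∣ c ∣≤ d → a * c ≤ b * d
  *-upper {a} {b} {c} {d} (a≤b , -a≤b) (c≤d , -c≤d) = *-cancelˡ-≤ (fromℕ-pos 2) (gap-≤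
    (+-nonneg (*-nonneg (x≤y⇒0≤y-x a≤b) (x≤y⇒0≤y-x -c≤d)) (*-nonneg (x≤y⇒0≤y-x -a≤b) (x≤y⇒0≤y-x c≤d)))
    (solve 4 (λ a b c d → con (ℤ.+ 2) :* (a :* c) :+ ((b :- a) :* (d :- :- c) :+ (b :- :- a) :* (d :- c))
      := con (ℤ.+ 2) :* (b :* d)) ≈-refl a b c d))

  ∣*∣≤ : ∀ {a b c d} → ∣ a ∣≤ b → ∣ c ∣≤ d → ∣ a * c ∣≤ b * d
  ∣*∣≤ {a} {c = c} ∣a∣≤b ∣c∣≤d = *-upper ∣a∣≤b ∣c∣≤d ,
    ≤-trans (≤-reflexive (-‿distribˡ-* a c)) (*-upper (∣-∣≤ ∣a∣≤b) ∣c∣≤d)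

  ∣+∣≤ : ∀ {a b c d} → ∣ a ∣≤ b → ∣ c ∣≤ d → ∣ a + c ∣≤ b + d
  ∣+∣≤ {a} {c = c} (a≤b , -a≤b) (c≤d , -c≤d) = +-mono-≤ a≤b c≤d ,
    ≤-trans (≤-reflexive (≈-sym (-‿+-comm a c))) (+-mono-≤ -a≤b -c≤d)

  ∣∣≤-cong : ∀ {a a′ b b′} → a ≈ a′ → b ≈ b′ → ∣ a ∣≤ b → ∣ a′ ∣≤ b′
  ∣∣≤-cong a≈a′ b≈b′ (a≤b , -a≤b) =
    ≤-trans (≤-reflexive (≈-sym a≈a′)) (≤-trans a≤b (≤-reflexive b≈b′)) ,
    ≤-trans (≤-reflexive (-‿cong (≈-sym a≈a′))) (≤-trans -a≤b (≤-reflexive b≈b′))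

  nonneg⇒∣∣≤ : ∀ {a b} → 0# ≤ a → a ≤ b → ∣ a ∣≤ b
  nonneg⇒∣∣≤ 0≤a a≤b = a≤b , ≤-trans (neg-mono-≤ 0≤a) (≤-trans (≤-reflexive -0#≈0#) (≤-trans 0≤a a≤b))

  ∣^∣≤ : ∀ {a b} k → ∣ a ∣≤ b → ∣ a ^ k ∣≤ b ^ k
  ∣^∣≤ zero    ∣a∣≤b = nonneg⇒∣∣≤ 0≤1 ≤-refl
  ∣^∣≤ (suc k) ∣a∣≤b = ∣*∣≤ ∣a∣≤b (∣^∣≤ k ∣a∣≤b)

  term-cong : ∀ k {y z} → y ≈ z → term k y ≈ term k z
  term-cong k y≈z = *-congʳ (^-congˡ k y≈z)

  partialExp-cong : ∀ m {y z} → y ≈ z → partialExp m y ≈ partialExp m z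
  partialExp-cong m y≈z = Σ-cong (upTo m) (λ k → term-cong k y≈z)

  term-1 : ∀ y → term 1 y ≈ y
  term-1 y = *-cancelˡ-≈ (0<k! 1) (≈-trans (term-* 1 y) (≈-trans (*-identityʳ y) (≈-sym (≈-trans (*-congʳ fromℕ-1) (*-identityˡ y)))))

  -- One Euler step from `z` to `z + h` between -y and 0. The powers alternate in sign there, so
  -- errors are measured by absolute values, that is, by the series at `y`.
  module EulerStep {y z h : Carrier} (0≤h : 0# ≤ h) (-y≤z : - y ≤ z) (z+h≤0 : z + h ≤ 0#) where
    private
      z≤z+h : z ≤ z + h
      z≤z+h = gap-≤ 0≤h ≈-refl

      0≤y : 0# ≤ y
      0≤y = ≤-trans (≤-reflexive (≈-sym -0#≈0#)) (≤-trans (neg-mono-≤ (≤-trans -y≤z (≤-trans z≤z+h z+h≤0))) (≤-reflexive (-‿involutive y)))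

      bounded : ∀ {w} → - y ≤ w → w ≤ 0# → ∣ w ∣≤ y
      bounded -y≤w w≤0 = ≤-trans w≤0 0≤y , ≤-trans (neg-mono-≤ -y≤w) (≤-reflexive (-‿involutive y))

      ∣z∣≤y : ∣ z ∣≤ y
      ∣z∣≤y = bounded -y≤z (≤-trans z≤z+h z+h≤0)

      ∣z+h∣≤y : ∣ z + h ∣≤ y
      ∣z+h∣≤y = bounded (≤-trans -y≤z z≤z+h) z+h≤0

      remainder : ℕ → Carrier
      remainder k = (z + h) ^ suc k - (z ^ suc k + fromℕ (suc k) * (h * z ^ k))

      remainder-0 : remainder 0 ≈ 0#
      remainder-0 = ≈-trans (+-cong (*-identityʳ _) (-‿cong (+-cong (*-identityʳ z)
        (≈-trans (*-congʳ fromℕ-1) (≈-trans (*-identityˡ _) (*-identityʳ h)))))) (-‿inverseʳ (z + h))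

      remainder-suc : ∀ k → remainder (suc k) ≈ (z + h) * remainder k + fromℕ (suc k) * ((h * h) * z ^ k)
      remainder-suc k = ≈-trans
        (+-congˡ (-‿cong (+-congˡ (≈-trans (distribʳ _ 1# n) (+-congʳ (*-identityˡ _))))))
        (solve 5 (λ z h n wᵏ zᵏ → (z :+ h) :* ((z :+ h) :* wᵏ) :- (z :* (z :* zᵏ) :+ (h :* (z :* zᵏ) :+ n :* (h :* (z :* zᵏ))))
          := (z :+ h) :* ((z :+ h) :* wᵏ :- (z :* zᵏ :+ n :* (h :* zᵏ))) :+ n :* ((h :* h) :* zᵏ)) ≈-refl z h n ((z + h) ^ k) (z ^ k))
        where n = fromℕ (suc k)

      -- In the induction the old bound times y and the new term add up to (k + 2)² h² y^(k + 1),
      -- which is at most (k + 3)(k + 2) h² y^(k + 1). Taylor's factor 1/2 is given up.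
      remainder-bound : ∀ k → ∣ remainder (suc k) ∣≤ fromℕ (suc (suc k)) * (fromℕ (suc k) * ((h * h) * y ^ k))
      remainder-bound zero = ∣∣≤-cong (≈-sym (≈-trans (remainder-suc 0) (≈-trans (+-congʳ (≈-trans (*-congˡ remainder-0) (zeroʳ _))) (+-identityˡ _)))) ≈-refl
        (nonneg⇒∣∣≤ 0≤h² (gap-≤ 0≤h² (≈-trans (+-cong (≈-sym (*-identityˡ _)) ≈-refl) (≈-trans (+-congˡ (≈-sym (*-identityˡ _)))
          (≈-trans (≈-sym (distribʳ _ 1# 1#)) (*-congʳ (+-congˡ (≈-sym fromℕ-1))))))))
        where
        0≤h² : 0# ≤ fromℕ 1 * ((h * h) * 1#)
        0≤h² = *-nonneg (fromℕ-nonneg 1) (*-nonneg (*-nonneg 0≤h 0≤h) 0≤1)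
      remainder-bound (suc k) = ∣∣≤-cong (≈-sym (remainder-suc (suc k))) ≈-refl
        (widen (∣+∣≤ (∣*∣≤ ∣z+h∣≤y (remainder-bound k)) (∣*∣≤ (nonneg⇒∣∣≤ (fromℕ-nonneg (2 ℕ.+ k)) ≤-refl)
          (∣*∣≤ (nonneg⇒∣∣≤ (*-nonneg 0≤h 0≤h) ≤-refl) (∣^∣≤ (suc k) ∣z∣≤y)))))
        where
        n = fromℕ (suc k)
        B = (h * h) * y ^ suc k
        0≤B : 0# ≤ B
        0≤B = *-nonneg (*-nonneg 0≤h 0≤h) (^-nonneg (suc k) 0≤y)
        larger : y * (fromℕ (2 ℕ.+ k) * (n * ((h * h) * y ^ k))) + fromℕ (2 ℕ.+ k) * B ≤ fromℕ (3 ℕ.+ k) * (fromℕ (2 ℕ.+ k) * B)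
        larger = gap-≤ (*-nonneg (fromℕ-nonneg (2 ℕ.+ k)) 0≤B) (≈-trans
          (solve 5 (λ o y n hh yᵏ → (y :* ((o :+ n) :* (n :* (hh :* yᵏ))) :+ (o :+ n) :* (hh :* (y :* yᵏ))) :+ (o :+ n) :* (hh :* (y :* yᵏ))
            := (n :+ con (ℤ.+ 2)) :* ((o :+ n) :* (hh :* (y :* yᵏ)))) ≈-refl 1# y n (h * h) (y ^ k))
          (*-congʳ (≈-trans (+-comm n (fromℕ 2)) (≈-sym (fromℕ-+ 2 (suc k))))))
        widen : ∀ {a} → ∣ a ∣≤ y * (fromℕ (2 ℕ.+ k) * (n * ((h * h) * y ^ k))) + fromℕ (2 ℕ.+ k) * B → ∣ a ∣≤ fromℕ (3 ℕ.+ k) * (fromℕ (2 ℕ.+ k) * B)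
        widen (a≤ , -a≤) = ≤-trans a≤ larger , ≤-trans -a≤ larger

    term-euler : ∀ k → term (2 ℕ.+ k) z + h * term (1 ℕ.+ k) z ≤ term (2 ℕ.+ k) (z + h) + (h * h) * term k y
    term-euler k = *-cancelˡ-≤ (0<k! (2 ℕ.+ k)) (begin
      F * (term (2 ℕ.+ k) z + h * term (1 ℕ.+ k) z) ≈⟨ distribˡ F _ _ ⟩
      F * term (2 ℕ.+ k) z + F * (h * term (1 ℕ.+ k) z)
        ≈⟨ +-cong (term-* (2 ℕ.+ k) z) (≈-trans (*-congʳ (fromℕ-! (suc k)))
             (≈-trans (solve 4 (λ n f h t → (n :* f) :* (h :* t) := n :* (h :* (f :* t))) ≈-refl n₂ (fromℕ (suc k !)) h (term (suc k) z))
               (*-congˡ (*-congˡ (term-* (suc k) z))))) ⟩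
      z ^ (2 ℕ.+ k) + n₂ * (h * z ^ suc k)
        ≈⟨ solve 2 (λ a b → a := b :+ :- (b :- a)) ≈-refl _ ((z + h) ^ (2 ℕ.+ k)) ⟩
      (z + h) ^ (2 ℕ.+ k) + - remainder (suc k) ≤⟨ +-monoʳ-≤ _ (proj₂ (remainder-bound k)) ⟩
      (z + h) ^ (2 ℕ.+ k) + n₂ * (n₁ * ((h * h) * y ^ k))
        ≈⟨ +-cong (≈-sym (term-* (2 ℕ.+ k) (z + h))) (≈-trans (*-congˡ (*-congˡ (*-congˡ (≈-sym (term-* k y)))))
             (≈-trans (solve 5 (λ n₂ n₁ hh f t → n₂ :* (n₁ :* (hh :* (f :* t))) := (n₂ :* (n₁ :* f)) :* (hh :* t)) ≈-refl n₂ n₁ (h * h) (fromℕ (k !)) (term k y))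
               (*-congʳ (≈-sym (≈-trans (fromℕ-! (suc k)) (*-congˡ (fromℕ-! k))))))) ⟩
      F * term (2 ℕ.+ k) (z + h) + F * ((h * h) * term k y) ≈⟨ distribˡ F _ _ ⟨
      F * (term (2 ℕ.+ k) (z + h) + (h * h) * term k y) ∎)
      where
      open ≤-Reasoning
      F = fromℕ ((2 ℕ.+ k) !)
      n₁ = fromℕ (1 ℕ.+ k)
      n₂ = fromℕ (2 ℕ.+ k)

    -- Second order Taylor estimate for partial sums: 2 + m, 1 + m and m are the indices of the
    -- function and of its first two derivatives.
    partialExp-euler : ∀ m → partialExp (2 ℕ.+ m) z + h * partialExp (1 ℕ.+ m) z ≤
                             partialExp (2 ℕ.+ m) (z + h) + (h * h) * partialExp m y
    partialExp-euler zero = ≤-reflexive (begin-equality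
      partialExp 2 z + h * partialExp 1 z ≈⟨ +-cong (partialExp-2 z) (≈-trans (*-congˡ (partialExp-1 z)) (*-identityʳ h)) ⟩
      (1# + z) + h                        ≈⟨ +-assoc 1# z h ⟩
      1# + (z + h)                        ≈⟨ partialExp-2 (z + h) ⟨
      partialExp 2 (z + h)                ≈⟨ ≈-trans (+-congˡ (zeroʳ _)) (+-identityʳ _) ⟨
      partialExp 2 (z + h) + (h * h) * 0# ∎)
      where
      open ≤-Reasoning
      partialExp-2 : ∀ w → partialExp 2 w ≈ 1# + w
      partialExp-2 w = ≈-trans (partialExp-suc 1 w) (+-cong (partialExp-1 w) (term-1 w))
    partialExp-euler (suc m) = begin
      partialExp (3 ℕ.+ m) z + h * partialExp (2 ℕ.+ m) z
        ≈⟨ ≈-trans (+-cong (partialExp-suc (2 ℕ.+ m) z) (*-congˡ (partialExp-suc (1 ℕ.+ m) z)))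
             (solve 5 (λ a b h c d → (a :+ b) :+ h :* (c :+ d) := (a :+ h :* c) :+ (b :+ h :* d)) ≈-refl _ _ h _ _) ⟩
      (partialExp (2 ℕ.+ m) z + h * partialExp (1 ℕ.+ m) z) + (term (2 ℕ.+ m) z + h * term (1 ℕ.+ m) z)
        ≤⟨ +-mono-≤ (partialExp-euler m) (term-euler m) ⟩
      (partialExp (2 ℕ.+ m) (z + h) + (h * h) * partialExp m y) + (term (2 ℕ.+ m) (z + h) + (h * h) * term m y)
        ≈⟨ ≈-trans (solve 5 (λ a b h c d → (a :+ h :* c) :+ (b :+ h :* d) := (a :+ b) :+ h :* (c :+ d)) ≈-refl _ _ (h * h) _ _)
             (+-cong (≈-sym (partialExp-suc (2 ℕ.+ m) (z + h))) (*-congˡ (≈-sym (partialExp-suc m y)))) ⟩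
      partialExp (3 ℕ.+ m) (z + h) + (h * h) * partialExp (1 ℕ.+ m) y ∎
      where open ≤-Reasoning

    -- The slope is at least 1/2 - 1/8 - 1/8 = 1/4: the value of u, less the top term by which u may
    -- exceed its derivative, less the quadratic error divided by h.
    growth : ∀ m {M} → fromℕ 8 * term (suc m) y ≤ 1# → fromℕ 8 * (h * M) ≤ 1# → partialExp m y ≤ M →
      1# ≤ fromℕ 2 * partialExp (2 ℕ.+ m) z → fromℕ 4 * partialExp (2 ℕ.+ m) z + h ≤ fromℕ 4 * partialExp (2 ℕ.+ m) (z + h)
    growth m {M = M} 8τ≤1 8hM≤1 E≤M 1≤2u = *-cancelˡ-≤ (fromℕ-pos 2) (begin
      fromℕ 2 * (fromℕ 4 * u + h)
        ≈⟨ solve 2 (λ u h → con (ℤ.+ 2) :* (con (ℤ.+ 4) :* u :+ h) := con (ℤ.+ 8) :* u :+ h :* (con (ℤ.+ 4) :* con (ℤ.+ 1) :- con (ℤ.+ 1) :- con (ℤ.+ 1))) ≈-refl u h ⟩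
      fromℕ 8 * u + h * (fromℕ 4 * fromℕ 1 - fromℕ 1 - fromℕ 1)
        ≤⟨ +-monoʳ-≤ _ (*-monoˡ-≤ 0≤h (+-mono-≤ (+-mono-≤ (*-monoˡ-≤ (fromℕ-nonneg 4) (≤-trans (≤-reflexive fromℕ-1) 1≤2u))
             (neg-mono-≤ (≤-trans 8τ≤1 (≤-reflexive (≈-sym fromℕ-1))))) (neg-mono-≤ (≤-trans 8hM≤1 (≤-reflexive (≈-sym fromℕ-1)))))) ⟩
      fromℕ 8 * u + h * (fromℕ 4 * (fromℕ 2 * u) - fromℕ 8 * τ - fromℕ 8 * (h * M))
        ≈⟨ solve 4 (λ u h τ M → con (ℤ.+ 8) :* u :+ h :* (con (ℤ.+ 4) :* (con (ℤ.+ 2) :* u) :- con (ℤ.+ 8) :* τ :- con (ℤ.+ 8) :* (h :* M))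
             := con (ℤ.+ 8) :* ((u :+ h :* (u :- τ)) :- (h :* h) :* M)) ≈-refl u h τ M ⟩
      fromℕ 8 * ((u + h * (u - τ)) - (h * h) * M)
        ≤⟨ *-monoˡ-≤ (fromℕ-nonneg 8) (+-mono-≤ (+-monoʳ-≤ u (*-monoˡ-≤ 0≤h u-τ≤)) (neg-mono-≤ (*-monoˡ-≤ (*-nonneg 0≤h 0≤h) E≤M))) ⟩
      fromℕ 8 * ((u + h * partialExp (1 ℕ.+ m) z) - (h * h) * partialExp m y)
        ≤⟨ *-monoˡ-≤ (fromℕ-nonneg 8) (+-monoˡ-≤ _ (partialExp-euler m)) ⟩
      fromℕ 8 * ((partialExp (2 ℕ.+ m) (z + h) + (h * h) * partialExp m y) - (h * h) * partialExp m y)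
        ≈⟨ solve 2 (λ a b → con (ℤ.+ 8) :* ((a :+ b) :- b) := con (ℤ.+ 2) :* (con (ℤ.+ 4) :* a)) ≈-refl _ _ ⟩
      fromℕ 2 * (fromℕ 4 * partialExp (2 ℕ.+ m) (z + h)) ∎)
      where
      open ≤-Reasoning
      u = partialExp (2 ℕ.+ m) z
      τ = term (suc m) y
      term≤τ : term (suc m) z ≤ τ
      term≤τ = *-monoʳ-≤ (inj₁ (⁻¹-pos (0<k! (suc m)))) (proj₁ (∣^∣≤ (suc m) ∣z∣≤y))
      u-τ≤ : u - τ ≤ partialExp (1 ℕ.+ m) z
      u-τ≤ = begin
        u - τ ≈⟨ +-congʳ (partialExp-suc (suc m) z) ⟩
        (partialExp (suc m) z + term (suc m) z) - τ ≤⟨ +-monoʳ-≤ _ (neg-mono-≤ term≤τ) ⟩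
        (partialExp (suc m) z + term (suc m) z) - term (suc m) z ≈⟨ solve 2 (λ a b → (a :+ b) :- b := a) ≈-refl _ _ ⟩
        partialExp (suc m) z ∎

  -- `partialExp-bound` with x = 1/2 and an integer t above 2y bounds all partial sums by 2^t.
  partialExp-bounded : ∀ {y} → 0# ≤ y → ∃[ M ] (∀ m → partialExp m y ≤ M)
  partialExp-bounded {y} 0≤y with archimedean (fromℕ 2 * y)
  ... | t , 2y<t = 1# / c , λ m → y*z≤x⇒z≤x/y 0<c (≤-trans
        (*-monoˡ-≤ (inj₁ 0<c) (partialExp-mono m 0≤y (2*y≤n⇒y≤n*half t (inj₁ 2y<t)))) (partialExp-bound m (inj₁ 0<half) (inj₁ half<1) t))
    where
    open ≤-Reasoning
    c = (1# - half) ^ t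
    0<c : 0# < c
    0<c = ^-pos t (<-respʳ 1-half 0<half)

  ^-neg : ∀ k a → (- a) ^ k ≈ a ^ k ⊎ (- a) ^ k ≈ - (a ^ k)
  ^-neg zero    a = inj₁ ≈-refl
  ^-neg (suc k) a with ^-neg k a
  ... | inj₁ eq = inj₂ (≈-trans (*-congˡ eq) (≈-sym (-‿distribˡ-* a (a ^ k))))
  ... | inj₂ eq = inj₁ (≈-trans (*-congˡ eq) (solve 2 (λ a b → :- a :* :- b := a :* b) ≈-refl a (a ^ k)))

  term-neg : ∀ k {a c} → ∣ term k a ∣≤ c → term k (- a) ≤ c
  term-neg k {a} (t≤c , -t≤c) with ^-neg k a
  ... | inj₁ eq = ≤-trans (≤-reflexive (*-congʳ eq)) t≤c
  ... | inj₂ eq = ≤-trans (≤-reflexive (≈-trans (*-congʳ eq) (≈-sym (-‿distribˡ-* _ _)))) -t≤c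

  -- The witness is min(y, 1)/16. In the climb 16 δ ≤ 1 keeps the errors small, and 16 δ ≤ y gives
  -- the final contradiction.
  small-positive : ∀ {y} → 0# < y → ∃[ δ ] 0# < δ × fromℕ 16 * δ ≤ 1# × fromℕ 16 * δ ≤ y
  small-positive {y} 0<y with ≤-or-< y 1#
  ... | inj₁ y≤1 = y / fromℕ 16 , *-pos 0<y (⁻¹-pos (fromℕ-pos 16)) ,
        ≤-trans (≤-reflexive (y*[x/y]≈x (fromℕ-pos 16))) y≤1 , ≤-reflexive (y*[x/y]≈x (fromℕ-pos 16))
  ... | inj₂ 1<y = 1# / fromℕ 16 , *-pos 0<1 (⁻¹-pos (fromℕ-pos 16)) ,
        ≤-reflexive (y*[x/y]≈x (fromℕ-pos 16)) , ≤-trans (≤-reflexive (y*[x/y]≈x (fromℕ-pos 16))) (inj₁ 1<y)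

  -- Along an Euler scheme for u′ = u with step h, the partial sums grow by at least (- ℓ) / 4 between
  -- ℓ and 0, where their value is 1; so exp ℓ is less than 1.
  module Climb {ℓ e : Carrier} (ℓ<0 : ℓ < 0#) (exp : IsExp ℓ e) (1≤e : 1# ≤ e) where
    open ≤-Reasoning

    y : Carrier
    y = - ℓ

    0<y : 0# < y
    0<y = <-respʳ (+-identityˡ y) (x<y⇒0<y-x ℓ<0)

    δ : Carrier
    δ = proj₁ (small-positive 0<y)

    0<δ : 0# < δ
    0<δ = proj₁ (proj₂ (small-positive 0<y))

    16δ≤1 : fromℕ 16 * δ ≤ 1#
    16δ≤1 = proj₁ (proj₂ (proj₂ (small-positive 0<y)))

    16δ≤y : fromℕ 16 * δ ≤ y
    16δ≤y = proj₂ (proj₂ (proj₂ (small-positive 0<y)))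

    m : ℕ
    m = proj₁ (exp δ 0<δ)

    close : ∀ k → ∣ partialExp (k ℕ.+ m) ℓ - e ∣≤ δ
    close k = ≤-trans (x≤abs _) (inj₁ near) , ≤-trans (-x≤abs _) (inj₁ near)
      where near = proj₂ (exp δ 0<δ) (k ℕ.+ m) (ℕ.m≤n+m m k)

    -- Convergence controls the term: at ℓ it is the difference of two consecutive partial sums,
    -- both within δ of e, and passing from ℓ to y changes at most its sign.
    8τ≤1 : fromℕ 8 * term (suc m) y ≤ 1#
    8τ≤1 = ≤-trans (*-monoˡ-≤ (fromℕ-nonneg 8) (term-neg (suc m) small)) (≤-trans
      (≤-reflexive (solve 1 (λ d → con (ℤ.+ 8) :* (d :+ d) := con (ℤ.+ 16) :* d) ≈-refl δ)) 16δ≤1)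
      where
      small : ∣ term (suc m) ℓ ∣≤ δ + δ
      small = ∣∣≤-cong (≈-trans (+-congʳ (+-congʳ (partialExp-suc (suc m) ℓ)))
        (solve 3 (λ a b e → (a :+ b :- e) :+ :- (a :- e) := b) ≈-refl (partialExp (suc m) ℓ) (term (suc m) ℓ) e)) ≈-refl
        (∣+∣≤ (close 2) (∣-∣≤ (close 1)))

    M : Carrier
    M = proj₁ (partialExp-bounded (inj₁ 0<y))

    E≤M : partialExp m y ≤ M
    E≤M = proj₂ (partialExp-bounded (inj₁ 0<y)) m

    -- The number of Euler steps, taken so large that the step h = y/N satisfies 8 h M ≤ 1.
    N : ℕ
    N = proj₁ (archimedean (fromℕ 8 * (y * M)))

    8yM<N : fromℕ 8 * (y * M) < fromℕ N
    8yM<N = proj₂ (archimedean (fromℕ 8 * (y * M)))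

    0<N : 0# < fromℕ N
    0<N = ≤-<-trans (*-nonneg (fromℕ-nonneg 8) (*-nonneg (inj₁ 0<y)
      (≤-trans (Σ-nonneg (upTo m) (λ k → term-nonneg k (inj₁ 0<y))) E≤M))) 8yM<N

    h : Carrier
    h = y / fromℕ N

    0≤h : 0# ≤ h
    0≤h = /-nonneg (inj₁ 0<y) 0<N

    Nh : fromℕ N * h ≈ y
    Nh = y*[x/y]≈x 0<N

    8hM≤1 : fromℕ 8 * (h * M) ≤ 1#
    8hM≤1 = *-cancelˡ-≤ 0<N (begin
      fromℕ N * (fromℕ 8 * (h * M))   ≈⟨ solve 4 (λ n c h M → n :* (c :* (h :* M)) := c :* ((n :* h) :* M)) ≈-refl (fromℕ N) (fromℕ 8) h M ⟩
      fromℕ 8 * ((fromℕ N * h) * M)   ≈⟨ *-congˡ (*-congʳ Nh) ⟩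
      fromℕ 8 * (y * M)               ≤⟨ inj₁ 8yM<N ⟩
      fromℕ N                         ≈⟨ *-identityʳ _ ⟨
      fromℕ N * 1#                    ∎)

    u : Carrier → Carrier
    u = partialExp (2 ℕ.+ m)

    e-δ≤u : e - δ ≤ u ℓ
    e-δ≤u = begin
      e - δ                 ≤⟨ +-monoʳ-≤ e (neg-mono-≤ (proj₂ (close 2))) ⟩
      e - - (u ℓ - e)       ≈⟨ solve 2 (λ e u → e :- :- (u :- e) := u) ≈-refl e (u ℓ) ⟩
      u ℓ                   ∎

    4≤4uℓ+4δ : fromℕ 4 ≤ fromℕ 4 * u ℓ + fromℕ 4 * δ
    4≤4uℓ+4δ = begin
      fromℕ 4                        ≈⟨ *-identityʳ _ ⟨
      fromℕ 4 * 1#                   ≤⟨ *-monoˡ-≤ (fromℕ-nonneg 4) 1≤e ⟩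
      fromℕ 4 * e                    ≈⟨ solve 2 (λ e d → con (ℤ.+ 4) :* e := con (ℤ.+ 4) :* (e :- d) :+ con (ℤ.+ 4) :* d) ≈-refl e δ ⟩
      fromℕ 4 * (e - δ) + fromℕ 4 * δ ≤⟨ +-monoˡ-≤ _ (*-monoˡ-≤ (fromℕ-nonneg 4) e-δ≤u) ⟩
      fromℕ 4 * u ℓ + fromℕ 4 * δ    ∎

    2≤4uℓ : fromℕ 2 ≤ fromℕ 4 * u ℓ
    2≤4uℓ = begin
      fromℕ 2                                     ≤⟨ gap-≤ (fromℕ-nonneg 1) (≈-sym (fromℕ-+ 2 1)) ⟩
      fromℕ 3                                     ≈⟨ solve 0 (con (ℤ.+ 3) := con (ℤ.+ 4) :- con (ℤ.+ 1)) ≈-refl ⟩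
      fromℕ 4 - fromℕ 1                           ≤⟨ +-mono-≤ 4≤4uℓ+4δ (neg-mono-≤ 4δ≤1) ⟩
      (fromℕ 4 * u ℓ + fromℕ 4 * δ) - fromℕ 4 * δ ≈⟨ solve 2 (λ a b → (a :+ b) :- b := a) ≈-refl _ _ ⟩
      fromℕ 4 * u ℓ ∎
      where
      4δ≤1 : fromℕ 4 * δ ≤ fromℕ 1
      4δ≤1 = ≤-trans (*-monoʳ-≤ (inj₁ 0<δ) (fromℕ-mono-≤ (ℕ.m≤m+n 4 12))) (≤-trans 16δ≤1 (≤-reflexive (≈-sym fromℕ-1)))

    -- The induction supports itself: the growth so far keeps u at least 1/2, which is what the next
    -- step requires.
    climb : ∀ i → i ℕ.≤ N → fromℕ 4 * u ℓ + fromℕ i * h ≤ fromℕ 4 * u (ℓ + fromℕ i * h)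
    climb zero _ = ≤-reflexive (≈-trans (≈-trans (+-congˡ (zeroˡ h)) (+-identityʳ _))
      (*-congˡ (partialExp-cong (2 ℕ.+ m) (≈-sym (≈-trans (+-congˡ (zeroˡ h)) (+-identityʳ ℓ))))))
    climb (suc i) i<N = begin
      fromℕ 4 * u ℓ + fromℕ (suc i) * h ≈⟨ next _ ⟩
      (fromℕ 4 * u ℓ + fromℕ i * h) + h ≤⟨ +-monoˡ-≤ h (climb i (ℕ.<⇒≤ i<N)) ⟩
      fromℕ 4 * u z + h                 ≤⟨ EulerStep.growth {y} {z} {h} 0≤h -y≤z z+h≤0 m 8τ≤1 8hM≤1 E≤M 1≤2u ⟩
      fromℕ 4 * u (z + h)               ≈⟨ *-congˡ (partialExp-cong (2 ℕ.+ m) (next ℓ)) ⟨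
      fromℕ 4 * u (ℓ + fromℕ (suc i) * h) ∎
      where
      z = ℓ + fromℕ i * h
      next : ∀ a → a + fromℕ (suc i) * h ≈ (a + fromℕ i * h) + h
      next a = ≈-trans (+-congˡ (≈-trans (distribʳ h 1# (fromℕ i)) (≈-trans (+-congʳ (*-identityˡ h)) (+-comm h _)))) (≈-sym (+-assoc a _ h))
      -y≤z : - y ≤ z
      -y≤z = ≤-trans (≤-reflexive (-‿involutive ℓ)) (gap-≤ (*-nonneg (fromℕ-nonneg i) 0≤h) ≈-refl)
      z+h≤0 : z + h ≤ 0#
      z+h≤0 = begin
        z + h                   ≈⟨ next ℓ ⟨
        ℓ + fromℕ (suc i) * h   ≤⟨ +-monoʳ-≤ ℓ (*-monoʳ-≤ 0≤h (fromℕ-mono-≤ i<N)) ⟩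
        ℓ + fromℕ N * h         ≈⟨ +-congˡ Nh ⟩
        ℓ + y                   ≈⟨ -‿inverseʳ ℓ ⟩
        0#                      ∎
      1≤2u : 1# ≤ fromℕ 2 * u z
      1≤2u = *-cancelˡ-≤ (fromℕ-pos 2) (begin
        fromℕ 2 * 1#                  ≈⟨ *-identityʳ _ ⟩
        fromℕ 2                       ≤⟨ 2≤4uℓ ⟩
        fromℕ 4 * u ℓ                 ≤⟨ gap-≤ (*-nonneg (fromℕ-nonneg i) 0≤h) ≈-refl ⟩
        fromℕ 4 * u ℓ + fromℕ i * h   ≤⟨ climb i (ℕ.<⇒≤ i<N) ⟩
        fromℕ 4 * u z                 ≈⟨ solve 1 (λ u → con (ℤ.+ 4) :* u := con (ℤ.+ 2) :* (con (ℤ.+ 2) :* u)) ≈-refl (u z) ⟩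
        fromℕ 2 * (fromℕ 2 * u z)     ∎)

    -- The climb starts at 4u ≥ 4 - 4δ, gains y and ends at 4u = 4. So y ≤ 4δ, while 16δ ≤ y.
    contradictory : ⊥
    contradictory = <⇒≱ 4δ<y (+-cancel (begin
      fromℕ 4 * u ℓ + y               ≈⟨ +-congˡ Nh ⟨
      fromℕ 4 * u ℓ + fromℕ N * h     ≤⟨ climb N ℕ.≤-refl ⟩
      fromℕ 4 * u (ℓ + fromℕ N * h)   ≈⟨ *-congˡ (≈-trans (partialExp-cong (2 ℕ.+ m) (≈-trans (+-congˡ Nh) (-‿inverseʳ ℓ))) (partialExp-at-0 (suc m))) ⟩
      fromℕ 4 * 1#                    ≈⟨ *-identityʳ _ ⟩
      fromℕ 4                         ≤⟨ 4≤4uℓ+4δ ⟩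
      fromℕ 4 * u ℓ + fromℕ 4 * δ     ∎))
      where
      4δ<y : fromℕ 4 * δ < y
      4δ<y = <-≤-trans (<-respˡ (*-comm δ _) (<-respʳ (*-comm δ _) (*-monoˡ-< 0<δ (fromℕ-mono-< (ℕ.m≤m+n 5 11))))) 16δ≤y
      +-cancel : ∀ {a b c} → a + b ≤ a + c → b ≤ c
      +-cancel {a} {b} {c} a+b≤a+c = begin
        b             ≈⟨ solve 2 (λ a b → b := :- a :+ (a :+ b)) ≈-refl a b ⟩
        - a + (a + b) ≤⟨ +-monoʳ-≤ (- a) a+b≤a+c ⟩
        - a + (a + c) ≈⟨ solve 2 (λ a b → :- a :+ (a :+ b) := b) ≈-refl a c ⟩
        c             ∎

  log-nonneg : ∀ {e ℓ} → IsLog e ℓ → 1# ≤ e → 0# ≤ ℓ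
  log-nonneg log 1≤e = ≮⇒≥ (λ ℓ<0 → Climb.contradictory ℓ<0 log 1≤e)

  -- Otherwise ℓ is less than 3/2, and `exp-upper` with three factors at x = 1/2 gives e ≤ 8.
  log-9 : ∀ {e ℓ} → IsLog e ℓ → fromℕ 9 ≤ e → fromℕ 3 ≤ fromℕ 2 * ℓ
  log-9 {e} {ℓ} log 9≤e = ≮⇒≥ (λ 2ℓ<3 → <⇒≱ (fromℕ-mono-< {8} {9} ℕ.≤-refl) (≤-trans 9≤e (begin
    e                             ≈⟨ ≈-trans (*-congʳ 8*half³) (*-identityˡ e) ⟨
    (fromℕ 8 * (half * half * half)) * e ≈⟨ *-assoc _ _ _ ⟩
    fromℕ 8 * ((half * half * half) * e)
      ≈⟨ *-congˡ (*-congʳ (≈-trans (solve 1 (λ h → h :* h :* h := h :* (h :* (h :* con (ℤ.+ 1)))) ≈-refl half)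
           (≈-trans (*-congˡ (*-congˡ (*-congˡ fromℕ-1))) (^-congˡ 3 1-half)))) ⟩
    fromℕ 8 * ((1# - half) ^ 3 * e) ≤⟨ *-monoˡ-≤ (fromℕ-nonneg 8) (exp-upper 3 log
        (log-nonneg log (≤-trans (≤-trans (≤-reflexive (≈-sym fromℕ-1)) (fromℕ-mono-≤ {1} {9} (ℕ.m≤m+n 1 8))) 9≤e))
        (inj₁ 0<half) half<1 (2*y≤n⇒y≤n*half 3 (inj₁ 2ℓ<3))) ⟩
    fromℕ 8 * 1#                  ≈⟨ *-identityʳ _ ⟩
    fromℕ 8                       ∎)))
    where
    open ≤-Reasoning
    8*half³ : fromℕ 8 * (half * half * half) ≈ 1#
    8*half³ = ≈-trans (solve 1 (λ h → con (ℤ.+ 8) :* (h :* h :* h) :=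
      (con (ℤ.+ 2) :* h) :* ((con (ℤ.+ 2) :* h) :* (con (ℤ.+ 2) :* h))) ≈-refl half)
      (≈-trans (*-cong 2*half (≈-trans (*-cong 2*half 2*half) (*-identityˡ 1#))) (*-identityˡ 1#))

-- First times and rounding

least : ∀ {P : ℕ → Set} → (∀ t → Dec (P t)) → ∀ t → P t → ∃[ s ] P s × s ℕ.≤ t × (∀ u → P u → s ℕ.≤ u)
least P? zero    p = 0 , p , z≤n , λ _ _ → z≤n
least P? (suc t) p with P? 0
... | yes p₀ = 0 , p₀ , z≤n , λ _ _ → z≤n
... | no ¬p₀ with least (P? ∘ suc) t p
...   | s , pₛ , s≤t , minimal = suc s , pₛ , s≤s s≤t ,
        λ { zero p₀ → ⊥-elim (¬p₀ p₀) ; (suc u) pᵤ → s≤s (minimal u pᵤ) }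

module MixingTimes (ℝ : RealNumbers) where
  open OrderedField ℝ
  open Sums ℝ
  open Chains ℝ

  -- The order on the reals is decidable, so a first time can be searched for below `T`. The maximum
  -- is attained because there are finitely many starts; `x₀` shows that there is one.
  mixingTime-≤ : ∀ {n q} (P : TransitionMatrix {n} {q}) π ε T → Config n q →
    (∀ x → totalVariation ((P ^ᴹ T) x) π ≤ ε) → ∃[ τ ] IsMixingTime P π ε τ × τ ℕ.≤ T
  mixingTime-≤ {n} {q} P π ε T x₀ mixed = hit slowest ,
    ((λ x → hit x , isHit x , All.lookup (f[xs]≤f[argmax] {f = hit} x₀ (configs n q)) (∈-configs x)) , slowest , isHit slowest) ,
    proj₁ (proj₂ (proj₂ (first slowest)))
    where
    first : ∀ x → ∃[ s ] totalVariation ((P ^ᴹ s) x) π ≤ ε × s ℕ.≤ T × (∀ u → totalVariation ((P ^ᴹ u) x) π ≤ ε → s ℕ.≤ u)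
    first x = least (λ t → totalVariation ((P ^ᴹ t) x) π ≤? ε) T (mixed x)
    hit : Config n q → ℕ
    hit x = proj₁ (first x)
    isHit : ∀ x → IsMixingTimeFrom P π ε x (hit x)
    isHit x = proj₁ (proj₂ (first x)) , proj₂ (proj₂ (proj₂ (first x)))
    slowest : Config n q
    slowest = argmax hit x₀ (configs n q)

  floor : ∀ x → 0# ≤ x → ∃[ t ] fromℕ t ≤ x × x < fromℕ (suc t)
  floor x 0≤x with archimedean x
  ... | N , x<N = search N x<N
    where
    search : ∀ N → x < fromℕ N → ∃[ t ] fromℕ t ≤ x × x < fromℕ (suc t)
    search zero    x<0 = ⊥-elim (<⇒≱ x<0 0≤x)
    search (suc N) x<1+N with ≤-or-< (fromℕ N) x
    ... | inj₁ N≤x = N , N≤x , x<1+N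
    ... | inj₂ x<N = search N x<N


-- Weights of block colourings in the Potts model

module PottsDynamics (ℝ : RealNumbers) where
  open OrderedField ℝ
  open Sums ℝ
  open OldVertices ℝ
  open Chains ℝ
  open Exponential ℝ
  open MixingTimes ℝ

  module Blocks (L r q : ℕ) .{{L>1 : NonTrivial L}} .{{r≢0 : NonZero r}} (r≤L-2 : r ℕ.≤ L ℕ.∸ 2)
    (λ′ : Carrier) (1<λ′ : 1# < λ′) (p : Carrier) (power : IsRationalPower λ′ (2 ℕ.* r ℕ.+ 2) r p)
    (q-large : fromℕ (2 ℕ.^ (r ℕ.^ 2 ℕ.+ 8 ℕ.* r ℕ.+ 3)) * fromℕ (r ℕ.^ (2 ℕ.* r ℕ.^ 2 ℕ.+ 4 ℕ.* r ℕ.+ 1)) * p ≤ fromℕ q) where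

    open Grid L r r≤L-2
    open Subgrids L r r≤L-2

    V : ℕ
    V = L ℕ.* L

    area : ℕ
    area = r ℕ.* r

    Observable : Set
    Observable = Config V q → Carrier

    0<p : 0# < p
    0<p = proj₁ power

    1≤λ′ : 1# ≤ λ′
    1≤λ′ = inj₁ 1<λ′

    weight : Position → Observable
    weight s Z = λ′ ^ incidentMono (subgrid r s) Z

    1≤weight : ∀ s Z → 1# ≤ weight s Z
    1≤weight s Z = 1≤^ (incidentMono (subgrid r s) Z) 1≤λ′

    colourings : Carrier
    colourings = fromℕ q ^ area

    totalWeight : Position → Observable
    totalWeight s = recolour (cells s) (weight s)

    recolour-cells-const : ∀ s c {X : Config V q} → recolour (cells s) (λ _ → c) X ≈ colourings * c
    recolour-cells-const s c = ≈-trans (recolour-const (cells s) c)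
      (*-congʳ (≈-reflexive (cong (fromℕ q ^_) (length-cells s))))

    colourings≤totalWeight : ∀ s X → colourings ≤ totalWeight s X
    colourings≤totalWeight s X = begin
      colourings                          ≈⟨ *-identityʳ _ ⟨
      colourings * 1#                     ≈⟨ recolour-cells-const s 1# ⟨
      recolour (cells s) (λ _ → 1#) X     ≤⟨ recolour-mono (cells s) (λ Z _ → 1≤weight s Z) ⟩
      totalWeight s X                     ∎
      where open ≤-Reasoning

    -- Compared after raising to the r-th power, because `p` is given only by p^r = λ^(2r + 2).
    weight≤p^oldCount : ∀ s Z → weight s Z ≤ p ^ oldCount (boundaryColours s Z) (cells s) Z
    weight≤p^oldCount s Z = ^-cancel-≤ r (^-nonneg O (inj₁ 0<p)) (begin
      (λ′ ^ M) ^ r                  ≈⟨ ^-assocʳ λ′ M r ⟩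
      λ′ ^ (M ℕ.* r)                ≈⟨ ≈-reflexive (cong (λ′ ^_) (ℕ.*-comm M r)) ⟩
      λ′ ^ (r ℕ.* M)                ≤⟨ ^-monoʳ-≤ 1≤λ′ (incidentMono-bound s Z) ⟩
      λ′ ^ ((2 ℕ.* r ℕ.+ 2) ℕ.* O)  ≈⟨ ^-assocʳ λ′ (2 ℕ.* r ℕ.+ 2) O ⟨
      (λ′ ^ (2 ℕ.* r ℕ.+ 2)) ^ O    ≈⟨ ^-congˡ O (proj₂ power) ⟨
      (p ^ r) ^ O                   ≈⟨ ^-assocʳ p r O ⟩
      p ^ (r ℕ.* O)                 ≈⟨ ≈-reflexive (cong (p ^_) (ℕ.*-comm r O)) ⟩
      p ^ (O ℕ.* r)                 ≈⟨ ^-assocʳ p O r ⟨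
      (p ^ O) ^ r                   ∎)
      where
      open ≤-Reasoning
      M = incidentMono (subgrid r s) Z
      O = oldCount (boundaryColours s Z) (cells s) Z

    -- The boundary is disjoint from the cells, so the colours that count as old from the start are
    -- the same for every recolouring.
    boundaryColours-agree : ∀ s {X Z : Config V q} → Agree (cells s) X Z → boundaryColours s Z ≡ boundaryColours s X
    boundaryColours-agree s {X} {Z} agree = map-cong-∈ (boundary s) (λ v v∈ → agree v (boundary-disjoint s v∈))
      where
      map-cong-∈ : ∀ vs → (∀ v → v ∈ vs → lookup Z v ≡ lookup X v) → map (lookup Z) vs ≡ map (lookup X) vs
      map-cong-∈ []       eq = ≡.refl
      map-cong-∈ (v ∷ vs) eq = cong₂ _∷_ (eq v (here ≡.refl)) (map-cong-∈ vs (λ u u∈ → eq u (there u∈)))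

    private
      reach : Carrier
      reach = fromℕ (r ℕ.* 4 ℕ.+ area) * p

      reach-nonneg : 0# ≤ reach
      reach-nonneg = *-nonneg (fromℕ-nonneg (r ℕ.* 4 ℕ.+ area)) (inj₁ 0<p)

      totalWeight≤ : ∀ s X → totalWeight s X ≤ (fromℕ q + reach) ^ area
      totalWeight≤ s X = begin
        totalWeight s X ≤⟨ recolour-mono (cells s) (λ Z agree → ≤-trans (weight≤p^oldCount s Z)
          (≤-reflexive (≈-reflexive (cong (λ B → p ^ oldCount B (cells s) Z) (boundaryColours-agree s {X} {Z} agree))))) ⟩
        recolour (cells s) (λ Z → p ^ oldCount (boundaryColours s X) (cells s) Z) X
          ≤⟨ recolour-p^oldCount p 0<p (cells s) (boundaryColours s X) (cells! s) ⟩
        (fromℕ q + fromℕ (length (boundaryColours s X) ℕ.+ length (cells s)) * p) ^ length (cells s)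
          ≈⟨ ≈-reflexive (cong₂ (λ k l → (fromℕ q + fromℕ (k ℕ.+ l) * p) ^ l)
               (≡.trans (List.length-map (lookup X) (boundary s)) (length-boundary s)) (length-cells s)) ⟩
        (fromℕ q + reach) ^ area ∎
        where open ≤-Reasoning

      -- The lower bound on q enters here. `reach` bounds what old colours add to one factor q, and
      -- 2 r² comes from linearising the power with exponent r².
      q-dominates : fromℕ (64 ℕ.* area) * (fromℕ (2 ℕ.* area) * reach) ≤ fromℕ q
      q-dominates = begin
        fromℕ (64 ℕ.* area) * (fromℕ (2 ℕ.* area) * (fromℕ (r ℕ.* 4 ℕ.+ area) * p))
          ≈⟨ solve 4 (λ a b c d → a :* (b :* (c :* d)) := ((a :* b) :* c) :* d) ≈-refl _ _ _ p ⟩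
        fromℕ (64 ℕ.* area) * fromℕ (2 ℕ.* area) * fromℕ (r ℕ.* 4 ℕ.+ area) * p
          ≈⟨ *-congʳ (≈-trans (fromℕ-* (64 ℕ.* area ℕ.* (2 ℕ.* area)) _) (*-congʳ (fromℕ-* (64 ℕ.* area) _))) ⟨
        fromℕ (64 ℕ.* area ℕ.* (2 ℕ.* area) ℕ.* (r ℕ.* 4 ℕ.+ area)) * p
          ≈⟨ ≈-reflexive (cong (λ k → fromℕ (k ℕ.* (r ℕ.* 4 ℕ.+ area)) * p) (arrange area)) ⟩
        fromℕ (128 ℕ.* area ℕ.* area ℕ.* (r ℕ.* 4 ℕ.+ area)) * p
          ≤⟨ *-monoʳ-≤ (inj₁ 0<p) (fromℕ-mono-≤ (constant-bound r)) ⟩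
        fromℕ (2 ℕ.^ (r ℕ.^ 2 ℕ.+ 8 ℕ.* r ℕ.+ 3) ℕ.* r ℕ.^ (2 ℕ.* r ℕ.^ 2 ℕ.+ 4 ℕ.* r ℕ.+ 1)) * p
          ≈⟨ *-congʳ (fromℕ-* (2 ℕ.^ (r ℕ.^ 2 ℕ.+ 8 ℕ.* r ℕ.+ 3)) _) ⟩
        fromℕ (2 ℕ.^ (r ℕ.^ 2 ℕ.+ 8 ℕ.* r ℕ.+ 3)) * fromℕ (r ℕ.^ (2 ℕ.* r ℕ.^ 2 ℕ.+ 4 ℕ.* r ℕ.+ 1)) * p
          ≤⟨ q-large ⟩
        fromℕ q ∎
        where
        open ≤-Reasoning
        arrange : ∀ m → 64 ℕ.* m ℕ.* (2 ℕ.* m) ≡ 128 ℕ.* m ℕ.* m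
        arrange = +-*-Solver.solve 1 (λ m → con′ 64 :*′ m :*′ (con′ 2 :*′ m) :=′ con′ 128 :*′ m :*′ m) ≡.refl
          where open +-*-Solver using () renaming (con to con′; _:*_ to _:*′_; _:=_ to _:=′_)

    instance
      area≢0 : NonZero area
      area≢0 = ℕ.m*n≢0 r r

    0<q : 0# < fromℕ q
    0<q = <-≤-trans (*-pos (fromℕ-pos (64 ℕ.* area) {{ℕ.m*n≢0 64 area}})
      (*-pos (fromℕ-pos (2 ℕ.* area) {{ℕ.m*n≢0 2 area}})
        (*-pos (fromℕ-pos (r ℕ.* 4 ℕ.+ area) {{ℕ.>-nonZero (ℕ.<-≤-trans (ℕ.>-nonZero⁻¹ area) (ℕ.m≤n+m area (r ℕ.* 4)))}}) 0<p)))
      q-dominates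

    0<colourings : 0# < colourings
    0<colourings = ^-pos area 0<q

    0<totalWeight : ∀ s X → 0# < totalWeight s X
    0<totalWeight s X = <-≤-trans 0<colourings (colourings≤totalWeight s X)

    -- Multiplied by q, the claim follows from `perturbed-power` without division; `q-dominates`
    -- then absorbs the linear term.
    excessWeight : ∀ s X → fromℕ (64 ℕ.* area) * (totalWeight s X - colourings) ≤ colourings
    excessWeight s X = *-cancelˡ-≤ 0<q (begin
      Q * (k * (a - u))              ≈⟨ solve 4 (λ Q k a u → Q :* (k :* (a :- u)) := k :* (a :* Q) :+ :- (k :* (u :* Q))) ≈-refl Q k a u ⟩
      k * (a * Q) - k * (u * Q)      ≤⟨ +-monoˡ-≤ _ (*-monoˡ-≤ 0≤k (≤-trans (*-monoʳ-≤ (inj₁ 0<q) (totalWeight≤ s X))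
                                          (perturbed-power 0<q reach-nonneg area small))) ⟩
      k * (u * (Q + c * reach)) - k * (u * Q)
        ≈⟨ solve 4 (λ k u Q y → k :* (u :* (Q :+ y)) :- k :* (u :* Q) := u :* (k :* y)) ≈-refl k u Q (c * reach) ⟩
      u * (k * (c * reach))          ≤⟨ *-monoˡ-≤ (inj₁ 0<colourings) q-dominates ⟩
      u * Q                          ≈⟨ *-comm u Q ⟩
      Q * u                          ∎)
      where
      open ≤-Reasoning
      Q = fromℕ q
      k = fromℕ (64 ℕ.* area)
      c = fromℕ (2 ℕ.* area)
      a = totalWeight s X
      u = colourings
      0≤k = fromℕ-nonneg (64 ℕ.* area)
      small : c * reach ≤ Q
      small = ≤-trans (≤-trans (≤-reflexive (≈-sym (*-identityˡ _)))
        (*-monoʳ-≤ (*-nonneg (fromℕ-nonneg (2 ℕ.* area)) reach-nonneg)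
          (≤-trans (≤-reflexive (≈-sym fromℕ-1)) (fromℕ-mono-≤ {1} (ℕ.>-nonZero⁻¹ (64 ℕ.* area) {{ℕ.m*n≢0 64 area}}))))) q-dominates

    -- Block updates compared with uniform resampling

    heatBath : Position → Observable → Observable
    heatBath s F X = recolour (cells s) (λ Z → weight s Z * F Z) X / totalWeight s X

    uniformResample : Position → Observable → Observable
    uniformResample s F X = recolour (cells s) F X / colourings

    heatBath-* : ∀ s F X → totalWeight s X * heatBath s F X ≈ recolour (cells s) (λ Z → weight s Z * F Z) X
    heatBath-* s F X = y*[x/y]≈x (0<totalWeight s X)

    uniformResample-* : ∀ s F X → colourings * uniformResample s F X ≈ recolour (cells s) F X
    uniformResample-* s F X = y*[x/y]≈x 0<colourings

    heatBath-agree : ∀ s {F X Y} → Agree (cells s) X Y → heatBath s F X ≈ heatBath s F Y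
    heatBath-agree s agree = *-cong (recolour-base (cells s) agree) (⁻¹-cong (recolour-base (cells s) agree))

    -- K-Lipschitz for the Hamming distance. One inequality suffices, since every update can be
    -- undone by another one.
    Lipschitz : Carrier → Observable → Set
    Lipschitz K F = ∀ X v b → F (X [ v ]≔ b) ≤ F X + K

    Lipschitz-agree : ∀ {K F} → Lipschitz K F → ∀ ws {X Z} → Agree ws X Z → F Z ≤ F X + fromℕ (length ws) * K
    Lipschitz-agree {K} {F} lip [] {X} agree = ≤-reflexive (≈-trans (≈-reflexive (cong F (Agree-[] agree)))
      (≈-sym (≈-trans (+-congˡ (zeroˡ K)) (+-identityʳ (F X)))))
    Lipschitz-agree {K} {F} lip (w ∷ ws) {X} {Z} agree = begin
      F Z                                     ≤⟨ Lipschitz-agree lip ws agree′ ⟩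
      F X′ + fromℕ (length ws) * K            ≤⟨ +-monoˡ-≤ _ (lip X w (lookup Z w)) ⟩
      (F X + K) + fromℕ (length ws) * K       ≈⟨ solve 3 (λ f k l → (f :+ k) :+ l :* k := f :+ (con (ℤ.+ 1) :+ l) :* k) ≈-refl (F X) K _ ⟩
      F X + (fromℕ 1 + fromℕ (length ws)) * K ≈⟨ +-congˡ (*-congʳ (+-congʳ fromℕ-1)) ⟩
      F X + fromℕ (length (w ∷ ws)) * K       ∎
      where
      open ≤-Reasoning
      X′ = X [ w ]≔ lookup Z w
      agree′ : Agree ws X′ Z
      agree′ v v∉ws with v Fin.≟ w
      ... | yes ≡.refl = ≡.sym (Vec.lookup∘update v X (lookup Z v))
      ... | no v≢w = ≡.trans (agree v (λ { (here v≡w) → v≢w v≡w ; (there v∈ws) → v∉ws v∈ws }))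
        (≡.sym (Vec.lookup∘update′ v≢w X (lookup Z w)))

    Agree-sym : ∀ {ws} {X Z : Config V q} → Agree ws X Z → Agree ws Z X
    Agree-sym agree v v∉ws = ≡.sym (agree v v∉ws)

    Lipschitz-neg : ∀ {K F} → Lipschitz K F → Lipschitz K (λ Z → - 1# * F Z)
    Lipschitz-neg {K} {F} lip X v b = begin
      - 1# * F Y                   ≈⟨ RingProperties.-1*x≈-x ring (F Y) ⟩
      - F Y                        ≈⟨ solve 2 (λ f k → :- f := k :- (f :+ k)) ≈-refl (F Y) K ⟩
      K - (F Y + K)                ≤⟨ +-monoʳ-≤ K (neg-mono-≤ back) ⟩
      K - F X                      ≈⟨ +-comm K _ ⟩
      - F X + K                    ≈⟨ +-congʳ (≈-sym (RingProperties.-1*x≈-x ring (F X))) ⟩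
      - 1# * F X + K               ∎
      where
      open ≤-Reasoning
      Y = X [ v ]≔ b
      back : F X ≤ F Y + K
      back = ≤-trans (≤-reflexive (≈-reflexive (cong F (≡.sym (≡.trans (Vec.[]≔-idempotent X v) (Vec.[]≔-lookup X v))))))
        (lip Y v (lookup X v))

    module _ (s : Position) {K : Carrier} (0≤K : 0# ≤ K) where

      private
        D : Carrier
        D = fromℕ area * K

      -- Write each weight as 1 plus a nonnegative excess. On the excess F is at most F X + D, hence
      -- at most 2 D above the uniform mean, and the excess is at most 1/(64 r²) of the total
      -- weight. As D = r² K, this costs K/32.
      heatBath≤uniformResample : ∀ F X → (∀ Z → Agree (cells s) X Z → F Z ≤ F X + D × F X ≤ F Z + D) →
        fromℕ 32 * heatBath s F X ≤ fromℕ 32 * uniformResample s F X + K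
      heatBath≤uniformResample F X osc = *-cancelˡ-≤ (0<totalWeight s X) (begin
        a * (fromℕ 32 * κ)    ≈⟨ solve 3 (λ a c κ → a :* (c :* κ) := c :* (a :* κ)) ≈-refl a (fromℕ 32) κ ⟩
        fromℕ 32 * (a * κ)    ≤⟨ *-monoˡ-≤ (fromℕ-nonneg 32) aκ≤ ⟩
        fromℕ 32 * (a * ν + fromℕ 2 * ((a - u) * D))
          ≈⟨ solve 5 (λ a ν u m K → con (ℤ.+ 32) :* (a :* ν :+ con (ℤ.+ 2) :* ((a :- u) :* (m :* K)))
               := a :* (con (ℤ.+ 32) :* ν) :+ ((con (ℤ.+ 64) :* m) :* (a :- u)) :* K) ≈-refl a ν u (fromℕ area) K ⟩
        a * (fromℕ 32 * ν) + ((fromℕ 64 * fromℕ area) * (a - u)) * K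
          ≤⟨ +-monoʳ-≤ _ (*-monoʳ-≤ 0≤K (≤-trans (≤-trans (≤-reflexive (*-congʳ (≈-sym (fromℕ-* 64 area))))
               (excessWeight s X)) (colourings≤totalWeight s X))) ⟩
        a * (fromℕ 32 * ν) + a * K ≈⟨ distribˡ a _ _ ⟨
        a * (fromℕ 32 * ν + K) ∎)
        where
        open ≤-Reasoning
        a = totalWeight s X
        u = colourings
        κ = heatBath s F X
        ν = uniformResample s F X
        e = F X + D

        ν≥ : F X ≤ ν + D
        ν≥ = *-cancelˡ-≤ 0<colourings (begin
          u * F X                                ≈⟨ recolour-cells-const s (F X) ⟨
          recolour (cells s) (λ _ → F X) X       ≤⟨ recolour-mono (cells s) (λ Z agree → proj₂ (osc Z agree)) ⟩
          recolour (cells s) (λ Z → F Z + D) X   ≈⟨ recolour-+ (cells s) ⟩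
          recolour (cells s) F X + recolour (cells s) (λ _ → D) X
            ≈⟨ +-cong (≈-sym (uniformResample-* s F X)) (recolour-cells-const s D) ⟩
          u * ν + u * D                          ≈⟨ distribˡ u ν D ⟨
          u * (ν + D)                            ∎)

        aκ≤ : a * κ ≤ a * ν + fromℕ 2 * ((a - u) * D)
        aκ≤ = begin
          a * κ ≈⟨ heatBath-* s F X ⟩
          recolour (cells s) (λ Z → weight s Z * F Z) X ≤⟨ recolour-mono (cells s) (λ Z agree → excess Z (proj₁ (osc Z agree))) ⟩
          recolour (cells s) (λ Z → F Z + e * (weight s Z + - 1#)) X
            ≈⟨ ≈-trans (recolour-+ (cells s)) (+-cong (≈-sym (uniformResample-* s F X))
                 (≈-trans (recolour-*ˡ (cells s) e) (*-congˡ (≈-trans (recolour-+ (cells s)) (+-congˡ (recolour-cells-const s (- 1#))))))) ⟩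
          u * ν + e * (a + u * - 1#)
            ≈⟨ +-congˡ (*-congˡ (+-congˡ (≈-trans (*-comm u _) (RingProperties.-1*x≈-x ring u)))) ⟩
          u * ν + e * (a - u)
            ≤⟨ +-monoʳ-≤ _ (*-monoʳ-≤ (x≤y⇒0≤y-x (colourings≤totalWeight s X)) (+-monoˡ-≤ D ν≥)) ⟩
          u * ν + ((ν + D) + D) * (a - u)
            ≈⟨ solve 4 (λ u ν D a → u :* ν :+ ((ν :+ D) :+ D) :* (a :- u) := a :* ν :+ con (ℤ.+ 2) :* ((a :- u) :* D)) ≈-refl u ν D a ⟩
          a * ν + fromℕ 2 * ((a - u) * D) ∎
          where
          excess : ∀ Z → F Z ≤ e → weight s Z * F Z ≤ F Z + e * (weight s Z + - 1#)
          excess Z FZ≤e = begin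
            weight s Z * F Z ≈⟨ ≈-trans (*-congʳ w≈) (≈-trans (distribʳ (F Z) 1# _) (+-congʳ (*-identityˡ _))) ⟩
            F Z + (weight s Z - 1#) * F Z ≤⟨ +-monoʳ-≤ _ (*-monoˡ-≤ (x≤y⇒0≤y-x (1≤weight s Z)) FZ≤e) ⟩
            F Z + (weight s Z - 1#) * e ≈⟨ +-congˡ (*-comm _ e) ⟩
            F Z + e * (weight s Z + - 1#) ∎
            where
            w≈ : weight s Z ≈ 1# + (weight s Z - 1#)
            w≈ = solve 2 (λ w o → w := o :+ (w :- o)) ≈-refl (weight s Z) 1#

      module _ {F : Observable} (lip : Lipschitz K F) where

        Lipschitz-cells : ∀ X Z → Agree (cells s) X Z → F Z ≤ F X + D
        Lipschitz-cells X Z agree = ≤-trans (Lipschitz-agree lip (cells s) {X} {Z} agree)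
          (≤-reflexive (+-congˡ (*-congʳ (≈-reflexive (cong fromℕ (length-cells s))))))

      heatBath-upper : ∀ {F} → Lipschitz K F → ∀ X → fromℕ 32 * heatBath s F X ≤ fromℕ 32 * uniformResample s F X + K
      heatBath-upper lip X = heatBath≤uniformResample _ X (λ Z agree →
        Lipschitz-cells lip X Z agree , Lipschitz-cells lip Z X (Agree-sym {X = X} {Z} agree))

      -- The upper bound for the negated function; writing it as `- 1# * F` lets the sign pass
      -- through `recolour-*ˡ`.
      heatBath-lower : ∀ {F} → Lipschitz K F → ∀ X → fromℕ 32 * uniformResample s F X ≤ fromℕ 32 * heatBath s F X + K
      heatBath-lower {F} lip X = begin
        c * uniformResample s F X
          ≈⟨ solve 2 (λ x K → con (ℤ.+ 32) :* x := :- (con (ℤ.+ 32) :* :- x :+ K) :+ K) ≈-refl _ K ⟩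
        - (c * - uniformResample s F X + K) + K ≤⟨ +-monoˡ-≤ K (neg-mono-≤ negated) ⟩
        - (c * - heatBath s F X) + K ≈⟨ solve 2 (λ x K → :- (con (ℤ.+ 32) :* :- x) :+ K := con (ℤ.+ 32) :* x :+ K) ≈-refl _ K ⟩
        c * heatBath s F X + K ∎
        where
        open ≤-Reasoning
        c = fromℕ 32
        negate : ∀ {x y} → - 1# * x * y ≈ - (x * y)
        negate {x} {y} = ≈-trans (*-congʳ (RingProperties.-1*x≈-x ring x)) (≈-sym (-‿distribˡ-* x y))
        negated : c * - heatBath s F X ≤ c * - uniformResample s F X + K
        negated = begin
          c * - heatBath s F X ≈⟨ *-congˡ negate ⟨
          c * (- 1# * recolour (cells s) (λ Z → weight s Z * F Z) X * totalWeight s X ⁻¹)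
            ≈⟨ *-congˡ (*-congʳ (≈-trans (≈-sym (recolour-*ˡ (cells s) (- 1#)))
                 (recolour-cong (cells s) (λ Z _ → solve 3 (λ o w f → o :* (w :* f) := w :* (o :* f)) ≈-refl (- 1#) (weight s Z) (F Z))))) ⟩
          c * heatBath s (λ Z → - 1# * F Z) X ≤⟨ heatBath-upper (Lipschitz-neg lip) X ⟩
          c * uniformResample s (λ Z → - 1# * F Z) X + K
            ≈⟨ +-congʳ (*-congˡ (≈-trans (*-congʳ (recolour-*ˡ (cells s) (- 1#))) negate)) ⟩
          c * - uniformResample s F X + K ∎

      module _ {F : Observable} (lip : Lipschitz K F) (X : Config V q) {v : Fin V} (b : Fin q) where

        private
          Y = X [ v ]≔ b

        heatBath-inside : v ∈ cells s → heatBath s F Y ≈ heatBath s F X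
        heatBath-inside v∈ = ≈-sym (heatBath-agree s {F} {X} {Y}
          (λ u u∉ → Vec.lookup∘update′ (λ { ≡.refl → u∉ v∈ }) X b))

        -- No edge joins `v` to the subgrid, so the weights are the same from `X` and from `Y`.
        -- Equal new colourings have equal probabilities, and F changes by at most K between them.
        heatBath-far : v ∉ cells s → (∀ {w} → w ∈ neighbours v → w ∉ cells s) → heatBath s F Y ≤ heatBath s F X + K
        heatBath-far v∉ nbrs∉ = *-cancelˡ-≤ (0<totalWeight s Y) (begin
          totalWeight s Y * heatBath s F Y                             ≈⟨ heatBath-* s F Y ⟩
          recolour (cells s) (λ Z → weight s Z * F Z) Y                ≈⟨ recolour-update (cells s) b v∉ ⟩
          recolour (cells s) (λ Z → weight s (Z [ v ]≔ b) * F (Z [ v ]≔ b)) X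
            ≤⟨ recolour-mono (cells s) (λ Z _ → ≤-trans (*-monoˡ-≤ (≤-trans 0≤1 (1≤weight s (Z [ v ]≔ b))) (lip Z v b))
                 (≤-reflexive (*-congʳ (same Z)))) ⟩
          recolour (cells s) (λ Z → weight s Z * (F Z + K)) X
            ≈⟨ ≈-trans (recolour-cong (cells s) (λ Z _ → ≈-trans (distribˡ _ _ _) (+-congˡ (*-comm _ K))))
                 (≈-trans (recolour-+ (cells s)) (+-cong (≈-sym (heatBath-* s F X)) (recolour-*ˡ (cells s) K))) ⟩
          totalWeight s X * heatBath s F X + K * totalWeight s X       ≈⟨ +-congˡ (*-comm K _) ⟩
          totalWeight s X * heatBath s F X + totalWeight s X * K       ≈⟨ distribˡ _ _ K ⟨
          totalWeight s X * (heatBath s F X + K)                       ≈⟨ *-congʳ total-same ⟨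
          totalWeight s Y * (heatBath s F X + K)                       ∎)
          where
          open ≤-Reasoning
          same : ∀ Z → weight s (Z [ v ]≔ b) ≈ weight s Z
          same Z = ≈-reflexive (cong (λ′ ^_) (incidentMono-update s b Z v∉ nbrs∉))
          total-same : totalWeight s Y ≈ totalWeight s X
          total-same = ≈-trans (recolour-update (cells s) b v∉) (recolour-cong (cells s) (λ Z _ → same Z))

        -- Goes through the uniform means, which differ by at most K; replacing the true mean on
        -- either side costs K/32.
        heatBath-outside : v ∉ cells s → fromℕ 16 * heatBath s F Y ≤ fromℕ 16 * heatBath s F X + fromℕ 17 * K
        heatBath-outside v∉ = *-cancelˡ-≤ (fromℕ-pos 2) (begin
          fromℕ 2 * (fromℕ 16 * heatBath s F Y)
            ≈⟨ solve 1 (λ x → con (ℤ.+ 2) :* (con (ℤ.+ 16) :* x) := con (ℤ.+ 32) :* x) ≈-refl _ ⟩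
          fromℕ 32 * heatBath s F Y ≤⟨ heatBath-upper lip Y ⟩
          fromℕ 32 * uniformResample s F Y + K ≤⟨ +-monoˡ-≤ K (*-monoˡ-≤ (fromℕ-nonneg 32) resample) ⟩
          fromℕ 32 * (uniformResample s F X + K) + K
            ≈⟨ solve 2 (λ x K → con (ℤ.+ 32) :* (x :+ K) :+ K := con (ℤ.+ 32) :* x :+ con (ℤ.+ 33) :* K) ≈-refl _ K ⟩
          fromℕ 32 * uniformResample s F X + fromℕ 33 * K ≤⟨ +-monoˡ-≤ _ (heatBath-lower lip X) ⟩
          (fromℕ 32 * heatBath s F X + K) + fromℕ 33 * K
            ≈⟨ solve 2 (λ x K → (con (ℤ.+ 32) :* x :+ K) :+ con (ℤ.+ 33) :* K :=
                 con (ℤ.+ 2) :* (con (ℤ.+ 16) :* x :+ con (ℤ.+ 17) :* K)) ≈-refl _ K ⟩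
          fromℕ 2 * (fromℕ 16 * heatBath s F X + fromℕ 17 * K) ∎)
          where
          open ≤-Reasoning
          resample : uniformResample s F Y ≤ uniformResample s F X + K
          resample = *-cancelˡ-≤ 0<colourings (begin
            colourings * uniformResample s F Y             ≈⟨ uniformResample-* s F Y ⟩
            recolour (cells s) F Y                         ≈⟨ recolour-update (cells s) b v∉ ⟩
            recolour (cells s) (λ Z → F (Z [ v ]≔ b)) X    ≤⟨ recolour-mono (cells s) (λ Z _ → lip Z v b) ⟩
            recolour (cells s) (λ Z → F Z + K) X           ≈⟨ recolour-+ (cells s) ⟩
            recolour (cells s) F X + recolour (cells s) (λ _ → K) X
              ≈⟨ +-cong (≈-sym (uniformResample-* s F X)) (recolour-cells-const s K) ⟩
            colourings * uniformResample s F X + colourings * K ≈⟨ distribˡ _ _ K ⟨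
            colourings * (uniformResample s F X + K)       ∎)

    -- Contraction of Lipschitz constants in one step

    open import Data.List.Membership.DecPropositional (Fin._≟_ {V}) using () renaming (_∈?_ to _∈ᵛ?_)

    inside? : ∀ v s → Carrier
    inside? v s = indicator (v ∈ᵛ? cells s)

    -- For each of the r² offsets exactly one position places the cell with that offset on `v`.
    covered-by-area-subgrids : ∀ v → Σ[ positions ] (inside? v) ≈ fromℕ area
    covered-by-area-subgrids v = begin-equality
      Σ[ positions ] (inside? v) ≈⟨ Σ-cong positions inside≈ ⟩
      Σ[ positions ] (λ s → Σ[ upTo area ] (λ t → indicator (v Fin.≟ cell s t))) ≈⟨ Σ-swap positions (upTo area) ⟩
      Σ[ upTo area ] (λ t → Σ[ positions ] (λ s → indicator (v Fin.≟ cell s t))) ≈⟨ Σ-cong (upTo area) once ⟩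
      Σ[ upTo area ] (λ _ → 1#) ≈⟨ Σ-const (upTo area) 1# ⟩
      fromℕ (length (upTo area)) * 1# ≈⟨ *-identityʳ _ ⟩
      fromℕ (length (upTo area)) ≈⟨ ≈-reflexive (cong fromℕ (List.length-upTo area)) ⟩
      fromℕ area ∎
      where
      open ≤-Reasoning
      indicator-∈ : ∀ {ws} → Unique ws → indicator (v ∈ᵛ? ws) ≈ Σ[ ws ] (λ w → indicator (v Fin.≟ w))
      indicator-∈ {ws} ws! with v ∈ᵛ? ws
      ... | yes v∈ws = ≈-sym (≈-trans (Σ-cong ws (λ w → ≈-sym (*-identityʳ _))) (Σ-point Fin._≟_ ws! v∈ws (λ _ → 1#)))
      ... | no v∉ws = ≈-sym (≤-antisym
        (≤-trans (Σ-mono ws (λ w w∈ → ≤-reflexive (indicator-no (v Fin.≟ w) (λ { ≡.refl → v∉ws w∈ })))) (≤-reflexive (Σ-0 ws)))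
        (Σ-nonneg ws (λ w → indicator-nonneg (v Fin.≟ w))))
      inside≈ : ∀ s → inside? v s ≈ Σ[ upTo area ] (λ t → indicator (v Fin.≟ cell s t))
      inside≈ s = ≈-trans (indicator-∈ (cells! s)) (≈-trans
        (≈-reflexive (cong (λ ws → Σ[ ws ] (λ w → indicator (v Fin.≟ w))) (≡.sym (List.map-upTo (cell s) area))))
        (≈-reflexive (Σ-map (cell s) (upTo area))))
      position≟ : ∀ (s s′ : Position) → Dec (s ≡ s′)
      position≟ = ×-≡-dec Fin._≟_ Fin._≟_
      once : ∀ t → Σ[ positions ] (λ s → indicator (v Fin.≟ cell s t)) ≈ 1#
      once t = ≈-trans
        (Σ-cong positions (λ s → ≈-trans (indicator-cong (v Fin.≟ cell s t) (position≟ origin s) (to s) (from s)) (≈-sym (*-identityʳ _))))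
        (Σ-point position≟ positions! (∈-positions origin) (λ _ → 1#))
        where
        i = ℕ.pred L ℕ.+ suc (t ℕ./ r)
        j = ℕ.pred L ℕ.+ suc (t ℕ.% r)
        origin : Position
        origin = proj₁ (coordinates {L} v) ⊖ i , proj₂ (coordinates {L} v) ⊖ j
        to : ∀ s → v ≡ cell s t → origin ≡ s
        to (a , b) v≡ = cong₂ _,_
          (≡.trans (cong (_⊖ i) (cong proj₁ coordinates≡)) (⊕-⊖ a i))
          (≡.trans (cong (_⊖ j) (cong proj₂ coordinates≡)) (⊕-⊖ b j))
          where
          coordinates≡ : coordinates {L} v ≡ (a ⊕ i , b ⊕ j)
          coordinates≡ = ≡.trans (cong (coordinates {L}) v≡) (coordinates-vertex _)
        from : ∀ s → origin ≡ s → v ≡ cell s t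
        from s ≡.refl = ≡.sym (≡.trans
          (cong₂ (λ x y → vertex (x , y)) (⊖-⊕ (proj₁ (coordinates {L} v)) i) (⊖-⊕ (proj₂ (coordinates {L} v)) j))
          (vertex-coordinates {L} v))

    -- Counting neighbours inside the subgrid, not just testing for one, makes the total over all
    -- positions four times that of `covered-by-area-subgrids`.
    adjacency : Fin V → Position → Carrier
    adjacency v s = Σ[ neighbours v ] (λ w → inside? w s)

    -- One inequality, linear in indicators, for three cases. Scaled by 16, the mean changes by 0 if
    -- `v` is inside, by at most 17 K if `v` is next to the subgrid, and by at most 16 K otherwise.
    heatBath-local : ∀ s {K F} → 0# ≤ K → Lipschitz K F → ∀ X v b →
      fromℕ 16 * heatBath s F (X [ v ]≔ b) + (fromℕ 16 * K) * inside? v s ≤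
      fromℕ 16 * heatBath s F X + (fromℕ 16 * K + K * adjacency v s)
    heatBath-local s {K} {F} 0≤K lip X v b with v ∈ᵛ? cells s
    ... | yes v∈ = +-mono-≤ (≤-reflexive (*-congˡ (heatBath-inside s 0≤K lip X b v∈)))
      (≤-trans (≤-reflexive (*-identityʳ _)) (gap-≤ (*-nonneg 0≤K (Σ-nonneg (neighbours v) (λ w → indicator-nonneg (w ∈ᵛ? cells s)))) ≈-refl))
    ... | no v∉ with All.all? (λ w → ¬? (w ∈ᵛ? cells s)) (neighbours v)
    ...   | yes far = begin
      c * heatBath s F Y + (c * K) * 0#   ≈⟨ ≈-trans (+-congˡ (zeroʳ _)) (+-identityʳ _) ⟩
      c * heatBath s F Y                  ≤⟨ *-monoˡ-≤ (fromℕ-nonneg 16) (heatBath-far s 0≤K lip X b v∉ (All.lookup far)) ⟩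
      c * (heatBath s F X + K)            ≈⟨ distribˡ c _ K ⟩
      c * heatBath s F X + c * K          ≤⟨ +-monoʳ-≤ _ (gap-≤ (*-nonneg 0≤K (Σ-nonneg (neighbours v) (λ w → indicator-nonneg (w ∈ᵛ? cells s)))) ≈-refl) ⟩
      c * heatBath s F X + (c * K + K * adjacency v s) ∎
      where
      open ≤-Reasoning
      c = fromℕ 16
      Y = X [ v ]≔ b
    ...   | no ¬far = begin
      c * heatBath s F Y + (c * K) * 0#   ≈⟨ ≈-trans (+-congˡ (zeroʳ _)) (+-identityʳ _) ⟩
      c * heatBath s F Y                  ≤⟨ heatBath-outside s 0≤K lip X b v∉ ⟩
      c * heatBath s F X + fromℕ 17 * K   ≈⟨ +-congˡ (solve 1 (λ K → con (ℤ.+ 17) :* K := con (ℤ.+ 16) :* K :+ K :* con (ℤ.+ 1)) ≈-refl K) ⟩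
      c * heatBath s F X + (c * K + K * fromℕ 1) ≤⟨ +-monoʳ-≤ _ (+-monoʳ-≤ _ (*-monoˡ-≤ 0≤K (≤-trans (≤-reflexive fromℕ-1) (near (neighbours v) ¬far)))) ⟩
      c * heatBath s F X + (c * K + K * adjacency v s) ∎
      where
      open ≤-Reasoning
      c = fromℕ 16
      Y = X [ v ]≔ b
      near : ∀ ws → ¬ All (λ w → ¬ (w ∈ cells s)) ws → 1# ≤ Σ[ ws ] (λ w → inside? w s)
      near [] ¬none = ⊥-elim (¬none [])
      near (w ∷ ws) ¬none with w ∈ᵛ? cells s
      ... | yes w∈ = gap-≤ (Σ-nonneg ws (λ u → indicator-nonneg (u ∈ᵛ? cells s))) ≈-refl
      ... | no w∉ = ≤-trans (near ws (λ none → ¬none (w∉ ∷ none))) (≤-reflexive (≈-sym (+-identityˡ _)))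

    step : Observable → Observable
    step F X = Σ[ positions ] (λ s → heatBath s F X) / fromℕ V

    instance
      V≢0 : NonZero V
      V≢0 = ℕ.m*n≢0 L L {{L≢0}} {{L≢0}}
        where L≢0 = ℕ.nonTrivial⇒nonZero L

    0<V : 0# < fromℕ V
    0<V = fromℕ-pos V

    -- A rate of area / (2V) would give the time bound only up to rounding; the surplus pays for the floor.
    rate : Carrier
    rate = fromℕ (3 ℕ.* area) / fromℕ (4 ℕ.* V)

    contraction : ∀ {K F} → 0# ≤ K → Lipschitz K F → Lipschitz ((1# - rate) * K) (step F)
    contraction {K} {F} 0≤K lip X v b = *-cancelˡ-≤ (*-pos (fromℕ-pos 16) 0<V)
      (cancel-right (begin
      (c * N) * step F Y + (c * K) * A  ≈⟨ +-cong (≈-trans (*-assoc c N _) (*-congˡ (y*[x/y]≈x 0<V))) (*-congˡ (≈-sym (covered-by-area-subgrids v))) ⟩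
      c * Σ[ positions ] (λ s → heatBath s F Y) + (c * K) * Σ[ positions ] (inside? v)
        ≈⟨ ≈-trans (Σ-+ positions) (+-cong (Σ-*ˡ positions c) (Σ-*ˡ positions (c * K))) ⟨
      Σ[ positions ] (λ s → c * heatBath s F Y + (c * K) * inside? v s)
        ≤⟨ Σ-mono positions (λ s _ → heatBath-local s 0≤K lip X v b) ⟩
      Σ[ positions ] (λ s → c * heatBath s F X + (c * K + K * adjacency v s))
        ≈⟨ ≈-trans (Σ-+ positions) (+-cong (≈-trans (Σ-*ˡ positions c) (≈-trans (*-congˡ (≈-sym (y*[x/y]≈x 0<V))) (≈-sym (*-assoc c N _))))
             (≈-trans (Σ-+ positions) (+-cong (≈-trans (Σ-const positions (c * K)) (*-congʳ (≈-reflexive (cong fromℕ length-positions))))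
               (≈-trans (Σ-*ˡ positions K) (*-congˡ adjacencies))))) ⟩
      (c * N) * step F X + (N * (c * K) + K * (fromℕ 4 * A))
        -- The loss 4 A is written as 16 A - 12 A: the first part cancels the term added on the
        -- left, and 12 A is 16 n times the rate.
        ≈⟨ +-congˡ (+-congˡ (*-congˡ (solve 1 (λ A → con (ℤ.+ 4) :* A := con (ℤ.+ 16) :* A :- con (ℤ.+ 12) :* A) ≈-refl A))) ⟩
      (c * N) * step F X + (N * (c * K) + K * (c * A - fromℕ 12 * A))
        ≈⟨ +-congˡ (+-congˡ (*-congˡ (+-congˡ (-‿cong (≈-sym rate-*))))) ⟩
      (c * N) * step F X + (N * (c * K) + K * (c * A - (c * N) * rate))
        ≈⟨ solve 6 (λ c N f K A ρ → (c :* N) :* f :+ (N :* (c :* K) :+ K :* (c :* A :- (c :* N) :* ρ))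
             := ((c :* N) :* (f :+ K :- ρ :* K)) :+ (c :* K) :* A) ≈-refl c N (step F X) K A rate ⟩
      (c * N) * (step F X + K - rate * K) + (c * K) * A
        ≈⟨ +-congʳ (*-congˡ (≈-trans (+-assoc _ K _) (+-congˡ (≈-sym (≈-trans (distribʳ K 1# (- rate))
             (+-cong (*-identityˡ K) (≈-sym (-‿distribˡ-* rate K)))))))) ⟩
      (c * N) * (step F X + (1# - rate) * K) + (c * K) * A ∎))
      where
      open ≤-Reasoning
      c = fromℕ 16
      N = fromℕ V
      A = fromℕ area
      Y = X [ v ]≔ b
      cancel-right : ∀ {x y z} → x + z ≤ y + z → x ≤ y
      cancel-right {x} {y} {z} x+z≤y+z = begin
        x         ≈⟨ solve 2 (λ x z → x := x :+ z :- z) ≈-refl x z ⟩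
        x + z - z ≤⟨ +-monoˡ-≤ (- z) x+z≤y+z ⟩
        y + z - z ≈⟨ solve 2 (λ x z → x :+ z :- z := x) ≈-refl y z ⟩
        y         ∎
      adjacencies : Σ[ positions ] (adjacency v) ≈ fromℕ 4 * A
      adjacencies = ≈-trans (Σ-swap positions (neighbours v) {λ s w → inside? w s}) (≈-trans
        (Σ-cong (neighbours v) covered-by-area-subgrids) (Σ-const (neighbours v) A))
      rate-* : (c * N) * rate ≈ fromℕ 12 * A
      rate-* = begin-equality
        (c * N) * rate ≈⟨ solve 2 (λ N ρ → (con (ℤ.+ 16) :* N) :* ρ := con (ℤ.+ 4) :* ((con (ℤ.+ 4) :* N) :* ρ)) ≈-refl N rate ⟩
        fromℕ 4 * ((fromℕ 4 * N) * rate) ≈⟨ *-congˡ (*-congʳ (fromℕ-* 4 V)) ⟨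
        fromℕ 4 * (fromℕ (4 ℕ.* V) * rate) ≈⟨ *-congˡ (y*[x/y]≈x (fromℕ-pos (4 ℕ.* V) {{ℕ.m*n≢0 4 V}})) ⟩
        fromℕ 4 * fromℕ (3 ℕ.* area) ≈⟨ *-congˡ (fromℕ-* 3 area) ⟩
        fromℕ 4 * (fromℕ 3 * A) ≈⟨ solve 1 (λ A → con (ℤ.+ 4) :* (con (ℤ.+ 3) :* A) := con (ℤ.+ 12) :* A) ≈-refl A ⟩
        fromℕ 12 * A ∎

    -- The transition matrix acting on functions

    transition : TransitionMatrix {V} {q}
    transition = blockDynamics (subgrids L r) (uniform (subgrids L r)) G λ′

    stationary : Distribution {V} {q}
    stationary = gibbs G λ′

    elements↭cells : ∀ s → elements (subgrid r s) ↭ cells s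
    elements↭cells s = ∼bag⇒↭ (unique∧set⇒bag (elements! (subgrid r s)) (cells! s)
      (mk⇔ (λ v∈ → ∈-subgrid⁻ s (∈-elements⁻ (subgrid r s) v∈)) (λ v∈ → ∈-elements⁺ (subgrid r s) (∈-subgrid⁺ s v∈))))

    Σ-overwrite-cells : ∀ s X (F : Observable) →
      Σ[ configs ∣ subgrid r s ∣ q ] (λ c → F (overwrite X (subgrid r s) c)) ≈ recolour (cells s) F X
    Σ-overwrite-cells s X F = ≈-trans (Σ-overwrite X (subgrid r s) F) (recolour-↭ (elements↭cells s))

    updateProbability : Position → Config V q → Config V q → Carrier
    updateProbability s X Y =
      Σ[ filter (λ c → overwrite X (subgrid r s) c ≟ᶜ Y) (configs ∣ subgrid r s ∣ q) ] λ c →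
        λ′ ^ μ[_,_] G X (subgrid r s) c / Σ[ configs ∣ subgrid r s ∣ q ] (λ d → λ′ ^ μ[_,_] G X (subgrid r s) d)

    updateProbability-action : ∀ s (F : Observable) X → Σ[ configs V q ] (λ Y → updateProbability s X Y * F Y) ≈ heatBath s F X
    updateProbability-action s F X = begin-equality
      Σ[ configs V q ] (λ Y → updateProbability s X Y * F Y)
        ≈⟨ Σ-fibres _≟ᶜ_ (configs! {V}) ∈-configs (overwrite X S) (λ c → weight s (overwrite X S c) / total) F (configs ∣ S ∣ q) ⟩
      Σ[ configs ∣ S ∣ q ] (λ c → (weight s (overwrite X S c) / total) * F (overwrite X S c))
        ≈⟨ Σ-cong (configs ∣ S ∣ q) (λ c → solve 3 (λ w t f → (w :* t) :* f := (w :* f) :* t) ≈-refl _ (total ⁻¹) _) ⟩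
      Σ[ configs ∣ S ∣ q ] (λ c → (weight s (overwrite X S c) * F (overwrite X S c)) * total ⁻¹)
        ≈⟨ Σ-*ʳ (configs ∣ S ∣ q) (total ⁻¹) ⟩
      Σ[ configs ∣ S ∣ q ] (λ c → weight s (overwrite X S c) * F (overwrite X S c)) / total
        ≈⟨ *-cong (Σ-overwrite-cells s X (λ Z → weight s Z * F Z)) (⁻¹-cong (Σ-overwrite-cells s X (weight s))) ⟩
      heatBath s F X ∎
      where
      open ≤-Reasoning
      S = subgrid r s
      total = Σ[ configs ∣ S ∣ q ] (λ d → weight s (overwrite X S d))

    -- The weight ψ is 1/n because distinct positions give distinct subgrids, so the matrix acts as
    -- the plain average of the block expectations over all positions.
    transition-action : ∀ (F : Observable) X → Σ[ configs V q ] (λ Y → transition X Y * F Y) ≈ step F X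
    transition-action F X = begin-equality
      Σ[ configs V q ] (λ Y → transition X Y * F Y)
        ≈⟨ Σ-cong (configs V q) (λ Y → ≈-trans (*-congʳ (expand Y)) (≈-sym (Σ-*ʳ positions (F Y)))) ⟩
      Σ[ configs V q ] (λ Y → Σ[ positions ] (λ s → (ψ * updateProbability s X Y) * F Y))
        ≈⟨ Σ-swap (configs V q) positions ⟩
      Σ[ positions ] (λ s → Σ[ configs V q ] (λ Y → (ψ * updateProbability s X Y) * F Y))
        ≈⟨ Σ-cong positions (λ s → ≈-trans (Σ-cong (configs V q) (λ Y → *-assoc ψ _ _))
             (≈-trans (Σ-*ˡ (configs V q) ψ) (*-congˡ (updateProbability-action s F X)))) ⟩
      Σ[ positions ] (λ s → ψ * heatBath s F X) ≈⟨ Σ-*ˡ positions ψ ⟩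
      ψ * Σ[ positions ] (λ s → heatBath s F X)
        ≈⟨ ≈-trans (*-comm ψ _) (*-congˡ (≈-trans (*-identityˡ _) (⁻¹-cong (≈-reflexive (cong fromℕ length-subgrids))))) ⟩
      step F X ∎
      where
      open ≤-Reasoning
      ψ = 1# / fromℕ (length (subgrids L r))
      update : Config V q → Subset V → Carrier
      update Y S = Σ[ filter (λ c → overwrite X S c ≟ᶜ Y) (configs ∣ S ∣ q) ] λ c →
        λ′ ^ μ[_,_] G X S c / Σ[ configs ∣ S ∣ q ] (λ d → λ′ ^ μ[_,_] G X S d)
      expand : ∀ Y → transition X Y ≈ Σ[ positions ] (λ s → ψ * updateProbability s X Y)
      expand Y = ≈-trans
        (≈-reflexive (cong (λ 𝒮 → Σ[ 𝒮 ] (λ S → ψ * update Y S)) subgrids≡map))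
        (≈-reflexive (Σ-map (subgrid r) positions))

    iterate : ℕ → Observable → Observable
    iterate zero    F = F
    iterate (suc t) F = step (iterate t F)

    power-action : ∀ t (F : Observable) X → Σ[ configs V q ] (λ Y → (transition ^ᴹ t) X Y * F Y) ≈ iterate t F X
    power-action zero    F X = Σ-point _≟ᶜ_ (configs! {V}) (∈-configs X) F
    power-action (suc t) F X = begin-equality
      Σ[ configs V q ] (λ Y → (transition ^ᴹ suc t) X Y * F Y)
        ≈⟨ Σ-cong (configs V q) (λ Y → Σ-*ʳ (configs V q) (F Y)) ⟨
      Σ[ configs V q ] (λ Y → Σ[ configs V q ] (λ Z → (transition X Z * (transition ^ᴹ t) Z Y) * F Y))
        ≈⟨ Σ-swap (configs V q) (configs V q) ⟩
      Σ[ configs V q ] (λ Z → Σ[ configs V q ] (λ Y → (transition X Z * (transition ^ᴹ t) Z Y) * F Y))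
        ≈⟨ Σ-cong (configs V q) (λ Z → ≈-trans (Σ-cong (configs V q) (λ Y → *-assoc (transition X Z) ((transition ^ᴹ t) Z Y) (F Y)))
             (≈-trans (Σ-*ˡ (configs V q) (transition X Z)) (*-congˡ (power-action t F Z)))) ⟩
      Σ[ configs V q ] (λ Z → transition X Z * iterate t F Z) ≈⟨ transition-action (iterate t F) X ⟩
      iterate (suc t) F X ∎
      where open ≤-Reasoning

    -- Stationarity of the Gibbs distribution

    private
      outerMono : Subset V → Config V q → ℕ
      outerMono S Z = length (filter (λ e → ¬? (incident? S e)) (monochromaticEdges G Z))

      μ≡incident+outer : ∀ S Z → μ G Z ≡ incidentMono S Z ℕ.+ outerMono S Z
      μ≡incident+outer S Z = length-filter-¬ (incident? S) (monochromaticEdges G Z)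

      outerMono-agree : ∀ s {X Z} → Agree (cells s) X Z → outerMono (subgrid r s) Z ≡ outerMono (subgrid r s) X
      outerMono-agree s {X} {Z} agree = cong length (filter-filter-cong (λ e → ¬? (incident? (subgrid r s) e)) (mono? Z) (mono? X) (Graph.edges G) same)
        where
        same : ∀ e → e ∈ Graph.edges G → _ → _
        same (x , y) _ ¬inc = (λ eq → ≡.trans (≡.sym x≡) (≡.trans eq y≡)) , (λ eq → ≡.trans x≡ (≡.trans eq (≡.sym y≡)))
          where
          x≡ : lookup Z x ≡ lookup X x
          x≡ = agree x (λ x∈ → ¬inc (inj₁ (∈-subgrid⁺ s x∈)))
          y≡ : lookup Z y ≡ lookup X y
          y≡ = agree y (λ y∈ → ¬inc (inj₂ (∈-subgrid⁺ s y∈)))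

    potts : Observable
    potts X = λ′ ^ μ G X

    -- Resampling the cells multiplies a sum over all configurations by q^(r²), so the two sums can be
    -- compared on each fibre of configurations that agree off the cells.
    heatBath-stationary : ∀ s F → Σ[ configs V q ] (λ X → potts X * heatBath s F X) ≈ Σ[ configs V q ] (λ X → potts X * F X)
    heatBath-stationary s F = *-cancelˡ-≈ 0<colourings (begin-equality
      colourings * Σ[ configs V q ] (λ X → potts X * heatBath s F X) ≈⟨ resample _ ⟨
      Σ[ configs V q ] (recolour (cells s) (λ Z → potts Z * heatBath s F Z)) ≈⟨ Σ-cong (configs V q) local ⟩
      Σ[ configs V q ] (recolour (cells s) (λ Z → potts Z * F Z)) ≈⟨ resample _ ⟩
      colourings * Σ[ configs V q ] (λ X → potts X * F X) ∎)
      where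
      open ≤-Reasoning
      resample : ∀ H → Σ[ configs V q ] (recolour (cells s) H) ≈ colourings * Σ[ configs V q ] H
      resample H = ≈-trans (Σ-configs-recolour (cells s) H) (*-congʳ (≈-reflexive (cong (fromℕ q ^_) (length-cells s))))
      outer : Observable
      outer X = λ′ ^ outerMono (subgrid r s) X
      -- Edges that do not meet the cells give a factor that is constant on the fibre, so it can be
      -- taken out of both sums.
      potts-split : ∀ X Z → Agree (cells s) X Z → potts Z ≈ outer X * weight s Z
      potts-split X Z agree = ≈-trans (≈-reflexive (cong (λ′ ^_) (μ≡incident+outer (subgrid r s) Z)))
        (≈-trans (^-homo-* λ′ (incidentMono (subgrid r s) Z) (outerMono (subgrid r s) Z))
          (≈-trans (*-comm _ _) (*-congʳ (≈-reflexive (cong (λ′ ^_) (outerMono-agree s {X} {Z} agree))))))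
      local : ∀ X → recolour (cells s) (λ Z → potts Z * heatBath s F Z) X ≈ recolour (cells s) (λ Z → potts Z * F Z) X
      local X = begin-equality
        recolour (cells s) (λ Z → potts Z * heatBath s F Z) X
          ≈⟨ recolour-cong (cells s) (λ Z agree → ≈-trans
               (*-cong (potts-split X Z agree) (≈-sym (heatBath-agree s {F} {X} {Z} agree)))
               (solve 3 (λ o w h → (o :* w) :* h := (o :* h) :* w) ≈-refl (outer X) (weight s Z) (heatBath s F X))) ⟩
        recolour (cells s) (λ Z → (outer X * heatBath s F X) * weight s Z) X ≈⟨ recolour-*ˡ (cells s) _ ⟩
        (outer X * heatBath s F X) * totalWeight s X
          ≈⟨ ≈-trans (*-assoc _ _ _) (*-congˡ (≈-trans (*-comm _ _) (heatBath-* s F X))) ⟩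
        outer X * recolour (cells s) (λ Z → weight s Z * F Z) X ≈⟨ recolour-*ˡ (cells s) (outer X) ⟨
        recolour (cells s) (λ Z → outer X * (weight s Z * F Z)) X
          ≈⟨ recolour-cong (cells s) (λ Z agree → ≈-trans (≈-sym (*-assoc _ _ _)) (*-congʳ (≈-sym (potts-split X Z agree)))) ⟩
        recolour (cells s) (λ Z → potts Z * F Z) X ∎

    step-potts : ∀ F → Σ[ configs V q ] (λ X → potts X * step F X) ≈ Σ[ configs V q ] (λ X → potts X * F X)
    step-potts F = begin-equality
      Σ[ configs V q ] (λ X → potts X * step F X)
        ≈⟨ Σ-cong (configs V q) (λ X → ≈-trans (≈-sym (*-assoc _ _ _)) (*-congʳ (≈-sym (Σ-*ˡ positions (potts X))))) ⟩
      Σ[ configs V q ] (λ X → Σ[ positions ] (λ s → potts X * heatBath s F X) * fromℕ V ⁻¹) ≈⟨ Σ-*ʳ (configs V q) _ ⟩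
      Σ[ configs V q ] (λ X → Σ[ positions ] (λ s → potts X * heatBath s F X)) * fromℕ V ⁻¹
        ≈⟨ *-congʳ (≈-trans (Σ-swap (configs V q) positions) (≈-trans
             (Σ-cong positions (λ s → heatBath-stationary s F)) (Σ-const positions _))) ⟩
      (fromℕ (length positions) * Σ[ configs V q ] (λ X → potts X * F X)) * fromℕ V ⁻¹
        ≈⟨ *-congʳ (*-congʳ (≈-reflexive (cong fromℕ length-positions))) ⟩
      (fromℕ V * Σ[ configs V q ] (λ X → potts X * F X)) / fromℕ V
        ≈⟨ ≈-trans (*-assoc _ _ _) (y*[x/y]≈x 0<V) ⟩
      Σ[ configs V q ] (λ X → potts X * F X) ∎
      where open ≤-Reasoning

    -- Total variation distance as a difference of expectations

    partitionFunction : Carrier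
    partitionFunction = Σ[ configs V q ] potts

    stationary-expectation : ∀ (F : Observable) → Σ[ configs V q ] (λ X → stationary X * F X) ≈ Σ[ configs V q ] (λ X → potts X * F X) / partitionFunction
    stationary-expectation F = ≈-trans
      (Σ-cong (configs V q) (λ X → solve 3 (λ a z f → (a :* z) :* f := (a :* f) :* z) ≈-refl (potts X) (partitionFunction ⁻¹) (F X)))
      (Σ-*ʳ (configs V q) (partitionFunction ⁻¹))

    stationary-iterate : ∀ t F → Σ[ configs V q ] (λ X → stationary X * iterate t F X) ≈ Σ[ configs V q ] (λ X → stationary X * F X)
    stationary-iterate zero    F = ≈-refl
    stationary-iterate (suc t) F = ≈-trans (stationary-expectation (step (iterate t F))) (≈-trans (*-congʳ (step-potts (iterate t F)))
      (≈-trans (≈-sym (stationary-expectation (iterate t F))) (stationary-iterate t F)))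

    0<potts : ∀ X → 0# < potts X
    0<potts X = ^-pos (μ G X) (<-≤-trans 0<1 1≤λ′)

    0<partitionFunction : Config V q → 0# < partitionFunction
    0<partitionFunction X = <-≤-trans (0<potts X) (member (configs V q) (∈-configs X))
      where
      member : ∀ Zs → X ∈ Zs → potts X ≤ Σ[ Zs ] potts
      member (Z ∷ Zs) (here ≡.refl) = gap-≤ (Σ-nonneg Zs (λ Z → inj₁ (0<potts Z))) ≈-refl
      member (Z ∷ Zs) (there X∈)    = ≤-trans (member Zs X∈) (gap-≤ (inj₁ (0<potts Z)) (+-comm _ _))

    stationary-total : Config V q → Σ[ configs V q ] stationary ≈ 1#
    stationary-total X = ≈-trans (Σ-*ʳ (configs V q) _) (*-inverseʳ (0<partitionFunction X))

    -- Stationarity replaces the expectation of `f` under π by that of `g`, the expectation of `f`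
    -- after t steps. The distance is then the average of g x - g σ over σ, so a bound on the
    -- oscillation of `g` is enough.
    totalVariation-bound : ∀ t x β →
      (∀ f → Lipschitz 1# f → (∀ X Y → f X ≤ f Y + 1#) → ∀ X Y → iterate t f X ≤ iterate t f Y + β) →
      totalVariation ((transition ^ᴹ t) x) stationary ≤ β
    totalVariation-bound t x β oscillation = begin
      Σ[ configs V q ] (λ σ → abs (d σ)) / fromℕ 2 ≈⟨ Σ-*ʳ (configs V q) half ⟨
      Σ[ configs V q ] (λ σ → abs (d σ) * half) ≈⟨ Σ-cong (configs V q) (λ σ → signed σ) ⟩
      Σ[ configs V q ] (λ σ → (transition ^ᴹ t) x σ * f σ + - 1# * (stationary σ * f σ))
        ≈⟨ ≈-trans (Σ-+ (configs V q)) (+-cong (power-action t f x) (≈-trans (Σ-*ˡ (configs V q) (- 1#)) (*-congˡ (≈-sym (stationary-iterate t f))))) ⟩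
      g x + - 1# * Σ[ configs V q ] (λ σ → stationary σ * g σ)
        ≈⟨ +-congʳ (≈-trans (≈-sym (*-identityˡ _)) (≈-trans (*-congʳ (≈-sym (stationary-total x))) (≈-sym (Σ-*ʳ (configs V q) (g x))))) ⟩
      Σ[ configs V q ] (λ σ → stationary σ * g x) + - 1# * Σ[ configs V q ] (λ σ → stationary σ * g σ)
        ≤⟨ +-monoˡ-≤ _ (Σ-mono (configs V q) (λ σ _ → *-monoˡ-≤ (/-nonneg (inj₁ (0<potts σ)) (0<partitionFunction x))
             (oscillation f lipschitz oscillation₀ x σ))) ⟩
      Σ[ configs V q ] (λ σ → stationary σ * (g σ + β)) + - 1# * Σ[ configs V q ] (λ σ → stationary σ * g σ)
        ≈⟨ +-cong (≈-trans (Σ-cong (configs V q) (λ σ → distribˡ _ _ _)) (≈-trans (Σ-+ (configs V q))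
             (+-congˡ (≈-trans (Σ-*ʳ (configs V q) β) (≈-trans (*-congʳ (stationary-total x)) (*-identityˡ β))))))
             (RingProperties.-1*x≈-x ring _) ⟩
      (Σ[ configs V q ] (λ σ → stationary σ * g σ) + β) - Σ[ configs V q ] (λ σ → stationary σ * g σ)
        ≈⟨ solve 2 (λ a b → (a :+ b) :- a := b) ≈-refl _ β ⟩
      β ∎
      where
      open ≤-Reasoning
      d : Observable
      d σ = (transition ^ᴹ t) x σ - stationary σ
      -- Half the sign of d, so that the distance is the difference of two expectations of f.
      f : Observable
      f σ = if does (d σ <? 0#) then - half else half
      g : Observable
      g = iterate t f
      signed : ∀ σ → abs (d σ) * half ≈ (transition ^ᴹ t) x σ * f σ + - 1# * (stationary σ * f σ)
      signed σ with d σ <? 0#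
      ... | yes _ = ≈-trans (solve 3 (λ a b h → (:- (a :- b)) :* h := a :* (:- h) :- b :* (:- h)) ≈-refl ((transition ^ᴹ t) x σ) (stationary σ) half)
                      (+-congˡ (≈-sym (RingProperties.-1*x≈-x ring _)))
      ... | no _  = ≈-trans (solve 3 (λ a b h → (a :- b) :* h := a :* h :- b :* h) ≈-refl ((transition ^ᴹ t) x σ) (stationary σ) half)
                      (+-congˡ (≈-sym (RingProperties.-1*x≈-x ring _)))
      -half≤f : ∀ σ → - half ≤ f σ
      -half≤f σ with d σ <? 0#
      ... | yes _ = ≤-refl
      ... | no _  = gap-≤ 0≤1 (≈-trans (+-congˡ (≈-sym half+half)) (solve 1 (λ h → :- h :+ (h :+ h) := h) ≈-refl half))
      f≤half : ∀ σ → f σ ≤ half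
      f≤half σ with d σ <? 0#
      ... | no _  = ≤-refl
      ... | yes _ = gap-≤ 0≤1 (≈-trans (+-congˡ (≈-sym half+half)) (solve 1 (λ h → :- h :+ (h :+ h) := h) ≈-refl half))
      oscillation₀ : ∀ X Y → f X ≤ f Y + 1#
      oscillation₀ X Y = begin
        f X               ≤⟨ f≤half X ⟩
        half              ≈⟨ solve 1 (λ h → h := :- h :+ (h :+ h)) ≈-refl half ⟩
        - half + (half + half) ≈⟨ +-congˡ half+half ⟩
        - half + 1#       ≤⟨ +-monoˡ-≤ 1# (-half≤f Y) ⟩
        f Y + 1#          ∎
      lipschitz : Lipschitz 1# f
      lipschitz X v b = oscillation₀ _ X

    rate<1 : rate < 1#
    rate<1 = ≰⇒> (λ 1≤rate → <⇒≱ (fromℕ-mono-< 3area<4V) (begin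
      fromℕ (4 ℕ.* V)        ≈⟨ *-identityʳ _ ⟨
      fromℕ (4 ℕ.* V) * 1#   ≤⟨ *-monoˡ-≤ (fromℕ-nonneg (4 ℕ.* V)) 1≤rate ⟩
      fromℕ (4 ℕ.* V) * rate ≈⟨ y*[x/y]≈x (fromℕ-pos (4 ℕ.* V) {{ℕ.m*n≢0 4 V}}) ⟩
      fromℕ (3 ℕ.* area)     ∎))
      where
      open ≤-Reasoning
      3area<4V : 3 ℕ.* area ℕ.< 4 ℕ.* V
      3area<4V = ℕ.≤-<-trans (ℕ.*-monoʳ-≤ 3 (ℕ.*-mono-≤ (ℕ.<⇒≤ r<L) (ℕ.<⇒≤ r<L))) (ℕ.*-monoˡ-< V {3} {4} ℕ.≤-refl)

    0≤1-rate : 0# ≤ 1# - rate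
    0≤1-rate = x≤y⇒0≤y-x (inj₁ rate<1)

    Lipschitz-iterate : ∀ t {f} → Lipschitz 1# f → Lipschitz ((1# - rate) ^ t) (iterate t f)
    Lipschitz-iterate zero    lip = lip
    Lipschitz-iterate (suc t) lip = contraction (^-nonneg t 0≤1-rate) (Lipschitz-iterate t lip)

    -- Any two configurations differ at no more than n vertices, and each contributes one Lipschitz
    -- constant.
    distance-bound : ∀ t x → totalVariation ((transition ^ᴹ t) x) stationary ≤ fromℕ V * (1# - rate) ^ t
    distance-bound t x = totalVariation-bound t x _ (λ f lip _ X Y → ≤-trans
      (Lipschitz-agree (Lipschitz-iterate t lip) (allFin V) {Y} {X} (λ v v∉ → ⊥-elim (v∉ (∈-allFin v))))
      (≤-reflexive (+-congˡ (*-congʳ (≈-reflexive (cong fromℕ (List.length-tabulate {n = V} (λ i → i))))))))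

    -- At time 0 the oscillation of `f` itself gives 1, where `distance-bound` would give n; this
    -- settles ε ≥ 1.
    distance-bound-0 : ∀ x → totalVariation ((transition ^ᴹ 0) x) stationary ≤ 1#
    distance-bound-0 x = totalVariation-bound 0 x 1# (λ f _ osc → osc)

    -- From geometric decay to the mixing time

    module _ (ε : Carrier) (0<ε : 0# < ε) (ε≤n : ε ≤ fromℕ V) (ℓ : Carrier) (log : IsLog (fromℕ V / ε) ℓ) where

      A N bound : Carrier
      A = fromℕ (r ℕ.^ 2)
      N = fromℕ V
      bound = (fromℕ 2 * N * ℓ) / A

      r²≡area : r ℕ.^ 2 ≡ area
      r²≡area = cong (r ℕ.*_) (ℕ.*-identityʳ r)

      0<A : 0# < A
      0<A = subst (λ k → 0# < fromℕ k) (≡.sym r²≡area) (fromℕ-pos area)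

      A≤N : A ≤ N
      A≤N = fromℕ-mono-≤ (subst (ℕ._≤ V) (≡.sym r²≡area) (ℕ.*-mono-≤ (ℕ.<⇒≤ r<L) (ℕ.<⇒≤ r<L)))

      0≤ℓ : 0# ≤ ℓ
      0≤ℓ = log-nonneg log (y*z≤x⇒z≤x/y 0<ε (≤-trans (≤-reflexive (*-identityʳ ε)) ε≤n))

      0≤bound : 0# ≤ bound
      0≤bound = /-nonneg (*-nonneg (*-nonneg (fromℕ-nonneg 2) (fromℕ-nonneg V)) 0≤ℓ) 0<A

      x₀ : Config V q
      x₀ = Vec.replicate V (colour q 0<q)
        where
        colour : ∀ q → 0# < fromℕ q → Fin q
        colour zero    0<0 = ⊥-elim (<-irrefl ≈-refl 0<0)
        colour (suc q) _   = zero

      mixingTime-at : ∀ T → fromℕ T ≤ bound → (∀ x → totalVariation ((transition ^ᴹ T) x) stationary ≤ ε) →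
        ∃[ τ ] IsMixingTime transition stationary ε τ × fromℕ τ ≤ bound
      mixingTime-at T T≤bound close = proj₁ bounded , proj₁ (proj₂ bounded) ,
        ≤-trans (fromℕ-mono-≤ (proj₂ (proj₂ bounded))) T≤bound
        where
        bounded : ∃[ τ ] IsMixingTime transition stationary ε τ × τ ℕ.≤ T
        bounded = mixingTime-≤ transition stationary ε T x₀ close

      module LateTime (ε<1 : ε < 1#) (T : ℕ) (bound<1+T : bound < fromℕ (suc T)) where
        open ≤-Reasoning
        -- As r ≥ 1, the window alone needs L ≥ r + 2 ≥ 3.
        9≤V : 9 ℕ.≤ V
        9≤V = ℕ.*-mono-≤ 3≤L 3≤L
          where
          3≤L : 3 ℕ.≤ L
          3≤L = ℕ.≤-trans (s≤s (s≤s (ℕ.>-nonZero⁻¹ r))) 1+r<L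
        3≤2ℓ : fromℕ 3 ≤ fromℕ 2 * ℓ
        3≤2ℓ = log-9 log (y*z≤x⇒z≤x/y 0<ε (begin
          ε * fromℕ 9  ≤⟨ *-monoʳ-≤ (fromℕ-nonneg 9) (inj₁ ε<1) ⟩
          1# * fromℕ 9 ≈⟨ *-identityˡ _ ⟩
          fromℕ 9      ≤⟨ fromℕ-mono-≤ 9≤V ⟩
          N            ∎))
        t : Carrier
        t = fromℕ T
        -- Rounding down gives r² (1 + T) ≥ 2nℓ. Hence 4nℓ = 6nℓ - 2nℓ ≤ 3r² (1 + T) - 3r² = 3r² T,
        -- where 2ℓ ≥ 3 and n ≥ r² pay for the lost step.
        ℓ≤T*rate : ℓ ≤ t * rate
        ℓ≤T*rate = *-cancelˡ-≤ (fromℕ-pos (4 ℕ.* V) {{ℕ.m*n≢0 4 V}}) (begin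
          fromℕ (4 ℕ.* V) * ℓ ≈⟨ ≈-trans (*-congʳ (fromℕ-* 4 V))
            (solve 2 (λ n l → con (ℤ.+ 4) :* n :* l := con (ℤ.+ 3) :* (con (ℤ.+ 2) :* n :* l) :- n :* (con (ℤ.+ 2) :* l)) ≈-refl N ℓ) ⟩
          fromℕ 3 * (fromℕ 2 * N * ℓ) - N * (fromℕ 2 * ℓ)
            ≤⟨ +-mono-≤ (*-monoˡ-≤ (fromℕ-nonneg 3) (≤-trans (≤-reflexive (≈-sym (y*[x/y]≈x 0<A))) (*-monoˡ-≤ (inj₁ 0<A) (inj₁ bound<1+T))))
                 (neg-mono-≤ (*-mono-≤ (fromℕ-nonneg 3) (fromℕ-nonneg V) A≤N 3≤2ℓ)) ⟩
          fromℕ 3 * (A * (1# + t)) - A * fromℕ 3 ≈⟨ solve 3 (λ o t a → con (ℤ.+ 3) :* (a :* (o :+ t)) :- a :* con (ℤ.+ 3) :=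
                con (ℤ.+ 3) :* (a :* (o :+ t)) :- con (ℤ.+ 3) :* a) ≈-refl 1# t A ⟩
          fromℕ 3 * (A * (1# + t)) - fromℕ 3 * A
            ≈⟨ +-congʳ (*-congˡ (≈-trans (distribˡ A 1# t) (+-congʳ (*-identityʳ A)))) ⟩
          fromℕ 3 * (A + A * t) - fromℕ 3 * A
            ≈⟨ solve 2 (λ a t → con (ℤ.+ 3) :* (a :+ a :* t) :- con (ℤ.+ 3) :* a := t :* (con (ℤ.+ 3) :* a)) ≈-refl A t ⟩
          t * (fromℕ 3 * A)
            ≈⟨ *-congˡ (≈-trans (*-congˡ (≈-reflexive (cong fromℕ r²≡area))) (≈-sym (fromℕ-* 3 area))) ⟩
          t * fromℕ (3 ℕ.* area) ≈⟨ *-congˡ (y*[x/y]≈x (fromℕ-pos (4 ℕ.* V) {{ℕ.m*n≢0 4 V}})) ⟨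
          t * (fromℕ (4 ℕ.* V) * rate) ≈⟨ solve 3 (λ a b c → a :* (b :* c) := b :* (a :* c)) ≈-refl t (fromℕ (4 ℕ.* V)) rate ⟩
          fromℕ (4 ℕ.* V) * (t * rate) ∎)
        0≤rate : 0# ≤ rate
        0≤rate = /-nonneg (fromℕ-nonneg (3 ℕ.* area)) (fromℕ-pos (4 ℕ.* V) {{ℕ.m*n≢0 4 V}})
        N[1-rate]^T≤ε : N * (1# - rate) ^ T ≤ ε
        N[1-rate]^T≤ε = begin
          N * c             ≈⟨ *-congʳ (y*[x/y]≈x 0<ε) ⟨
          (ε * (N / ε)) * c ≈⟨ solve 3 (λ a b c → (a :* b) :* c := a :* (c :* b)) ≈-refl ε (N / ε) c ⟩
          ε * (c * (N / ε)) ≤⟨ *-monoˡ-≤ (inj₁ 0<ε) (exp-upper T log 0≤ℓ 0≤rate rate<1 ℓ≤T*rate) ⟩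
          ε * 1#            ≈⟨ *-identityʳ ε ⟩
          ε                 ∎
          where c = (1# - rate) ^ T

      mixingTime-bound : ∃[ τ ] IsMixingTime transition stationary ε τ × fromℕ τ ≤ bound
      mixingTime-bound = [ early , late ]′ (≤-or-< 1# ε)
        where
        early : 1# ≤ ε → ∃[ τ ] IsMixingTime transition stationary ε τ × fromℕ τ ≤ bound
        early 1≤ε = mixingTime-at 0 0≤bound (λ x → ≤-trans (distance-bound-0 x) 1≤ε)
        late : ε < 1# → ∃[ τ ] IsMixingTime transition stationary ε τ × fromℕ τ ≤ bound
        late ε<1 = at-floor (floor bound 0≤bound)
          where
          at-floor : ∃[ T ] fromℕ T ≤ bound × bound < fromℕ (suc T) →
                     ∃[ τ ] IsMixingTime transition stationary ε τ × fromℕ τ ≤ bound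
          at-floor (T , T≤bound , bound<1+T) = mixingTime-at T T≤bound
            (λ x → ≤-trans (distance-bound T x) (LateTime.N[1-rate]^T≤ε ε<1 T bound<1+T))

theorem2p10 :
  (ℝ : RealNumbers) →
  let open RealNumbers ℝ
      open Chains ℝ
  in
  (L r q : ℕ) → .{{_ : NonTrivial L}} → .{{_ : NonZero r}} → r ℕ.≤ L ℕ.∸ 2 →
  let n = L ℕ.* L
      G = toroidalGrid L
      𝒮 = subgrids L r
      ψ = uniform 𝒮
  in
  (λ′ : Carrier) → 1# < λ′ →
  -- p = λ^(2 + 2/r)
  (p : Carrier) → IsRationalPower λ′ (2 ℕ.* r ℕ.+ 2) r p →
  fromℕ (2 ℕ.^ (r ℕ.^ 2 ℕ.+ 8 ℕ.* r ℕ.+ 3)) * fromℕ (r ℕ.^ (2 ℕ.* r ℕ.^ 2 ℕ.+ 4 ℕ.* r ℕ.+ 1)) * p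
    ≤ fromℕ q →
  -- for ε > n the bound is negative
  (ε : Carrier) → 0# < ε → ε ≤ fromℕ n →
  -- ℓ = log(n/ε)
  (ℓ : Carrier) → IsLog (fromℕ n / ε) ℓ →
  ∃[ τ ] IsMixingTime {n} {q} (blockDynamics 𝒮 ψ G λ′) (gibbs G λ′) ε τ ×
         fromℕ τ ≤ (fromℕ 2 * fromℕ n * ℓ) / fromℕ (r ℕ.^ 2)
theorem2p10 ℝ L r q r≤L-2 λ′ 1<λ′ p power q-large ε 0<ε ε≤n ℓ log =
  PottsDynamics.Blocks.mixingTime-bound ℝ L r q r≤L-2 λ′ 1<λ′ p power q-large ε 0<ε ε≤n ℓ log
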